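{- Let $G$ be a finite simple undirected graph of order $n$ and minimum degree $\delta$, with toughness $\tau(G) > 1$. If $\delta \geq \frac{1}{3}(n-2)$, then each longest cycle in $G$ is a dominating cycle.
   Context: The order $n$ of $G$ is its number of vertices, and $\delta$ is its minimum vertex degree. For $S\subseteq V(G)$, $G\backslash S$ is the subgraph of $G$ induced by $V(G)\backslash S$, and for a subgraph $H$, $G\backslash H$ means $G\backslash V(H)$. Let $s(H)$ denote the number of connected components of a graph $H$. For real $t$, $G$ is $t$-tough if $|S|\ge t\, s(G\backslash S)$ for every $S\subseteq V(G)$ with $s(G\backslash S)>1$. The toughness $\tau(G)$ is the maximum $t$ for which $G$ is $t$-tough, with $\tau(K_n)=\infty$ for all $n\ge 1$. A cycle of length $t$ is a sequence $v_1v_2\dots v_tv_1$ of distinct vertices $v_1,\dots,v_t$ with $v_iv_{i+1}\in E(G)$ for each $i\in\{1,\dots,t\}$, where $v_{t+1}=v_1$. By convention, a single edge counts as a cycle of length $2$ and a single vertex as a cycle of length $1$. A longest cycle is one of maximum length in $G$. A cycle $C$ in $G$ is dominating if $G\backslash C$ has no edges. -}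

module Defs where

open import Level using (0ℓ)
open import Data.Nat.Base as ℕ using (ℕ)
open import Data.Integer.Base using (+_)
open import Data.Rational.Base as ℚ using (ℚ; _/_)
open import Data.Fin.Base using (Fin)
open import Data.Fin.Properties using (≡-setoid)
open import Data.Fin.Subset using (Subset; ∣_∣; ∁) renaming (_∈_ to _∈ₛ_)
open import Data.List.Base using (List; []; _∷_; _++_; length)
open import Data.List.Membership.Propositional using (_∉_)
open import Data.List.Relation.Unary.Linked using (Linked)
open import Data.List.Relation.Unary.Unique.Propositional using (Unique)
open import Data.Product.Base using (_×_; _,_; proj₁; ∃)
open import Data.Vec.Base using (tabulate)
open import Function.Base using (_∘_)
open import Function.Bundles using (Inverse)
open import Relation.Binary.Bundles using (Setoid)
open import Relation.Binary.Core using (Rel)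
open import Relation.Binary.Definitions using (Symmetric; Irreflexive; Decidable)
open import Relation.Binary.Construct.Closure.ReflexiveTransitive
  using (Star; ε; _◅◅_; reverse)
import Relation.Binary.Construct.On as On
open import Relation.Binary.PropositionalEquality.Core using (_≡_; _≢_)
open import Relation.Nullary.Decidable.Core using (does)
open import Relation.Nullary.Negation.Core using (¬_)
open import Relation.Nullary.Construct.Add.Supremum using (_⁺; ⊤⁺; [_])

-- Decidability of adjacency is part of the data: without it a finite graph
-- would have no degrees as natural numbers constructively.
record Graph (n : ℕ) : Set₁ where
  field
    Adj    : Rel (Fin n) 0ℓ
    sym    : Symmetric Adj
    irrefl : Irreflexive _≡_ Adj
    adj?   : Decidable Adj

module _ {n : ℕ} (G : Graph n) where
  open Graph G

  neighbours : Fin n → Subset n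
  neighbours v = tabulate (does ∘ adj? v)

  degree : Fin n → ℕ
  degree v = ∣ neighbours v ∣

  -- In particular n > 0.
  IsMinDegree : ℕ → Set
  IsMinDegree δ = (∃ λ v → degree v ≡ δ) × (∀ v → δ ℕ.≤ degree v)

  Complete : Set
  Complete = ∀ {u v} → u ≢ v → Adj u v

  InducedAdj : Subset n → Rel (Fin n) 0ℓ
  InducedAdj W u v = u ∈ₛ W × v ∈ₛ W × Adj u v

  walkSetoid : Subset n → Setoid 0ℓ 0ℓ
  walkSetoid W = record
    { Carrier       = Fin n
    ; _≈_           = Star (InducedAdj W)
    ; isEquivalence = record
      { refl  = ε
      ; sym   = reverse (λ (u∈W , v∈W , uv) → v∈W , u∈W , sym uv)
      ; trans = _◅◅_
      }
    }

  -- The elements of W, identified when joined by a walk inside W: its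
  -- classes are the connected components of the subgraph induced by W.
  componentSetoid : Subset n → Setoid 0ℓ 0ℓ
  componentSetoid W = On.setoid (walkSetoid W) (proj₁ {B = _∈ₛ W})

  -- The subgraph induced by W has exactly k connected components.
  HasComponents : Subset n → ℕ → Set
  HasComponents W k = Inverse (componentSetoid W) (≡-setoid k)

  Tough : ℚ → Set
  Tough t = ∀ S s → HasComponents (∁ S) s → 1 ℕ.< s →
            t ℚ.* (+ s / 1) ℚ.≤ + ∣ S ∣ / 1

  -- For a non-complete graph the greatest real t is a minimum of finitely
  -- many ratios ∣ S ∣ / s, hence rational. A complete graph is t-tough for
  -- every t, so no finite value qualifies, and it is given the value ∞.
  IsToughness : ℚ ⁺ → Set
  IsToughness [ τ ] = Tough τ × (∀ t → Tough t → t ℚ.≤ τ)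
  IsToughness ⊤⁺    = Complete

  -- v₁ … vₜ is listed once; the edges are those of v₁ v₂ … vₜ v₁. For t = 2
  -- this is a single edge, and t = 1 is allowed without any edge.
  data IsCycle : List (Fin n) → Set where
    single : ∀ v → IsCycle (v ∷ [])
    closed : ∀ {v w vs} → Unique (v ∷ w ∷ vs) →
             Linked Adj ((v ∷ w ∷ vs) ++ v ∷ []) → IsCycle (v ∷ w ∷ vs)

  IsLongestCycle : List (Fin n) → Set
  IsLongestCycle C = IsCycle C × (∀ D → IsCycle D → length D ℕ.≤ length C)

  Dominating : List (Fin n) → Set
  Dominating C = ∀ {u v} → u ∉ C → v ∉ C → ¬ Adj u v

{-# OPTIONS --safe #-}

-- Suppose some longest cycle misses an edge, and choose a longest cycle C and a
-- path P = x … y off C with k ≥ 2 vertices, k as large as possible. All other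
-- neighbours of x and y off P then lie on C, and they cut C into arcs. An arc
-- from a neighbour of x to a neighbour of y has at least k inner vertices, any
-- other arc at least one; with n ≤ 3δ + 2 this forces N(x) and N(y) to agree on
-- C (up to one vertex each when k = 2) and all arcs to have k inner vertices,
-- up to a total excess of at most 3. This needs x to have enough neighbours on
-- C: otherwise x lies on a cycle D off C with |D| ≥ δ − 1, three disjoint paths
-- join D to C by Menger's theorem (τ > 1 excludes cuts of two vertices), and
-- rerouting C through D gives n ≥ 3|D| + 6.
--
-- Let S be the set of the s attachment vertices on C. Two arcs joined off S
-- have total excess at least 2, again by rerouting. As τ > 1, G − S has fewer
-- than s components, so at least two such links are needed among P and the
-- s arcs. Each remaining distribution of the excess is excluded by one of two
-- moves: replacing an arc by P gives a new longest cycle, for which the ends of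
-- the arc must again have the same neighbours; and if all links pass through
-- one vertex b (or two), then S together with b is a cut violating τ > 1.

module Submission where

open import Defs
open import Data.Nat.Base using (ℕ)
open import Data.List.Base using (List)
open import Data.Fin.Base using (Fin)

-- The constants come from one count. If x and y have the same c neighbours on C and |P| = 2 + j,
-- then δ + 1 ≤ c + 2 + j and n ≤ 3δ + 2 leave at most 2c + 3 + 2j inner vertices for the arcs,
-- which need c(2 + j); the excess is at most 3 - j(c - 2). So c = 2 is the obstacle: a third
-- neighbour is what the outside cycle D has to supply, or else δ ≤ 3 makes the graph tiny.
--
-- A link between two arcs serves two reroutings, one giving up the parts of the arcs before it, the
-- other the parts behind it. Each must make room for P. This is why a link costs excess 2, and why
-- its ends can be located within the arcs.
--
-- P is maximal among the paths outside all longest cycles, not only outside C. An arc thrown out in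
-- favour of P is therefore again extremal and inherits whatever was proved for P.
--
-- Components are never counted: labels that no link changes, with one representative for each
-- label, bound their number from below.

-- Lists without repetition

module Lists where

  open import Data.Fin.Properties using (_≟_)
  open import Data.Nat.Base using (_≤_; z≤n; s≤s)
  open import Data.Nat.Properties using (≤-trans; ≤-reflexive; 1+n≰n)
  open import Data.List.Base using ([]; _∷_; _++_; length)
  open import Data.List.Properties using (length-tabulate)
  open import Data.List.Membership.Propositional using (_∈_; _∉_)
  open import Data.List.Membership.Propositional.Properties using (∈-++⁺ʳ; ∈-∃++; ∈-allFin)
  open import Data.List.Relation.Unary.Any using (here; there)
  open import Data.List.Relation.Unary.All as All using (All; []; _∷_)
  import Data.List.Relation.Unary.All.Properties as All
  open import Data.List.Relation.Unary.AllPairs using ([]; _∷_)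
  open import Data.List.Relation.Unary.Unique.Propositional using (Unique)
  import Data.List.Relation.Unary.Unique.Propositional.Properties as Unique
  open import Data.List.Relation.Binary.Permutation.Propositional using (_↭_; ↭-sym; ↭⇒↭ₛ)
  import Data.List.Relation.Binary.Permutation.Propositional.Properties as Perm
  import Data.List.Relation.Binary.Permutation.Setoid.Properties as PermS
  import Algebra.Solver.CommutativeMonoid as CMSolver
  open import Data.Product.Base using (_,_)
  open import Data.Empty using (⊥-elim)
  open import Relation.Nullary using (yes; no)
  open import Relation.Binary.PropositionalEquality using (refl; sym; subst; setoid)

  module _ {A : Set} where

    Unique-↭ : {xs ys : List A} → xs ↭ ys → Unique xs → Unique ys
    Unique-↭ p = PermS.Unique-resp-↭ (setoid A) (↭⇒↭ₛ p)

    Unique-++⁻ʳ : ∀ xs {ys : List A} → Unique (xs ++ ys) → Unique ys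
    Unique-++⁻ʳ []       u       = u
    Unique-++⁻ʳ (_ ∷ xs) (_ ∷ u) = Unique-++⁻ʳ xs u

    Unique-++⁻ˡ : ∀ xs {ys : List A} → Unique (xs ++ ys) → Unique xs
    Unique-++⁻ˡ []       u       = []
    Unique-++⁻ˡ (_ ∷ xs) (p ∷ u) = All.++⁻ˡ xs p ∷ Unique-++⁻ˡ xs u

    Unique-disjoint : ∀ xs {ys : List A} {x} → Unique (xs ++ ys) → x ∈ xs → x ∉ ys
    Unique-disjoint (_ ∷ xs) (p ∷ _) (here refl) y = All.lookup p (∈-++⁺ʳ xs y) refl
    Unique-disjoint (_ ∷ xs) (_ ∷ u) (there x)   y = Unique-disjoint xs u x y

    Unique-∷ : ∀ {x} {xs : List A} → x ∉ xs → Unique xs → Unique (x ∷ xs)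
    Unique-∷ x∉ u = All.tabulate (λ y∈ eq → x∉ (subst (_∈ _) (sym eq) y∈)) ∷ u

    Unique-part : ∀ {xs} (ys : List A) {zs} → ys ++ zs ↭ xs → Unique xs → Unique ys
    Unique-part ys p u = Unique-++⁻ˡ ys (Unique-↭ (↭-sym p) u)

    Unique-⊆-length : ∀ {xs ys : List A} → Unique xs → (∀ {v} → v ∈ xs → v ∈ ys) →
                      length xs ≤ length ys
    Unique-⊆-length {[]}     _       _  = z≤n
    Unique-⊆-length {x ∷ xs} (p ∷ u) xs⊆ with ∈-∃++ (xs⊆ (here refl))
    ... | as , bs , refl = ≤-trans (s≤s (Unique-⊆-length u sub))
                             (≤-reflexive (sym (Perm.↭-length (Perm.shift x as bs))))
      where
      sub : ∀ {v} → v ∈ xs → v ∈ as ++ bs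
      sub v∈ with Perm.∈-resp-↭ (Perm.shift x as bs) (xs⊆ (there v∈))
      ... | here refl = ⊥-elim (All.lookup p v∈ refl)
      ... | there q   = q

  module _ {m : ℕ} where

    open import Data.List.Membership.DecPropositional (_≟_ {m}) using (_∈?_)

    Unique-length≤ : {xs : List (Fin m)} → Unique xs → length xs ≤ m
    Unique-length≤ u = ≤-trans (Unique-⊆-length u (λ {v} _ → ∈-allFin v))
                               (≤-reflexive (length-tabulate (λ i → i)))

    Unique-⊇ : {xs ys : List (Fin m)} → Unique xs → (∀ {v} → v ∈ xs → v ∈ ys) →
               length ys ≤ length xs → ∀ {v} → v ∈ ys → v ∈ xs
    Unique-⊇ {xs} {ys} u s l {v} v∈ with v ∈? xs
    ... | yes p = p
    ... | no ¬p = ⊥-elim (1+n≰n (≤-trans (Unique-⊆-length (Unique-∷ ¬p u) s′) l))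
      where
      s′ : ∀ {w} → w ∈ v ∷ xs → w ∈ ys
      s′ (here refl) = v∈
      s′ (there q)   = s q

    module ListSolver = CMSolver (Perm.++-commutativeMonoid {A = Fin m})

-- The count of vertices against degrees

module Arithmetic where

  open import Data.Nat.Base
  open import Data.Nat.Properties
  open import Data.Nat.Tactic.RingSolver using (solve-∀)
  open import Data.Product.Base using (_×_; _,_)
  open import Data.Sum.Base using (_⊎_; inj₁; inj₂)
  open import Data.Empty using (⊥-elim)
  open import Function.Base using (case_of_)
  open import Relation.Binary.PropositionalEquality

  -- Every estimate below is brought to a common summand `K` on both sides, so that it reduces to
  -- two ring identities.
  cancel-≤ : ∀ K {a b A B} → A ≡ K + a → B ≡ K + b → A ≤ B → a ≤ b
  cancel-≤ K refl refl l = +-cancelˡ-≤ K _ _ l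

  -- Relative to `c` arcs of `2 + j` inner vertices each, the alternatives allow a total excess of
  -- 1, of 3 when `j` is 0, and of 2 when `j` is 1.
  EvenBound : ℕ → ℕ → ℕ → Set
  EvenBound j c Q = Q ≤ c * (2 + j) + 1 ⊎ (j ≡ 0 × Q ≤ c * 2 + 3) ⊎ (j ≡ 1 × Q ≤ c * 3 + 2)

  -- j = |P| − 2; c, p, q count the vertices of C joined to both ends of P, only
  -- to its first end, only to its last end; Q is the number of other vertices
  -- of C, and tX, tY count the changes of letter along C.
  module _ {j c p q Q n δ tX tY : ℕ}
           (δx : δ + 1 ≤ c + p + (2 + j)) (δy : δ + 1 ≤ c + q + (2 + j))
           (n≤ : n ≤ 3 * δ + 2) (≤n : (2 + j) + (c + p + q) + Q ≤ n)
           (2≤x : 2 ≤ c + p) (2≤y : 2 ≤ c + q) (small : 3 ≤ c + p ⊎ δ ≤ 3)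
           (turnX : 1 ≤ p → 1 ≤ c + q → 1 ≤ tX) (turnY : 1 ≤ q → 1 ≤ c + p → 1 ≤ tY)
           (low : c * (2 + j) + p + q + (1 + j) * (tX + tY) ≤ Q) where

    private
      -- Adding one turns `n ≤ 3 * δ + 2` into `n + 1 ≤ 3 * (δ + 1)`, and `δ + 1` is what the degree
      -- hypotheses bound.
      upper : ∀ {D} → δ + 1 ≤ D → (2 + j) + (c + p + q) + Q + 1 ≤ 3 * D
      upper {D} h = begin
        (2 + j) + (c + p + q) + Q + 1 ≤⟨ +-monoˡ-≤ 1 (≤-trans ≤n n≤) ⟩
        3 * δ + 2 + 1                 ≡⟨ arith δ ⟩
        3 * (δ + 1)                   ≤⟨ *-monoʳ-≤ 3 h ⟩
        3 * D                         ∎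
        where
        open ≤-Reasoning
        arith : ∀ δ → 3 * δ + 2 + 1 ≡ 3 * (δ + 1)
        arith = solve-∀

      lower : ∀ {t} → t ≤ tX + tY →
              (2 + j) + (c + p + q) + (c * (2 + j) + p + q + (1 + j) * t) + 1 ≤ (2 + j) + (c + p + q) + Q + 1
      lower h = +-monoˡ-≤ 1 (+-monoʳ-≤ ((2 + j) + (c + p + q)) (≤-trans (+-monoʳ-≤ (c * (2 + j) + p + q) (*-monoʳ-≤ (1 + j) h)) low))

    -- A neighbour of one end only helps one of the two degrees, yet it occupies a mark and an inner
    -- vertex of C, and the change of letter that it causes costs `1 + j` further inner vertices.
    -- With at least two neighbours for each end this is affordable only if `j` is 0 and each end
    -- has at most one such neighbour.
    letter-count-cases : (j ≡ 0 × p ≤ 1 × q ≤ 1 × Q ≤ (c + p + q) * 2) ⊎ (p ≡ 0 × q ≡ 0 × EvenBound j c Q)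
    letter-count-cases = go p q refl refl
      where
      go : ∀ p′ q′ → p ≡ p′ → q ≡ q′ →
           (j ≡ 0 × p ≤ 1 × q ≤ 1 × Q ≤ (c + p + q) * 2) ⊎ (p ≡ 0 × q ≡ 0 × EvenBound j c Q)
      go zero zero refl refl = inj₂ (refl , refl , even j refl c refl)
        where
        Q≤ : Q ≤ 2 * c + 3 + 2 * j
        Q≤ = cancel-≤ (3 + j + c) (a₁ j c Q) (a₂ j c) (upper δx)
          where
          a₁ : ∀ j c Q → 2 + j + (c + 0 + 0) + Q + 1 ≡ 3 + j + c + Q
          a₁ = solve-∀
          a₂ : ∀ j c → 3 * (c + 0 + (2 + j)) ≡ 3 + j + c + (2 * c + 3 + 2 * j)
          a₂ = solve-∀
        -- For `c = 2` the bound `Q≤` leaves an excess of 3 whatever `j` is. There `small` yields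
        -- `δ ≤ 3`, hence `n ≤ 11`, which is far stronger.
        tiny : δ ≤ 3 → (2 + j) + c + Q ≤ 11
        tiny δ≤3 = ≤-trans (≤-reflexive (a₁ j c Q)) (≤-trans ≤n (≤-trans n≤ (+-monoˡ-≤ 2 (*-monoʳ-≤ 3 δ≤3))))
          where
          a₁ : ∀ j c Q → (2 + j) + c + Q ≡ 2 + j + (c + 0 + 0) + Q
          a₁ = solve-∀
        Goal : ℕ → ℕ → Set
        Goal j c = EvenBound j c Q
        even : ∀ j′ → j ≡ j′ → ∀ c′ → c ≡ c′ → Goal j c
        even 0 refl _ _ = inj₂ (inj₁ (refl , ≤-trans Q≤ (≤-reflexive (a c))))
          where
          a : ∀ c → 2 * c + 3 + 0 ≡ c * 2 + 3
          a = solve-∀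
        even (suc _) _ 0 refl = ⊥-elim (<⇒≱ 2≤x z≤n)
        even (suc _) _ 1 refl = ⊥-elim (<⇒≱ 2≤x (s≤s z≤n))
        even 1 refl 2 refl = case small of λ
          { (inj₁ l) → ⊥-elim (<⇒≱ l (s≤s (s≤s z≤n)))
          ; (inj₂ l) → inj₂ (inj₂ (refl , ≤-trans (+-cancelˡ-≤ 5 Q 6 (tiny l)) (m≤m+n 6 2))) }
        even 1 refl (suc (suc (suc d))) refl = inj₂ (inj₂ (refl , ≤-trans Q≤ (≤-trans (m≤m+n _ d) (≤-reflexive (a d)))))
          where
          a : ∀ d → 2 * (3 + d) + 3 + 2 + d ≡ (3 + d) * 3 + 2
          a = solve-∀
        even (suc (suc i)) refl 2 refl = case small of λ
          { (inj₁ l) → ⊥-elim (<⇒≱ l (s≤s (s≤s z≤n)))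
          ; (inj₂ l) → inj₁ (≤-trans (≤-trans (m≤n+m Q i) (+-cancelˡ-≤ 6 _ _ (≤-trans (≤-reflexive (a₁ i Q)) (tiny l))))
                        (≤-trans (m≤m+n 5 (4 + 2 * i)) (≤-reflexive (a₂ i)))) }
          where
          a₁ : ∀ i Q → 6 + (i + Q) ≡ 2 + (2 + i) + 2 + Q
          a₁ = solve-∀
          a₂ : ∀ i → 5 + (4 + 2 * i) ≡ 2 * (2 + (2 + i)) + 1
          a₂ = solve-∀
        even (suc (suc i)) refl (suc (suc (suc d))) refl =
          inj₁ (≤-trans Q≤ (≤-trans (m≤m+n _ (2 * d + i + d * i)) (≤-reflexive (a d i))))
          where
          a : ∀ d i → 2 * (3 + d) + 3 + 2 * (2 + i) + (2 * d + i + d * i) ≡ (3 + d) * (2 + (2 + i)) + 1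
          a = solve-∀
      go zero (suc r) refl refl = inj₁ (only c refl)
        where
        few : c * j + 2 * r ≤ j
        few = cancel-≤ (6 + 2 * j + 3 * c) (a₁ j c r) (a₂ j c)
                    (≤-trans (lower (≤-trans (turnY (s≤s z≤n) (≤-trans (s≤s z≤n) 2≤x)) (m≤n+m tY tX))) (upper δx))
          where
          a₁ : ∀ j c r → 2 + j + (c + 0 + suc r) + (c * (2 + j) + 0 + suc r + (1 + j) * 1) + 1
                       ≡ 6 + 2 * j + 3 * c + (c * j + 2 * r)
          a₁ = solve-∀
          a₂ : ∀ j c → 3 * (c + 0 + (2 + j)) ≡ 6 + 2 * j + 3 * c + j
          a₂ = solve-∀
        only : ∀ c′ → c ≡ c′ → j ≡ 0 × 0 ≤ 1 × suc r ≤ 1 × Q ≤ (c + 0 + suc r) * 2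
        only 0 refl = ⊥-elim (<⇒≱ 2≤x z≤n)
        only 1 refl = ⊥-elim (<⇒≱ 2≤x (s≤s z≤n))
        only (suc (suc d)) refl = finish (m+n≡0⇒m≡0 j sum0) (m+n≡0⇒m≡0 r (trans (a₀ r) (m+n≡0⇒n≡0 (d * j) (m+n≡0⇒n≡0 j sum0))))
          where
          a₀ : ∀ r → r + r ≡ 2 * r
          a₀ = solve-∀
          sum0 : j + (d * j + 2 * r) ≡ 0
          sum0 = n≤0⇒n≡0 (cancel-≤ j (a₁ j d r) (sym (+-identityʳ j)) few)
            where
            a₁ : ∀ j d r → (2 + d) * j + 2 * r ≡ j + (j + (d * j + 2 * r))
            a₁ = solve-∀
          finish : j ≡ 0 → r ≡ 0 → j ≡ 0 × 0 ≤ 1 × suc r ≤ 1 × Q ≤ (c + 0 + suc r) * 2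
          finish refl refl = refl , z≤n , s≤s z≤n , cancel-≤ (4 + c) (a₁ c Q) (a₂ c) (upper δx)
            where
            a₁ : ∀ c Q → 2 + (c + 0 + 1) + Q + 1 ≡ 4 + c + Q
            a₁ = solve-∀
            a₂ : ∀ c → 3 * (c + 0 + 2) ≡ 4 + c + (c + 0 + 1) * 2
            a₂ = solve-∀
      go (suc r) zero refl refl = inj₁ (only c refl)
        where
        few : c * j + 2 * r ≤ j
        few = cancel-≤ (6 + 2 * j + 3 * c) (a₁ j c r) (a₂ j c)
                    (≤-trans (lower (≤-trans (turnX (s≤s z≤n) (≤-trans (s≤s z≤n) 2≤y)) (m≤m+n tX tY))) (upper δy))
          where
          a₁ : ∀ j c r → 2 + j + (c + suc r + 0) + (c * (2 + j) + suc r + 0 + (1 + j) * 1) + 1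
                       ≡ 6 + 2 * j + 3 * c + (c * j + 2 * r)
          a₁ = solve-∀
          a₂ : ∀ j c → 3 * (c + 0 + (2 + j)) ≡ 6 + 2 * j + 3 * c + j
          a₂ = solve-∀
        only : ∀ c′ → c ≡ c′ → j ≡ 0 × suc r ≤ 1 × 0 ≤ 1 × Q ≤ (c + suc r + 0) * 2
        only 0 refl = ⊥-elim (<⇒≱ 2≤y z≤n)
        only 1 refl = ⊥-elim (<⇒≱ 2≤y (s≤s z≤n))
        only (suc (suc d)) refl = finish (m+n≡0⇒m≡0 j sum0) (m+n≡0⇒m≡0 r (trans (a₀ r) (m+n≡0⇒n≡0 (d * j) (m+n≡0⇒n≡0 j sum0))))
          where
          a₀ : ∀ r → r + r ≡ 2 * r
          a₀ = solve-∀
          sum0 : j + (d * j + 2 * r) ≡ 0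
          sum0 = n≤0⇒n≡0 (cancel-≤ j (a₁ j d r) (sym (+-identityʳ j)) few)
            where
            a₁ : ∀ j d r → (2 + d) * j + 2 * r ≡ j + (j + (d * j + 2 * r))
            a₁ = solve-∀
          finish : j ≡ 0 → r ≡ 0 → j ≡ 0 × suc r ≤ 1 × 0 ≤ 1 × Q ≤ (c + suc r + 0) * 2
          finish refl refl = refl , s≤s z≤n , z≤n , cancel-≤ (4 + c) (a₁ c Q) (a₂ c) (upper δy)
            where
            a₁ : ∀ c Q → 2 + (c + 1 + 0) + Q + 1 ≡ 4 + c + Q
            a₁ = solve-∀
            a₂ : ∀ c → 3 * (c + 0 + 2) ≡ 4 + c + (c + 1 + 0) * 2
            a₂ = solve-∀
      go (suc a) (suc b) refl refl = inj₁ (only c refl)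
        where
        -- The two degree bounds are added, so that `p` and `q` enter symmetrically and both changes
        -- of letter are counted.
        sum0 : 2 * (c * j) + (a + b) ≡ 0
        sum0 = n≤0⇒n≡0 (cancel-≤ (18 + 6 * j + 6 * c + 3 * (a + b)) (a₁ j c a b) (a₂ j c a b)
                 (+-mono-≤ (≤-trans low₂ (upper δx)) (≤-trans low₂ (upper δy))))
          where
          low₂ = lower (+-mono-≤ (turnX (s≤s z≤n) (≤-trans (s≤s z≤n) 2≤y)) (turnY (s≤s z≤n) (≤-trans (s≤s z≤n) 2≤x)))
          a₁ : ∀ j c a b →
               (2 + j + (c + suc a + suc b) + (c * (2 + j) + suc a + suc b + (1 + j) * 2) + 1) +
               (2 + j + (c + suc a + suc b) + (c * (2 + j) + suc a + suc b + (1 + j) * 2) + 1)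
               ≡ 18 + 6 * j + 6 * c + 3 * (a + b) + (2 * (c * j) + (a + b))
          a₁ = solve-∀
          a₂ : ∀ j c a b → 3 * (c + suc a + (2 + j)) + 3 * (c + suc b + (2 + j))
               ≡ 18 + 6 * j + 6 * c + 3 * (a + b) + 0
          a₂ = solve-∀
        a+b≡0 : a + b ≡ 0
        a+b≡0 = m+n≡0⇒n≡0 (2 * (c * j)) sum0
        only : ∀ c′ → c ≡ c′ → j ≡ 0 × suc a ≤ 1 × suc b ≤ 1 × Q ≤ (c + suc a + suc b) * 2
        only c′ e = finish c′ e (m+n≡0⇒m≡0 a a+b≡0) (m+n≡0⇒n≡0 a a+b≡0) (m+n≡0⇒m≡0 (c * j) (m+n≡0⇒m≡0 (2 * (c * j)) sum0))
          where
          finish : ∀ c′ → c ≡ c′ → a ≡ 0 → b ≡ 0 → c * j ≡ 0 →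
                   j ≡ 0 × suc a ≤ 1 × suc b ≤ 1 × Q ≤ (c + suc a + suc b) * 2
          finish zero refl refl refl _ = ⊥-elim (<⇒≱ 2≤x (s≤s z≤n))
          finish (suc d) refl refl refl cj≡0 with m+n≡0⇒m≡0 j cj≡0
          ... | refl = refl , s≤s z≤n , s≤s z≤n , cancel-≤ (5 + c) (a₁ c Q) (a₂ c) (upper δx)
            where
            a₁ : ∀ c Q → 2 + (c + 1 + 1) + Q + 1 ≡ 5 + c + Q
            a₁ = solve-∀
            a₂ : ∀ c → 3 * (c + 1 + 2) ≡ 5 + c + (c + 1 + 1) * 2
            a₂ = solve-∀

-- From rational toughness to representatives of components

module Components {n : ℕ} (G : Graph n) where

  open Lists
  open import Data.Fin.Base using (zero; suc)
  open import Data.Fin.Properties using (_≟_; suc-injective)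
  open import Data.Fin.Subset using (Subset; ∣_∣; ∁; inside; outside) renaming (_∈_ to _∈ₛ_; _∉_ to _∉ₛ_)
  open import Data.Fin.Subset.Properties using (x∉p⇒x∈∁p; x∈∁p⇒x∉p; _∈?_)
  open import Data.Nat.Base using (zero; suc; _+_; _*_; _≤_; _<_; s≤s; NonZero)
  open import Data.Nat.Properties using (≤-trans; ≤-reflexive; _<?_; <-≤-trans)
  import Data.Nat.Properties as ℕ
  open import Data.Integer.Base as ℤ using (+_)
  import Data.Integer.Properties as ℤ
  open import Data.Rational.Base as ℚ using (ℚ; 1ℚ; _/_)
  import Data.Rational.Properties as ℚ
  open import Data.Rational.Unnormalised.Base as ℚᵘ using (mkℚᵘ; *≤*; *<*)
  import Data.Rational.Unnormalised.Properties as ℚᵘ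
  open import Data.List.Base using ([]; _∷_; length; lookup; allFin; map)
  open import Data.List.Properties using (length-map)
  open import Data.List.Membership.Propositional using (_∈_; _∉_)
  open import Data.List.Membership.Propositional.Properties using (∈-lookup; ∈-allFin; ∈-map⁻)
  open import Data.List.Membership.DecPropositional (_≟_ {n}) using () renaming (_∈?_ to _∈ˡ?_)
  open import Data.List.Relation.Unary.Any as Any using (Any; here; there; index; any?)
  import Data.List.Relation.Unary.Any.Properties as Any
  open import Data.List.Relation.Unary.All as All using (All; []; _∷_)
  import Data.List.Relation.Unary.All.Properties as All
  open import Data.List.Relation.Unary.AllPairs as AllPairs using (AllPairs; []; _∷_)
  open import Data.List.Relation.Unary.Unique.Propositional using (Unique)
  import Data.List.Relation.Unary.Unique.Propositional.Properties as Unique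
  open import Data.Vec.Base using (tabulate; []; _∷_; here; there)
  import Data.Vec.Properties as Vec
  open import Data.Product.Base using (Σ; _×_; _,_; proj₁; ∃)
  open import Data.Empty using (⊥-elim)
  open import Function.Base using (_∘_; case_of_)
  open import Relation.Binary.Construct.Closure.ReflexiveTransitive as Star using (Star; ε; _◅_; _◅◅_)
  open import Relation.Binary.PropositionalEquality
    using (_≡_; refl; sym; trans; cong; subst; subst₂)
  open import Relation.Binary.Construct.Add.Supremum.Strict ℚ._<_ using (_<⁺_; [_]; [_]<⊤⁺)
  open import Relation.Nullary.Construct.Add.Supremum using (⊤⁺; [_])
  open import Relation.Nullary.Decidable using (Dec; yes; no; does; ¬¬-excluded-middle; decidable-stable; dec-true)
  open import Relation.Nullary.Negation using (¬_)

  open Graph G using (Adj; irrefl; adj?) renaming (sym to adj-sym)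

  V : Set
  V = Fin n

  ¬¬-∀Fin : ∀ {m} {P : Fin m → Set} → (∀ i → ¬ ¬ P i) → ¬ ¬ (∀ i → P i)
  ¬¬-∀Fin {zero}  f k = k λ ()
  ¬¬-∀Fin {suc m} f k = f zero λ p → ¬¬-∀Fin (f ∘ suc) λ ps → k λ { zero → p ; (suc i) → ps i }

  module Components (W : Subset n) (conn? : ∀ u v → Dec (Star (InducedAdj G W) u v)) where

    _~_ : V → V → Set
    u ~ v = Star (InducedAdj G W) u v

    ~-sym : ∀ {u v} → u ~ v → v ~ u
    ~-sym = Star.reverse (λ (p , q , e) → q , p , adj-sym e)

    Separated : List V → Set
    Separated = AllPairs (λ u v → ¬ u ~ v)

    -- A maximal separated family meets every component exactly once, so its length is the number of
    -- components. Extending `Rs` instead of the empty list keeps that number at least `length Rs`.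
    saturate : ∀ vs Rs → All (_∈ₛ W) Rs → Separated Rs →
               ∃ λ Rs′ → All (_∈ₛ W) Rs′ × Separated Rs′ × length Rs ≤ length Rs′ ×
                 (∀ {r} → r ∈ Rs → r ∈ Rs′) ×
                 (∀ {v} → v ∈ vs → v ∈ₛ W → Any (v ~_) Rs′)
    saturate []       Rs a s = Rs , a , s , ℕ.≤-refl , (λ p → p) , λ ()
    saturate (v ∷ vs) Rs a s with v ∈? W | any? (conn? v) Rs
    ... | no v∉ | _ = let Rs′ , a′ , s′ , l , i , c = saturate vs Rs a s in
      Rs′ , a′ , s′ , l , i , λ { (here refl) v∈ → ⊥-elim (v∉ v∈) ; (there p) → c p }
    ... | yes _ | yes p = let Rs′ , a′ , s′ , l , i , c = saturate vs Rs a s in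
      Rs′ , a′ , s′ , l , i , λ { (here refl) _ → reach i p ; (there p) → c p }
      where
      reach : ∀ {Rs Rs′} → (∀ {r} → r ∈ Rs → r ∈ Rs′) → Any (v ~_) Rs → Any (v ~_) Rs′
      reach i (here q)  = Any.map (λ { refl → q }) (i (here refl))
      reach i (there p) = reach (i ∘ there) p
    ... | yes v∈ | no ¬p =
      let Rs′ , a′ , s′ , l , i , c = saturate vs (v ∷ Rs) (v∈ ∷ a) (All.¬Any⇒All¬ Rs ¬p ∷ s) in
      Rs′ , a′ , s′ , ≤-trans (ℕ.n≤1+n _) l , i ∘ there ,
      λ { (here refl) _ → Any.map (λ { refl → ε }) (i (here refl)) ; (there p) → c p }

    module _ (Rs : List V) (a : All (_∈ₛ W) Rs) (s : Separated Rs)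
             (c : ∀ {v} → v ∈ₛ W → Any (v ~_) Rs) where

      separated-index : ∀ {Rs} → Separated Rs → ∀ i j → lookup Rs i ~ lookup Rs j → i ≡ j
      separated-index (_ ∷ _) zero    zero    _ = refl
      separated-index {r ∷ Rs} (p ∷ _) zero (suc j) q = ⊥-elim (All.lookup p (∈-lookup {xs = Rs} j) q)
      separated-index {r ∷ Rs} (p ∷ _) (suc i) zero q = ⊥-elim (All.lookup p (∈-lookup {xs = Rs} i) (~-sym q))
      separated-index (_ ∷ s) (suc i) (suc j) q = cong suc (separated-index s i j q)

      to : Σ V (_∈ₛ W) → Fin (length Rs)
      to (v , v∈) = index (c v∈)

      to-~ : ∀ x → proj₁ x ~ lookup Rs (to x)
      to-~ (v , v∈) = Any.lookup-index (c v∈)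

      components : HasComponents G W (length Rs)
      components = record
        { to        = to
        ; from      = λ i → lookup Rs i , All.lookup a (∈-lookup {xs = Rs} i)
        ; to-cong   = λ {x} {y} x~y → separated-index s (to x) (to y) (~-sym (to-~ x) ◅◅ x~y ◅◅ to-~ y)
        ; from-cong = λ { refl → ε }
        ; inverse   = (λ {i} {x} x~i → separated-index s (to x) i (~-sym (to-~ x) ◅◅ x~i))
                    , (λ { {x} refl → ~-sym (to-~ x) })
        }

    separated-components : ∀ Rs → All (_∈ₛ W) Rs → Separated Rs →
                           ∃ λ k → length Rs ≤ k × HasComponents G W k
    separated-components Rs a s =
      let Rs′ , a′ , s′ , l , _ , c = saturate (allFin n) Rs a s in
      length Rs′ , l , components Rs′ a′ s′ (c (∈-allFin _))

  subsetOf : List V → Subset n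
  subsetOf S = tabulate λ v → does (v ∈ˡ? S)

  ∈-subsetOf⁺ : ∀ {S v} → v ∈ S → v ∈ₛ subsetOf S
  ∈-subsetOf⁺ {S} {v} v∈ = Vec.lookup⇒[]= v _ (trans (Vec.lookup∘tabulate _ v) (dec-true (v ∈ˡ? S) v∈))

  ∈-subsetOf⁻ : ∀ {S v} → v ∈ₛ subsetOf S → v ∈ S
  ∈-subsetOf⁻ {S} {v} p with v ∈ˡ? S | trans (sym (Vec.lookup∘tabulate (λ w → does (w ∈ˡ? S)) v)) (Vec.[]=⇒lookup p)
  ... | yes q | _ = q

  members : ∀ {m} → Subset m → List (Fin m)
  members []            = []
  members (inside ∷ p)  = zero ∷ map suc (members p)
  members (outside ∷ p) = map suc (members p)

  length-members : ∀ {m} (p : Subset m) → length (members p) ≡ ∣ p ∣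
  length-members []            = refl
  length-members (inside ∷ p)  = cong suc (trans (length-map suc (members p)) (length-members p))
  length-members (outside ∷ p) = trans (length-map suc (members p)) (length-members p)

  members-unique : ∀ {m} (p : Subset m) → Unique (members p)
  members-unique []            = []
  members-unique (inside ∷ p)  = Unique-∷ (λ q → case ∈-map⁻ suc q of λ { (_ , _ , ()) })
                                   (Unique.map⁺ suc-injective (members-unique p))
  members-unique (outside ∷ p) = Unique.map⁺ suc-injective (members-unique p)

  members⇒∈ : ∀ {m} (p : Subset m) {v} → v ∈ members p → v ∈ₛ p
  members⇒∈ (inside ∷ p) (here refl) = here
  members⇒∈ (inside ∷ p) (there q) with ∈-map⁻ suc q
  ... | _ , r , refl = there (members⇒∈ p r)
  members⇒∈ (outside ∷ p) q with ∈-map⁻ suc q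
  ... | _ , r , refl = there (members⇒∈ p r)

  ∣∣≤length : ∀ (p : Subset n) xs → (∀ {v} → v ∈ₛ p → v ∈ xs) → ∣ p ∣ ≤ length xs
  ∣∣≤length p xs s = ≤-trans (≤-reflexive (sym (length-members p)))
                       (Unique-⊆-length (members-unique p) (s ∘ members⇒∈ p))

  degree≤ : ∀ v xs → (∀ {w} → Adj v w → w ∈ xs) → degree G v ≤ length xs
  degree≤ v xs s = ∣∣≤length (neighbours G v) xs λ {w} p → s (lem p)
    where
    lem : ∀ {w} → w ∈ₛ neighbours G v → Adj v w
    lem {w} p with adj? v w | trans (sym (Vec.lookup∘tabulate (λ w → does (adj? v w)) w)) (Vec.[]=⇒lookup p)
    ... | yes q | _ = q

  Conn : List V → V → V → Set
  Conn S = Star λ u v → u ∉ S × v ∉ S × Adj u v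

  toℚᵘ-/ : ∀ i d .{{_ : NonZero d}} → ℚ.toℚᵘ (i / d) ℚᵘ.≃ i ℚᵘ./ d
  toℚᵘ-/ i (suc d) = ℚ.toℚᵘ-fromℚᵘ (mkℚᵘ i d)

  /1-cancel-< : ∀ {i j} → i / 1 ℚ.< j / 1 → i ℤ.< j
  /1-cancel-< {i} {j} p with ℚᵘ.<-respʳ-≃ (toℚᵘ-/ j 1) (ℚᵘ.<-respˡ-≃ (toℚᵘ-/ i 1) (ℚ.toℚᵘ-mono-< p))
  ... | *<* q = subst₂ ℤ._<_ (ℤ.*-identityʳ i) (ℤ.*-identityʳ j) q

  -- The 2 is moved to the other side among the integers, because `n` may be smaller than 2.
  third-bound : ∀ {n δ} → (+ n ℤ.- + 2) / 3 ℚ.≤ + δ / 1 → n ≤ 3 * δ + 2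
  third-bound {n} {δ} p with ℚᵘ.≤-respʳ-≃ (toℚᵘ-/ (+ δ) 1) (ℚᵘ.≤-respˡ-≃ (toℚᵘ-/ (+ n ℤ.- + 2) 3) (ℚ.toℚᵘ-mono-≤ p))
  ... | *≤* q = ℤ.drop‿+≤+ (subst₂ ℤ._≤_ (l (+ n)) r (ℤ.+-monoˡ-≤ (+ 2) q))
    where
    l : ∀ i → (i ℤ.- + 2) ℤ.* + 1 ℤ.+ + 2 ≡ i
    l i = trans (cong (ℤ._+ + 2) (ℤ.*-identityʳ (i ℤ.- + 2)))
            (trans (ℤ.+-assoc i (ℤ.- + 2) (+ 2)) (ℤ.+-identityʳ i))
    r : + δ ℤ.* + 3 ℤ.+ + 2 ≡ + (3 * δ + 2)
    r = cong (ℤ._+ + 2) (trans (sym (ℤ.pos-* δ 3)) (cong +_ (ℕ.*-comm δ 3)))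

  -- The form in which toughness is applied: vertices pairwise disconnected off `S` stand for
  -- distinct components. Repetitions in the list `S` only weaken the conclusion.
  tough : ∀ τ → IsToughness G τ → [ 1ℚ ] <⁺ τ →
          ∀ S Rs → All (_∉ S) Rs → AllPairs (λ u v → ¬ Conn S u v) Rs →
          2 ≤ length Rs → length Rs < length S
  -- In a complete graph two vertices off `S` are adjacent or equal, so they cannot be disconnected.
  tough ⊤⁺ complete _ S (r₁ ∷ r₂ ∷ Rs) (p₁ ∷ p₂ ∷ _) ((q ∷ _) ∷ _) _ =
    ⊥-elim (q ((p₁ , p₂ , complete λ { refl → q ε }) ◅ ε))
  tough ⊤⁺ complete _ S (r ∷ []) _ _ (s≤s ())
  -- Connectivity is not given as decidable. The goal is, so it may be proved under a double
  -- negation, where connectivity of the finitely many pairs can be assumed decidable.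
  tough [ τ ] (t , _) [ 1<τ ] S Rs a s 2≤ = decidable-stable (length Rs <? length S) λ ¬g →
    ¬¬-∀Fin (λ u → ¬¬-∀Fin (λ v → ¬¬-excluded-middle)) λ conn? →
    let k , l , h = Components.separated-components W conn? Rs a′ (AllPairs.map (_∘ Star.map conv) s)
    in ¬g (ℕ.≤-<-trans l (<-≤-trans (bound k (≤-trans 2≤ l) h) (∣∣≤length (subsetOf S) S ∈-subsetOf⁻)))
    where
    W = ∁ (subsetOf S)
    a′ : All (_∈ₛ W) Rs
    a′ = All.map (λ v∉ → x∉p⇒x∈∁p (v∉ ∘ ∈-subsetOf⁻)) a
    conv : ∀ {u v} → InducedAdj G W u v → u ∉ S × v ∉ S × Adj u v
    conv (p , q , e) = (λ r → x∈∁p⇒x∉p p (∈-subsetOf⁺ r)) , (λ r → x∈∁p⇒x∉p q (∈-subsetOf⁺ r)) , e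
    bound : ∀ k → 2 ≤ k → HasComponents G W k → k < ∣ subsetOf S ∣
    bound (suc k) 2≤k h = ℤ.drop‿+<+ (/1-cancel-< (ℚ.<-≤-trans
      (subst (ℚ._< τ ℚ.* (+ suc k / 1)) (ℚ.*-identityˡ (+ suc k / 1))
        (ℚ.*-monoˡ-<-pos (+ suc k / 1) {{ℚ.normalize-pos (suc k) 1}} 1<τ))
      (t (subsetOf S) (suc k) h 2≤k)))

-- Walks, paths and cycles as lists

module Argument {n : ℕ} (G : Graph n) where

  open Lists
  open Arithmetic
  open Components G
  open import Data.Fin.Base using (zero; suc; toℕ; inject≤)
  open import Data.Fin.Patterns using (0F; 1F; 2F)
  open import Data.Fin.Properties using (_≟_; inject≤-injective)
  open import Data.Nat.Base using (zero; suc; _+_; _*_; _∸_; _≤_; _<_; z≤n; s≤s; s≤s⁻¹)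
  open import Data.Nat.Properties
    using (≤-trans; ≤-reflexive; _<?_; _≤?_; ≮⇒≥; +-cancelˡ-≤; +-cancelʳ-≡; +-mono-≤; +-monoˡ-≤; +-monoʳ-≤;
           m≤m+n; m≤n+m; module ≤-Reasoning)
  import Data.Nat.Properties as ℕ
  open import Data.Nat.Tactic.RingSolver using (solve-∀)
  open import Data.List.Base
    using ([]; _∷_; _++_; [_]; length; lookup; allFin; filter; reverse; map; cartesianProduct)
  open import Data.List.Properties
    using (length-++; length-map; length-reverse; length-tabulate; ++-assoc; ++-identityʳ; unfold-reverse; reverse-++)
  open import Data.List.Membership.Propositional using (_∈_; _∉_; find; lose)
  open import Data.List.Membership.Propositional.Properties
    using (∈-lookup; ∈-allFin; ∈-++⁺ˡ; ∈-++⁺ʳ; ∈-++⁻; ∈-∃++; ∈-insert; ∈-filter⁺; ∈-filter⁻; ∈-map⁺; ∈-map⁻;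
           ∈-tabulate⁻; ∈-cartesianProduct⁺)
  open import Data.List.Membership.DecPropositional (_≟_ {n}) using (_∈?_)
  open import Data.List.Relation.Unary.Any using (Any; here; there; any?; index)
  open import Data.List.Relation.Unary.All as All using (All; []; _∷_)
  import Data.List.Relation.Unary.All.Properties as All
  open import Data.List.Relation.Unary.AllPairs as AllPairs using (AllPairs; []; _∷_)
  import Data.List.Relation.Unary.AllPairs.Properties as AllPairs
  open import Data.List.Relation.Unary.Linked using (Linked; [-]; _∷_)
  open import Data.List.Relation.Unary.Unique.Propositional using (Unique)
  import Data.List.Relation.Unary.Unique.Propositional.Properties as Unique
  open import Data.List.Relation.Binary.Permutation.Propositional
    using (_↭_; ↭-refl; ↭-sym; ↭-trans; ↭-prep; ↭-reflexive; module PermutationReasoning)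
  import Data.List.Relation.Binary.Permutation.Propositional.Properties as Perm
  open import Data.Product.Base using (Σ; _×_; _,_; proj₁; proj₂; ∃; ∃₂)
  open import Data.Sum.Base using (_⊎_; inj₁; inj₂; [_,_]′)
  open import Data.Unit.Base using (⊤; tt)
  open import Data.Empty using (⊥; ⊥-elim)
  open import Function.Base using (_∘_; case_of_)
  open import Relation.Binary.Construct.Closure.ReflexiveTransitive using (ε; _◅_)
  open import Relation.Binary.PropositionalEquality
    using (_≡_; _≢_; refl; sym; trans; cong; cong₂; subst; subst₂; module ≡-Reasoning)
  open import Relation.Nullary.Decidable
    using (Dec; yes; no; ¬?; _×-dec_; _⊎-dec_; ¬¬-excluded-middle; decidable-stable)
  open import Relation.Nullary.Negation using (¬_)
  open Graph G using (Adj; irrefl; adj?) renaming (sym to adj-sym)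
  open ListSolver {n} using (solve; _⊕_; _⊜_)

  -- In Walk u l v the list holds the inner vertices only, in Path R u v l it
  -- holds all of them.
  Walk : V → List V → V → Set
  Walk u []      v = Adj u v
  Walk u (w ∷ l) v = Adj u w × Walk w l v

  data Path (R : V → V → Set) : V → V → List V → Set where
    end : ∀ u → Path R u u (u ∷ [])
    _∷_ : ∀ {u w v l} → R u w → Path R w v l → Path R u v (u ∷ l)

  walk-join : ∀ {u v w} l {m} → Walk u l v → Walk v m w → Walk u (l ++ v ∷ m) w
  walk-join []      a       q = a , q
  walk-join (_ ∷ l) (a , p) q = a , walk-join l p q

  walk-split : ∀ {u v w} l {m} → Walk u (l ++ v ∷ m) w → Walk u l v × Walk v m w
  walk-split []      (a , q) = a , q
  walk-split (_ ∷ l) (a , p) = let p₁ , p₂ = walk-split l p in (a , p₁) , p₂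

  walk-rev : ∀ {u v} l → Walk u l v → Walk v (reverse l) u
  walk-rev []      a = adj-sym a
  walk-rev {u} {v} (w ∷ l) (a , p) =
    subst (λ z → Walk v z u) (sym (unfold-reverse w l))
      (walk-join (reverse l) (walk-rev l p) (adj-sym a))

  path-walk : ∀ {u x y v l} → Adj u x → Path Adj x y l → Adj y v → Walk u l v
  path-walk a (end _)   b = a , b
  path-walk a (c ∷ p) b = a , path-walk c p b

  walk-path : ∀ {u v w m} l → Walk u l v → Path Adj v w m → Path Adj u w (u ∷ l ++ m)
  walk-path []      a       p = a ∷ p
  walk-path (_ ∷ l) (a , q) p = a ∷ walk-path l q p

  path-join : ∀ {a b c d N M} Z → Path Adj a b N → Walk b Z c → Path Adj c d M →
              Path Adj a d (N ++ Z ++ M)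
  path-join Z (end _)   w q = walk-path Z w q
  path-join Z (x ∷ p) w q = x ∷ path-join Z p w q

  path-snoc : ∀ {a b c l} → Path Adj a b l → Adj b c → Path Adj a c (l ++ [ c ])
  path-snoc (end _)   e = e ∷ end _
  path-snoc (x ∷ p) e = x ∷ path-snoc p e

  path-rev : ∀ {a b l} → Path Adj a b l → Path Adj b a (reverse l)
  path-rev (end u) = end u
  path-rev {a} {b} (_∷_ {l = l} x p) =
    subst (Path Adj b a) (sym (unfold-reverse a l)) (path-snoc (path-rev p) (adj-sym x))

  path-head : ∀ {R : V → V → Set} {a b l} → Path R a b l → a ∈ l
  path-head (end _)   = here refl
  path-head (_ ∷ _) = here refl

  path-last : ∀ {R : V → V → Set} {a b l} → Path R a b l → b ∈ l
  path-last (end _)   = here refl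
  path-last (_ ∷ p) = there (path-last p)

  -- The vertex visited next when the list holds the remaining inner vertices of a walk to `v`.
  hd : List V → V → V
  hd []      v = v
  hd (k ∷ _) v = k

  walk-cut : ∀ {u v} I K → Walk u (I ++ K) v → Walk u I (hd K v) × Path Adj (hd K v) v (K ++ [ v ])
  walk-cut []      []      a       = a , end _
  walk-cut []      (k ∷ K) (a , p) = let p₁ , p₂ = walk-cut [] K p in a , p₁ ∷ p₂
  walk-cut (i ∷ I) K       (a , p) = let p₁ , p₂ = walk-cut I K p in (a , p₁) , p₂

  -- In contrast to `IsCycle`, single vertices are excluded, since they would need a loop; an edge
  -- still counts as a cycle of two vertices.
  IsCyc : List V → Set
  IsCyc []      = ⊥
  IsCyc (v ∷ l) = Walk v l v × Unique (v ∷ l)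

  cyc-unique : ∀ C → IsCyc C → Unique C
  cyc-unique (_ ∷ _) (_ , u) = u

  cyc-intro : ∀ {a d K} Z → Path Adj a d K → Walk d Z a → Unique (K ++ Z) → IsCyc (K ++ Z)
  cyc-intro {a} Z p w u = go p w u
    where
    close : ∀ {x y b K} → Path Adj x y K → Walk y Z b → ∃ λ K₀ → K ≡ x ∷ K₀ × Walk x (K₀ ++ Z) b
    close (end _)   w = [] , refl , w
    close (e ∷ p) w with close p w
    ... | K₀ , refl , q = _ , refl , e , q
    go : ∀ {d K} → Path Adj a d K → Walk d Z a → Unique (K ++ Z) → IsCyc (K ++ Z)
    go p w u with close p w
    ... | K₀ , refl , q = q , u

  cyc-rot : ∀ xs ys → IsCyc (xs ++ ys) → IsCyc (ys ++ xs)
  cyc-rot []       ys       c       = subst IsCyc (sym (++-identityʳ ys)) c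
  cyc-rot (x ∷ xs) []       c       = subst IsCyc (++-identityʳ (x ∷ xs)) c
  cyc-rot (x ∷ xs) (y ∷ ys) (w , u) =
    let w₁ , w₂ = walk-split xs w in
    walk-join ys w₂ w₁ , Unique-↭ (Perm.++-comm (x ∷ xs) (y ∷ ys)) u

  cyc⇒cycle : ∀ C → IsCyc C → IsCycle G C
  cyc⇒cycle (v ∷ [])     (a , u) = ⊥-elim (irrefl refl a)
  cyc⇒cycle (v ∷ w ∷ vs) (p , u) = closed u (linked (w ∷ vs) p)
    where
    linked : ∀ {u v} l → Walk u l v → Linked Adj (u ∷ l ++ v ∷ [])
    linked []      a       = a ∷ [-]
    linked (_ ∷ l) (a , p) = a ∷ linked l p

  linked⇒walk : ∀ {u v} l → Linked Adj (u ∷ l ++ v ∷ []) → Walk u l v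
  linked⇒walk []      (a ∷ _) = a
  linked⇒walk (_ ∷ l) (a ∷ p) = a , linked⇒walk l p

  module _ {R : V → V → Set} where

    path-map : ∀ {R′ u v l} → (∀ {a b} → R a b → R′ a b) → Path R u v l → Path R′ u v l
    path-map f (end u) = end u
    path-map f (e ∷ p) = f e ∷ path-map f p

    path-append : ∀ {u s v l m} → Path R u s l → Path R s v m →
                  ∃ λ r → Path R u v r × (∀ {w} → w ∈ r → w ∈ l ⊎ w ∈ m)
    path-append (end _) q = _ , q , inj₂
    path-append (e ∷ p) q with path-append p q
    ... | r , p′ , f = _ , e ∷ p′ , λ
      { (here refl) → inj₁ (here refl)
      ; (there w∈)  → [ inj₁ ∘ there , inj₂ ]′ (f w∈) }

    path-prefix : ∀ {u z l v} → Path R u z l → v ∈ l → Unique l →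
                  ∃ λ l₁ → Path R u v l₁ × (∀ {w} → w ∈ l₁ → w ∈ l) × (z ∈ l₁ → z ≡ v)
    path-prefix (end _) (here refl) _ = _ , end _ , (λ w → w) , λ { (here refl) → refl }
    path-prefix (e ∷ p) (here refl) (q ∷ _) =
      _ , end _ , (λ { (here refl) → here refl }) , λ { (here refl) → ⊥-elim (All.lookup q (path-last p) refl) }
    path-prefix (e ∷ p) (there v∈) (q ∷ u) with path-prefix p v∈ u
    ... | l₁ , p₁ , s , f = _ , e ∷ p₁ , (λ { (here refl) → here refl ; (there w) → there (s w) }) ,
      λ { (here refl) → ⊥-elim (All.lookup q (path-last p) refl) ; (there w) → f w }

    path-suffix : ∀ {u z l v} → Path R u z l → v ∈ l →
                  ∃₂ λ l₁ l₂ → Path R v z l₂ × l ≡ l₁ ++ l₂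
    path-suffix p@(end _) (here refl) = [] , _ , p , refl
    path-suffix p@(_ ∷ _) (here refl) = [] , _ , p , refl
    path-suffix (_ ∷ p) (there v∈) with path-suffix p v∈
    ... | l₁ , l₂ , q , refl = _ ∷ l₁ , l₂ , q , refl

    path-suffix′ : ∀ {u z l v} → Path R u z l → v ∈ l → Unique l →
                   ∃ λ l₂ → Path R v z l₂ × (∀ {w} → w ∈ l₂ → w ∈ l) × (u ∈ l₂ → u ≡ v)
    path-suffix′ p@(end _) (here refl) _ = _ , p , (λ w → w) , λ _ → refl
    path-suffix′ p@(_ ∷ _) (here refl) _ = _ , p , (λ w → w) , λ _ → refl
    path-suffix′ (_ ∷ p) (there v∈) (q ∷ _) with path-suffix p v∈
    ... | l₁ , l₂ , p₂ , refl = l₂ , p₂ , there ∘ ∈-++⁺ʳ l₁ ,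
      λ u∈ → ⊥-elim (All.lookup q (∈-++⁺ʳ l₁ u∈) refl)

    path-simple : ∀ {u z l} → Path R u z l →
                  ∃ λ l′ → Path R u z l′ × Unique l′ × (∀ {w} → w ∈ l′ → w ∈ l)
    path-simple (end u) = _ , end u , [] ∷ [] , λ w → w
    path-simple {u} (e ∷ p) with path-simple p
    ... | l′ , p′ , uq , s with u ∈? l′
    ...   | no u∉ = _ , e ∷ p′ , Unique-∷ u∉ uq , λ { (here refl) → here refl ; (there w) → there (s w) }
    ...   | yes u∈ with path-suffix p′ u∈
    ...     | l₁ , l₂ , q , refl = l₂ , q , Unique-++⁻ʳ l₁ uq , there ∘ s ∘ ∈-++⁺ʳ l₁

  -- Menger's theorem

  Edges : Set
  Edges = List (V × V)

  -- Edges are directed, which suits the induction on the list; a graph enters with both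
  -- orientations of each of its edges.
  Edge : Edges → V → V → Set
  Edge E u v = (u , v) ∈ E

  Separates : Edges → List V → List V → List V → Set
  Separates E A B S = ∀ {u v l} → u ∈ A → v ∈ B → Path (Edge E) u v l → ∃ λ w → w ∈ l × w ∈ S

  record Family (E : Edges) (A B : List V) (k : ℕ) : Set where
    field
      src tgt : Fin k → V
      list    : Fin k → List V
      src∈    : ∀ i → src i ∈ A
      tgt∈    : ∀ i → tgt i ∈ B
      path    : ∀ i → Path (Edge E) (src i) (tgt i) (list i)
      uniq    : ∀ i → Unique (list i)
      disj    : ∀ {i j w} → w ∈ list i → w ∈ list j → i ≡ j

  first-use : ∀ {x y E u v l} → Path (Edge ((x , y) ∷ E)) u v l →
              Path (Edge E) u v l ⊎ ∃ λ l₁ → Path (Edge E) u x l₁ × (∀ {w} → w ∈ l₁ → w ∈ l)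
  first-use (end u)           = inj₁ (end u)
  first-use (here refl ∷ p)   = inj₂ (_ , end _ , λ { (here refl) → here refl })
  first-use (there e ∷ p) with first-use p
  ... | inj₁ q = inj₁ (e ∷ q)
  ... | inj₂ (l₁ , q , s) = inj₂ (_ , e ∷ q , λ { (here refl) → here refl ; (there w) → there (s w) })

  last-use : ∀ {x y E u v l} → Path (Edge ((x , y) ∷ E)) u v l →
             Path (Edge E) u v l ⊎ ∃ λ l₂ → Path (Edge E) y v l₂ × (∀ {w} → w ∈ l₂ → w ∈ l)
  last-use (end u) = inj₁ (end u)
  last-use (e ∷ p) with last-use p
  last-use (e ∷ p) | inj₂ (l₂ , q , s) = inj₂ (l₂ , q , there ∘ s)
  last-use (here refl ∷ p) | inj₁ q = inj₂ (_ , q , there)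
  last-use (there e ∷ p)   | inj₁ q = inj₁ (e ∷ q)

  injective-covers : ∀ {k} (f : Fin k → V) ys → (∀ {i j} → f i ≡ f j → i ≡ j) → (∀ i → f i ∈ ys) →
                     length ys ≤ k → ∀ {z} → z ∈ ys → ∃ λ i → f i ≡ z
  injective-covers f ys inj f∈ l z∈ =
    let i , e = ∈-tabulate⁻ (Unique-⊇ (Unique.tabulate⁺ inj)
                  (λ w∈ → let i , e = ∈-tabulate⁻ w∈ in subst (_∈ ys) (sym e) (f∈ i))
                  (≤-trans l (≤-reflexive (sym (length-tabulate f)))) z∈)
    in i , sym e

  lookup-injective : ∀ {xs : List V} → Unique xs → ∀ i j → lookup xs i ≡ lookup xs j → i ≡ j
  lookup-injective (_ ∷ _) zero    zero    _ = refl
  lookup-injective {_ ∷ xs} (p ∷ _) zero (suc j) e = ⊥-elim (All.lookup p (∈-lookup {xs = xs} j) e)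
  lookup-injective {_ ∷ xs} (p ∷ _) (suc i) zero e = ⊥-elim (All.lookup p (∈-lookup {xs = xs} i) (sym e))
  lookup-injective (_ ∷ u) (suc i) (suc j) e = cong suc (lookup-injective u i j e)

  -- Göring's proof of Menger's theorem, by removing the edges one at a time.
  menger : ∀ E A B k → (∀ S → length S < k → ¬ Separates E A B S) → ¬ ¬ Family E A B k
  -- Without edges the paths from `A` to `B` are the single vertices of the intersection, which is a
  -- separator and a family of disjoint paths at once.
  menger [] A B k nosep none with length I <? k
    where
    I = filter (λ v → (v ∈? A) ×-dec (v ∈? B)) (allFin n)
  ... | yes I<k = nosep _ I<k λ { u∈ v∈ (end _) → _ , here refl , ∈-filter⁺ _ (∈-allFin _) (u∈ , v∈) }
  ... | no  I≮k = none record
    { src = at ; tgt = at ; list = λ i → [ at i ]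
    ; src∈ = λ i → proj₁ (in-both i) ; tgt∈ = λ i → proj₂ (in-both i)
    ; path = λ i → end (at i) ; uniq = λ i → [] ∷ []
    ; disj = λ { {i} {j} (here e) (here e′) → inject≤-injective k≤ k≤ i j
                   (lookup-injective (Unique.filter⁺ both? (Unique.allFin⁺ n)) _ _ (trans (sym e) e′)) }
    }
    where
    both? : ∀ v → Dec (v ∈ A × v ∈ B)
    both? v = (v ∈? A) ×-dec (v ∈? B)
    I = filter both? (allFin n)
    k≤ : k ≤ length I
    k≤ = ≮⇒≥ I≮k
    at : Fin k → V
    at i = lookup I (inject≤ i k≤)
    in-both : ∀ i → at i ∈ A × at i ∈ B
    in-both i = proj₂ (∈-filter⁻ both? {xs = allFin n} (∈-lookup {xs = I} (inject≤ i k≤)))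
  menger ((x , y) ∷ E) A B k nosep none =
    -- Whether the remaining edges admit a small separator is not decided; as the goal is a
    -- negation, both cases may be assumed.
    ¬¬-excluded-middle {A = ∃ λ S → length S < k × Separates E A B S} λ
    { (no ¬sep) → menger E A B k (λ S l s → ¬sep (S , l , s)) λ F → let open Family F in none record
        { src = src ; tgt = tgt ; list = list ; src∈ = src∈ ; tgt∈ = tgt∈
        ; path = λ i → path-map there (path i) ; uniq = uniq ; disj = disj }
    ; (yes (S , S<k , sep)) →
        menger E A (x ∷ S) k (before S S<k sep) λ P → menger E (y ∷ S) B k (after S S<k sep) λ Q →
        none (glue S S<k sep P Q)
    }
    where
    module _ (S : List V) (S<k : length S < k) (sep : Separates E A B S) where
      -- A path from `A` to `B` avoids the edge and then meets `S`, or it reaches `x` before using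
      -- the edge. Either way it contains a path in `E` from `A` to `x ∷ S`, which `T` must meet.
      before : ∀ T → length T < k → ¬ Separates E A (x ∷ S) T
      before T T<k sepT = nosep T T<k λ u∈ v∈ p → case first-use p of λ
        { (inj₁ q) → let l₀ , q₀ , u₀ , s₀ = path-simple q
                         w₀ , w₀∈l , w₀∈S = sep u∈ v∈ q₀
                         l₁ , q₁ , s₁ , _ = path-prefix q₀ w₀∈l u₀
                         t , t∈l , t∈T = sepT u∈ (there w₀∈S) q₁
                     in t , s₀ (s₁ t∈l) , t∈T
        ; (inj₂ (l₁ , q , s)) → let t , t∈l , t∈T = sepT u∈ (here refl) q in t , s t∈l , t∈T }

      after : ∀ T → length T < k → ¬ Separates E (y ∷ S) B T
      after T T<k sepT = nosep T T<k λ u∈ v∈ p → case last-use p of λ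
        { (inj₁ q) → let w , w∈l , w∈S = sep u∈ v∈ q
                         l₁ , l₂ , q₂ , e = path-suffix q w∈l
                         t , t∈l , t∈T = sepT (there w∈S) v∈ q₂
                     in t , subst (t ∈_) (sym e) (∈-++⁺ʳ l₁ t∈l) , t∈T
        ; (inj₂ (l₂ , q , s)) → let t , t∈l , t∈T = sepT (here refl) v∈ q in t , s t∈l , t∈T }

      -- Otherwise `S` would still separate once the edge is restored, as every path using the edge
      -- passes through `x`.
      x∉S : x ∉ S
      x∉S x∈S = nosep S S<k λ u∈ v∈ p → case first-use p of λ
        { (inj₁ q) → sep u∈ v∈ q ; (inj₂ (l₁ , q , s)) → x , s (path-last q) , x∈S }

      y∉S : y ∉ S
      y∉S y∈S = nosep S S<k λ u∈ v∈ p → case last-use p of λ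
        { (inj₁ q) → sep u∈ v∈ q ; (inj₂ (l₂ , q , s)) → y , s (path-head q) , y∈S }

      glue : Family E A (x ∷ S) k → Family E (y ∷ S) B k → Family ((x , y) ∷ E) A B k
      glue P Q = record
        { src = P.src ; tgt = λ i → Q.tgt (σ i) ; list = λ i → proj₁ (route i)
        ; src∈ = P.src∈ ; tgt∈ = λ i → Q.tgt∈ (σ i)
        ; path = λ i → proj₁ (proj₂ (route i)) ; uniq = λ i → proj₁ (proj₂ (proj₂ (route i)))
        ; disj = λ {i} {j} w∈i w∈j →
            disjoint i j (proj₂ (proj₂ (proj₂ (route i))) w∈i) (proj₂ (proj₂ (proj₂ (route j))) w∈j)
        }
        where
        module P = Family P
        module Q = Family Q
        P-tgt : ∀ {i j} → P.tgt i ≡ P.tgt j → i ≡ j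
        P-tgt {i} {j} e = P.disj (path-last (P.path i)) (subst (_∈ P.list j) (sym e) (path-last (P.path j)))
        Q-src : ∀ {i j} → Q.src i ≡ Q.src j → i ≡ j
        Q-src {i} {j} e = Q.disj (path-head (Q.path i)) (subst (_∈ Q.list j) (sym e) (path-head (Q.path j)))
        P-cover : ∀ {z} → z ∈ x ∷ S → ∃ λ i → P.tgt i ≡ z
        P-cover = injective-covers P.tgt (x ∷ S) P-tgt P.tgt∈ S<k
        Q-cover : ∀ {z} → z ∈ y ∷ S → ∃ λ i → Q.src i ≡ z
        Q-cover = injective-covers Q.src (y ∷ S) Q-src Q.src∈ S<k
        -- The `k` disjoint paths end in a list of at most `k` vertices and so use all of it: every
        -- vertex of `S` is the end of one path and lies on no other.
        P-only : ∀ {i w} → w ∈ P.list i → w ∈ S → w ≡ P.tgt i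
        P-only {i} w∈ w∈S with P-cover (there w∈S)
        ... | j , refl with P.disj w∈ (path-last (P.path j))
        ...   | refl = refl
        Q-only : ∀ {i w} → w ∈ Q.list i → w ∈ S → w ≡ Q.src i
        Q-only {i} w∈ w∈S with Q-cover (there w∈S)
        ... | j , refl with Q.disj w∈ (path-head (Q.path j))
        ...   | refl = refl
        -- Were `w` off `S`, the path from `A` up to `w` followed by the path from `w` to `B` would
        -- have to meet `S` elsewhere. But the two paths meet `S` only in the end of the first and
        -- the start of the second, and both have been cut away.
        meet : ∀ {i j w} → w ∈ P.list i → w ∈ Q.list j → w ∈ S
        meet {i} {j} {w} w∈P w∈Q = decidable-stable (w ∈? S) λ w∉S →
          let l₁ , p₁ , s₁ , f₁ = path-prefix (P.path i) w∈P (P.uniq i)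
              l₂ , p₂ , s₂ , f₂ = path-suffix′ (Q.path j) w∈Q (Q.uniq j)
              r , p , f = path-append p₁ p₂
              t , t∈r , t∈S = sep (P.src∈ i) (Q.tgt∈ j) p
          in case f t∈r of λ
            { (inj₁ t∈l) → let e = P-only (s₁ t∈l) t∈S in
                           w∉S (subst (_∈ S) (trans e (f₁ (subst (_∈ l₁) e t∈l))) t∈S)
            ; (inj₂ t∈l) → let e = Q-only (s₂ t∈l) t∈S in
                           w∉S (subst (_∈ S) (trans e (f₂ (subst (_∈ l₂) e t∈l))) t∈S) }
        -- A path ending at `x` continues through the deleted edge, a path ending in `S` continues
        -- with the one that starts there.
        Next : Fin k → Fin k → Set
        Next i j = (P.tgt i ≡ x × Q.src j ≡ y) ⊎ (P.tgt i ∈ S × Q.src j ≡ P.tgt i)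
        next : ∀ i → ∃ (Next i)
        next i with P.tgt∈ i
        ... | here e   = let j , e′ = Q-cover (here refl) in j , inj₁ (e , e′)
        ... | there t∈ = let j , e′ = Q-cover (there t∈) in j , inj₂ (t∈ , e′)
        σ : Fin k → Fin k
        σ i = proj₁ (next i)
        join : ∀ i j → Next i j → ∃ λ r → Path (Edge ((x , y) ∷ E)) (P.src i) (Q.tgt j) r ×
               (∀ {w} → w ∈ r → w ∈ P.list i ⊎ w ∈ Q.list j)
        join i j (inj₁ (e , e′)) with path-append (path-map there (P.path i))
                                        (here (trans (cong (_, y) e) refl) ∷
                                          subst (λ z → Path (Edge ((x , y) ∷ E)) z (Q.tgt j) (Q.list j)) e′ (path-map there (Q.path j)))
        ... | r , p , f = r , p , λ w∈ → case f w∈ of λ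
          { (inj₁ a) → inj₁ a ; (inj₂ (here refl)) → inj₁ (path-last (P.path i)) ; (inj₂ (there b)) → inj₂ b }
        join i j (inj₂ (_ , e)) = path-append (path-map there (P.path i))
          (subst (λ z → Path (Edge ((x , y) ∷ E)) z (Q.tgt j) (Q.list j)) e (path-map there (Q.path j)))
        route : ∀ i → ∃ λ r → Path (Edge ((x , y) ∷ E)) (P.src i) (Q.tgt (σ i)) r × Unique r ×
                (∀ {w} → w ∈ r → w ∈ P.list i ⊎ w ∈ Q.list (σ i))
        route i = let r , p , f = join i (σ i) (proj₂ (next i))
                      r′ , p′ , u′ , s′ = path-simple p
                  in r′ , p′ , u′ , λ w∈ → f (s′ w∈)
        cross : ∀ i j {w} → w ∈ P.list i → w ∈ Q.list (σ j) → i ≡ j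
        cross i j {w} a b with meet a b | proj₂ (next j)
        ... | w∈S | inj₁ (_ , e) = ⊥-elim (y∉S (subst (_∈ S) (trans (Q-only b w∈S) e) w∈S))
        ... | w∈S | inj₂ (_ , e) = P-tgt (trans (sym (P-only a w∈S)) (trans (Q-only b w∈S) e))
        same : ∀ i j → σ i ≡ σ j → i ≡ j
        same i j e with proj₂ (next i) | proj₂ (next j)
        ... | inj₁ (a , _) | inj₁ (b , _) = P-tgt (trans a (sym b))
        ... | inj₂ (_ , a) | inj₂ (_ , b) = P-tgt (trans (sym a) (trans (cong Q.src e) b))
        ... | inj₁ (_ , a) | inj₂ (b , c) = ⊥-elim (y∉S (subst (_∈ S) (trans (sym c) (trans (cong Q.src (sym e)) a)) b))
        ... | inj₂ (b , c) | inj₁ (_ , a) = ⊥-elim (y∉S (subst (_∈ S) (trans (sym c) (trans (cong Q.src e) a)) b))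
        disjoint : ∀ i j {w} → w ∈ P.list i ⊎ w ∈ Q.list (σ i) → w ∈ P.list j ⊎ w ∈ Q.list (σ j) → i ≡ j
        disjoint i j (inj₁ a) (inj₁ b) = P.disj a b
        disjoint i j (inj₁ a) (inj₂ b) = cross i j a b
        disjoint i j (inj₂ a) (inj₁ b) = sym (cross j i b a)
        disjoint i j (inj₂ a) (inj₂ b) = same i j (Q.disj a b)

  Toughness : Set
  Toughness = ∀ S Rs → All (_∉ S) Rs → AllPairs (λ u v → ¬ Conn S u v) Rs →
              2 ≤ length Rs → length Rs < length S

  pick-outside : ∀ {xs : List V} S → Unique xs → length S < length xs → ∃ λ v → v ∈ xs × v ∉ S
  pick-outside {xs} S u l with any? (λ v → ¬? (v ∈? S)) xs
  ... | yes p = let v , v∈ , v∉ = find p in v , v∈ , v∉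
    where open import Data.List.Membership.Propositional using (find)
  ... | no ¬p = ⊥-elim (ℕ.<⇒≱ l (Unique-⊆-length u λ {v} v∈ →
                  decidable-stable (v ∈? S) λ v∉ → ¬p (lose v∈ v∉)))
    where open import Data.List.Membership.Propositional using (lose)

  edges : Edges
  edges = filter (λ (u , v) → adj? u v) (cartesianProduct (allFin n) (allFin n))

  edge⇒adj : ∀ {u v} → Edge edges u v → Adj u v
  edge⇒adj e = proj₂ (∈-filter⁻ (λ (u , v) → adj? u v) {xs = cartesianProduct (allFin n) (allFin n)} e)

  adj⇒edge : ∀ {u v} → Adj u v → Edge edges u v
  adj⇒edge {u} {v} a = ∈-filter⁺ (λ (u , v) → adj? u v) (∈-cartesianProduct⁺ (∈-allFin u) (∈-allFin v)) a

  conn⇒path : ∀ {S u v} → u ∉ S → Conn S u v → ∃ λ l → Path (Edge edges) u v l × (∀ {w} → w ∈ l → w ∉ S)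
  conn⇒path u∉ ε = _ , end _ , λ { (here refl) → u∉ }
  conn⇒path u∉ ((_ , v∉ , e) ◅ c) with conn⇒path v∉ c
  ... | l , p , f = _ , adj⇒edge e ∷ p , λ { (here refl) → u∉ ; (there w) → f w }

  -- Cycles and their division into arcs

  cyc-rev : ∀ x l → IsCyc (x ∷ l) → IsCyc (x ∷ reverse l)
  cyc-rev x l (w , u) = walk-rev l w , Unique-↭ (↭-prep x (↭-sym (Perm.↭-reverse l))) u

  -- (ξ , I) stands for a vertex ξ of a cycle and the inner vertices I of the arc
  -- from ξ to the next marked vertex.
  Seg : Set
  Seg = V × List V

  flat : List Seg → List V
  flat []             = []
  flat ((ξ , I) ∷ ss) = ξ ∷ I ++ flat ss

  flat-++ : ∀ ss ts → flat (ss ++ ts) ≡ flat ss ++ flat ts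
  flat-++ []             ts = refl
  flat-++ ((ξ , I) ∷ ss) ts = cong (ξ ∷_) (trans (cong (I ++_) (flat-++ ss ts)) (sym (++-assoc I (flat ss) (flat ts))))

  hdξ : List Seg → V → V
  hdξ []            z = z
  hdξ ((ξ , _) ∷ _) z = ξ

  total : (Seg → ℕ) → List Seg → ℕ
  total f []       = 0
  total f (s ∷ ss) = f s + total f ss

  inner-length : Seg → ℕ
  inner-length (_ , I) = length I

  length-flat : ∀ ss → length (flat ss) ≡ length ss + total inner-length ss
  length-flat []             = refl
  length-flat ((ξ , I) ∷ ss) = cong suc (trans (length-++ I) (trans (cong (length I +_) (length-flat ss))
                                 (arith (length I) (length ss) (total inner-length ss))))
    where
    arith : ∀ a b c → a + (b + c) ≡ b + (a + c)
    arith = solve-∀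

  ∈-flat-ξ : ∀ {ss ξ I} → (ξ , I) ∈ ss → ξ ∈ flat ss
  ∈-flat-ξ (here refl) = here refl
  ∈-flat-ξ {(_ , J) ∷ _} (there p) = there (∈-++⁺ʳ J (∈-flat-ξ p))

  ∈-flat-I : ∀ {ss ξ I v} → (ξ , I) ∈ ss → v ∈ I → v ∈ flat ss
  ∈-flat-I (here refl) v = there (∈-++⁺ˡ v)
  ∈-flat-I {(_ , J) ∷ _} (there p) v = there (∈-++⁺ʳ J (∈-flat-I p v))

  ∈-flat⁻ : ∀ ss {v} → v ∈ flat ss → ∃ λ s → s ∈ ss × (v ≡ proj₁ s ⊎ v ∈ proj₂ s)
  ∈-flat⁻ ((ξ , I) ∷ ss) (here e) = _ , here refl , inj₁ e
  ∈-flat⁻ ((ξ , I) ∷ ss) (there p) with ∈-++⁻ I p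
  ... | inj₁ q = _ , here refl , inj₂ q
  ... | inj₂ q = let s , s∈ , r = ∈-flat⁻ ss q in s , there s∈ , r

  module _ {p : V → Set} (p? : ∀ v → Dec (p v)) where

    cut : ∀ l → ∃₂ λ I ss → l ≡ I ++ flat ss × All (¬_ ∘ p) I ×
                            All (λ s → p (proj₁ s) × All (¬_ ∘ p) (proj₂ s)) ss
    cut [] = [] , [] , refl , [] , []
    cut (v ∷ l) with cut l | p? v
    ... | I , ss , e , a , b | yes pv = [] , (v , I) ∷ ss , cong (v ∷_) e , [] , (pv , a) ∷ b
    ... | I , ss , e , a , b | no ¬pv = v ∷ I , ss , cong (v ∷_) e , ¬pv ∷ a , b

    last-such : ∀ l → All (¬_ ∘ p) l ⊎ ∃₂ λ as z → ∃ λ bs → l ≡ as ++ z ∷ bs × p z × All (¬_ ∘ p) bs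
    last-such [] = inj₁ []
    last-such (v ∷ l) with last-such l | p? v
    ... | inj₂ (as , z , bs , e , pz , a) | _ = inj₂ (v ∷ as , z , bs , cong (v ∷_) e , pz , a)
    ... | inj₁ a | yes pv = inj₂ ([] , v , l , refl , pv , a)
    ... | inj₁ a | no ¬pv = inj₁ (¬pv ∷ a)

  path-start : ∀ {x y z b} → Path Adj x y (z ∷ b) → x ≡ z
  path-start (end _) = refl
  path-start (_ ∷ _) = refl

  path⇒walk : ∀ {x y z b} m → Path Adj x y (x ∷ m ++ z ∷ b) → Walk x m z
  path⇒walk []      (e ∷ p) = subst (Adj _) (path-start p) e
  path⇒walk (a ∷ m) (e ∷ p) with path-start p
  ... | refl = e , path⇒walk m p

  indicator : ∀ {A : Set} → Dec A → ℕ
  indicator (yes _) = 1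
  indicator (no _)  = 0

  total-∈ : ∀ f {s ss} → s ∈ ss → f s ≤ total f ss
  total-∈ f {s} (here refl) = m≤m+n (f s) _
  total-∈ f {ss = t ∷ _} (there p) = ≤-trans (total-∈ f p) (m≤n+m _ (f t))

  total-two : ∀ f {s t ss} → s ∈ ss → t ∈ ss → s ≢ t → f s + f t ≤ total f ss
  total-two f (here refl) (here refl) ne = ⊥-elim (ne refl)
  total-two f (here refl) (there q)   ne = +-monoʳ-≤ _ (total-∈ f q)
  total-two f {s} {t} (there p) (here refl) ne =
    ≤-trans (≤-reflexive (ℕ.+-comm (f s) (f t))) (+-monoʳ-≤ _ (total-∈ f p))
  total-two f {ss = u ∷ _} (there p) (there q) ne = ≤-trans (total-two f p q ne) (m≤n+m _ (f u))

  total≥1 : ∀ f {ss} → 1 ≤ total f ss → ∃ λ s → s ∈ ss × 1 ≤ f s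
  total≥1 f {s ∷ ss} l with f s in eq
  ... | suc _ = s , here refl , subst (1 ≤_) (sym eq) (s≤s z≤n)
  ... | zero  = let t , t∈ , h = total≥1 f l in t , there t∈ , h

  -- Two kinds of marks around a cycle

  module Letters {X Y : V → Set} (X? : ∀ v → Dec (X v)) (Y? : ∀ v → Dec (Y v)) where

    both onlyX onlyY : Seg → ℕ
    both  (ξ , _) = indicator (X? ξ ×-dec Y? ξ)
    onlyX (ξ , _) = indicator (X? ξ ×-dec ¬? (Y? ξ))
    onlyY (ξ , _) = indicator (Y? ξ ×-dec ¬? (X? ξ))

    hits : List Seg → List V
    hits ss = map proj₁ (filter (λ s → X? (proj₁ s)) ss)

    length-hits : ∀ ss → length (hits ss) ≡ total both ss + total onlyX ss
    length-hits [] = refl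
    length-hits ((ξ , I) ∷ ss) with X? ξ | Y? ξ
    ... | yes _ | yes _ = cong suc (length-hits ss)
    ... | yes _ | no _  = trans (cong suc (length-hits ss)) (sym (ℕ.+-suc _ _))
    ... | no _  | yes _ = length-hits ss
    ... | no _  | no _  = length-hits ss

    length-letters : ∀ ss → All (λ s → X (proj₁ s) ⊎ Y (proj₁ s)) ss →
                     length ss ≡ total both ss + total onlyX ss + total onlyY ss
    length-letters [] [] = refl
    length-letters ((ξ , I) ∷ ss) (p ∷ ps) with X? ξ | Y? ξ | length-letters ss ps
    ... | yes _ | yes _ | e = cong suc e
    ... | yes _ | no _  | e = trans (cong suc e) (cong (_+ total onlyY ss) (sym (ℕ.+-suc (total both ss) _)))
    ... | no _  | yes _ | e = trans (cong suc e) (sym (ℕ.+-suc _ _))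
    ... | no ¬x | no ¬y | e = ⊥-elim ([ ¬x , ¬y ]′ p)

    -- The list is read cyclically: its last letter is followed by z.
    turns : List Seg → V → ℕ
    turns []             z = 0
    turns ((ξ , _) ∷ ss) z =
      indicator ((X? ξ ×-dec ¬? (Y? ξ)) ×-dec ¬? (X? (hdξ ss z) ×-dec ¬? (Y? (hdξ ss z)))) + turns ss z

    OnlyX : V → Set
    OnlyX ξ = X ξ × ¬ Y ξ

    turn-to : ∀ ss z → Any (OnlyX ∘ proj₁) ss → ¬ OnlyX z → 1 ≤ turns ss z
    turn-to ((ξ , I) ∷ ss) z o ¬z with X? ξ ×-dec ¬? (Y? ξ)
    ... | no ¬ξ = turn-to ss z (case o of λ { (here p) → ⊥-elim (¬ξ p) ; (there p) → p }) ¬z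
    ... | yes _ with X? (hdξ ss z) ×-dec ¬? (Y? (hdξ ss z))
    ...   | no _ = s≤s z≤n
    turn-to ((ξ , I) ∷ [])      z o ¬z | yes _ | yes q = ⊥-elim (¬z q)
    turn-to ((ξ , I) ∷ t ∷ ss)  z o ¬z | yes _ | yes q = turn-to (t ∷ ss) z (here q) ¬z

    turn-from : ∀ ss z → OnlyX (hdξ ss z) → Any (¬_ ∘ OnlyX ∘ proj₁) ss → 1 ≤ turns ss z
    turn-from ((ξ , I) ∷ ss) z o (here p) = ⊥-elim (p o)
    turn-from ((ξ , I) ∷ ss) z o (there p) with X? ξ ×-dec ¬? (Y? ξ)
    ... | no ¬ξ = ⊥-elim (¬ξ o)
    ... | yes _ with X? (hdξ ss z) ×-dec ¬? (Y? (hdξ ss z))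
    ...   | no _ = s≤s z≤n
    ...   | yes q = turn-from ss z q p

    -- A run of private letters has to end once some other letter occurs. If the list starts inside
    -- such a run, the run ends at the first other letter; if not, the return to `ξ` at the latest
    -- ends any run met on the way.
    turns≥1 : ∀ ξ I ss → let ts = (ξ , I) ∷ ss in
              1 ≤ total onlyX ts → 1 ≤ total both ts + total onlyY ts → 1 ≤ turns ts ξ
    turns≥1 ξ I ss hx hy = go (X? ξ ×-dec ¬? (Y? ξ))
      where
      ts = (ξ , I) ∷ ss
      some : Any (OnlyX ∘ proj₁) ts
      some = let s , s∈ , h = total≥1 onlyX hx in lose s∈ (pos s h)
        where
        pos : ∀ s → 1 ≤ onlyX s → OnlyX (proj₁ s)
        pos (ξ , _) h with X? ξ | Y? ξ
        ... | yes x | no ¬y = x , ¬y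
        pos _ () | yes _ | yes _
        pos _ () | no _  | yes _
        pos _ () | no _  | no _
      neg : ∀ {s} → s ∈ ts → Y (proj₁ s) → Any (¬_ ∘ OnlyX ∘ proj₁) ts
      neg s∈ y = lose s∈ λ (_ , ¬y) → ¬y y
      other : Any (¬_ ∘ OnlyX ∘ proj₁) ts
      other with 1 ≤? total both ts
      ... | yes h = let s , s∈ , h′ = total≥1 both h in neg s∈ (pos s h′)
        where
        pos : ∀ s → 1 ≤ both s → Y (proj₁ s)
        pos (ξ , _) h with X? ξ | Y? ξ
        ... | yes _ | yes y = y
        pos _ () | yes _ | no _
        pos _ () | no _  | yes _
        pos _ () | no _  | no _
      ... | no ¬h = let s , s∈ , h′ = total≥1 onlyY (subst (λ b → 1 ≤ b + total onlyY ts) (ℕ.n<1⇒n≡0 (ℕ.≰⇒> ¬h)) hy) in neg s∈ (pos s h′)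
        where
        pos : ∀ s → 1 ≤ onlyY s → Y (proj₁ s)
        pos (ξ , _) h with X? ξ | Y? ξ
        ... | no _ | yes y = y
        pos _ () | yes _ | yes _
        pos _ () | yes _  | no _
        pos _ () | no _  | no _
      go : Dec (OnlyX ξ) → 1 ≤ turns ts ξ
      go (yes o)  = turn-from ts ξ o other
      go (no ¬o) = turn-to ts ξ some ¬o

  module _ {X Y : V → Set} (X? : ∀ v → Dec (X v)) (Y? : ∀ v → Dec (Y v)) (k′ : ℕ) where

    private
      module XY = Letters X? Y?
      module YX = Letters Y? X?

    -- In the application `suc k′` is the number of vertices of P, and P could replace an arc that
    -- leads from a neighbour of one end to a neighbour of the other.
    Spaced : V → List V → V → Set
    Spaced ξ I η = 1 ≤ length I × ((X ξ × Y η) ⊎ (Y ξ × X η) → suc k′ ≤ length I)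

    SpacedAll : List Seg → V → Set
    SpacedAll []             z = ⊤
    SpacedAll ((ξ , I) ∷ ss) z = Spaced ξ I (hdξ ss z) × SpacedAll ss z

    -- Each arc is charged to its first letter. After a common letter, and after the last of a run
    -- of private ones, the next letter belongs to the other end, so the arc has `suc k′` inner
    -- vertices; in the second case one of them pays for the letter and `k′` for the change.
    letters-bound : ∀ ss z → SpacedAll ss z → All (λ s → X (proj₁ s) ⊎ Y (proj₁ s)) ss → X z ⊎ Y z →
                    total XY.both ss * suc k′ + total XY.onlyX ss + total XY.onlyY ss
                      + k′ * (XY.turns ss z + YX.turns ss z) ≤ total inner-length ss
    letters-bound [] z _ _ _ = ≤-reflexive (ℕ.*-zeroʳ k′)
    letters-bound ((ξ , I) ∷ ss) z (sp , sps) (p ∷ ps) pz =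
      ≤-trans (≤-reflexive (arith (XY.both s) (XY.onlyX s) (XY.onlyY s) tX tY
                  (total XY.both ss) (total XY.onlyX ss) (total XY.onlyY ss) (XY.turns ss z) (YX.turns ss z) (suc k′) k′))
        (+-mono-≤ (head (X? ξ) (Y? ξ) (X? η) (Y? η)) (letters-bound ss z sps ps pz))
      where
      η = hdξ ss z
      pη : X η ⊎ Y η
      pη = first ss ps
        where
        first : ∀ ss → All (λ s → X (proj₁ s) ⊎ Y (proj₁ s)) ss → X (hdξ ss z) ⊎ Y (hdξ ss z)
        first []      _       = pz
        first (_ ∷ _) (q ∷ _) = q
      w : ∀ {A B C D : Set} → Dec A → Dec B → Dec C → Dec D → ℕ
      w x y x′ y′ = indicator (x ×-dec y) * suc k′ + indicator (x ×-dec ¬? y) + indicator (y ×-dec ¬? x)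
        + k′ * (indicator ((x ×-dec ¬? y) ×-dec ¬? (x′ ×-dec ¬? y′)) + indicator ((y ×-dec ¬? x) ×-dec ¬? (y′ ×-dec ¬? x′)))
      zero-k : ∀ k → suc (k + 0) + 0 + 0 + k * 0 ≡ suc k
      zero-k = solve-∀
      one-k : ∀ k → 1 + k * 1 ≡ suc k
      one-k = solve-∀
      none-k : ∀ k → 1 + k * 0 ≡ 1
      none-k = solve-∀
      head : (x : Dec (X ξ)) (y : Dec (Y ξ)) (x′ : Dec (X η)) (y′ : Dec (Y η)) → w x y x′ y′ ≤ length I
      head (yes x) (yes y) x′ y′ = ≤-trans (≤-reflexive (zero-k k′))
        (proj₂ sp ([ (λ q → inj₂ (y , q)) , (λ q → inj₁ (x , q)) ]′ pη))
      head (yes x) (no _) (yes _) (yes q) = ≤-trans (≤-reflexive (one-k k′)) (proj₂ sp (inj₁ (x , q)))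
      head (yes x) (no _) (no _) (yes q)  = ≤-trans (≤-reflexive (one-k k′)) (proj₂ sp (inj₁ (x , q)))
      head (yes x) (no _) (yes _) (no _)  = ≤-trans (≤-reflexive (none-k k′)) (proj₁ sp)
      head (yes x) (no _) (no ¬a) (no ¬b) = ⊥-elim ([ ¬a , ¬b ]′ pη)
      head (no _) (yes y) (yes q) (yes _) = ≤-trans (≤-reflexive (one-k k′)) (proj₂ sp (inj₂ (y , q)))
      head (no _) (yes y) (yes q) (no _)  = ≤-trans (≤-reflexive (one-k k′)) (proj₂ sp (inj₂ (y , q)))
      head (no _) (yes y) (no _) (yes _)  = ≤-trans (≤-reflexive (none-k k′)) (proj₁ sp)
      head (no _) (yes y) (no ¬a) (no ¬b) = ⊥-elim ([ ¬a , ¬b ]′ pη)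
      head (no ¬x) (no ¬y) _ _ = ⊥-elim ([ ¬x , ¬y ]′ p)
      s = ξ , I
      tX = indicator ((X? ξ ×-dec ¬? (Y? ξ)) ×-dec ¬? (X? η ×-dec ¬? (Y? η)))
      tY = indicator ((Y? ξ ×-dec ¬? (X? ξ)) ×-dec ¬? (Y? η ×-dec ¬? (X? η)))
      arith : ∀ b o q t u B O Q T U K k →
              (b + B) * K + (o + O) + (q + Q) + k * ((t + T) + (u + U)) ≡
              (b * K + o + q + k * (t + u)) + (B * K + O + Q + k * (T + U))
      arith = solve-∀

  -- The cyclic successor of `s`. If `s` is last, its successor is the first mark of the list, which
  -- is why `z` must carry that mark.
  rest-nonempty : ∀ {z s : Seg} pre post → 2 ≤ length (pre ++ s ∷ post) → proj₁ z ≡ hdξ (pre ++ s ∷ post) (proj₁ z) →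
                  ∃ λ J → ∃ λ r → post ++ pre ≡ (hdξ post (proj₁ z) , J) ∷ r
  rest-nonempty pre              ((η , J) ∷ post) _ _ = J , post ++ pre , refl
  rest-nonempty []               []               (s≤s ()) _
  rest-nonempty ((v , J) ∷ pre)  []               _ e = J , pre , cong (λ w → (w , J) ∷ pre) (sym e)

  ξ-unique : ∀ {ss ξ I J} → Unique (flat ss) → (ξ , I) ∈ ss → (ξ , J) ∈ ss → I ≡ J
  ξ-unique _ (here refl) (here refl) = refl
  ξ-unique {(_ , I) ∷ ss} (p ∷ _) (here refl) (there q) = ⊥-elim (All.lookup p (∈-++⁺ʳ I (∈-flat-ξ q)) refl)
  ξ-unique {(_ , I) ∷ ss} (p ∷ _) (there q) (here refl) = ⊥-elim (All.lookup p (∈-++⁺ʳ I (∈-flat-ξ q)) refl)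
  ξ-unique {(_ , I) ∷ ss} (_ ∷ u) (there p) (there q) = ξ-unique (Unique-++⁻ʳ I u) p q

  walk-inner : ∀ {u v} l → Walk u l v → 1 ≤ length l → ∃₂ λ a b → Path Adj a b l × ∃₂ λ l₁ l₂ → l ≡ a ∷ l₁ × l ≡ l₂ ++ [ b ]
  walk-inner (a ∷ [])    (_ , _) _ = a , a , end a , [] , [] , refl , refl
  walk-inner (a ∷ c ∷ l) (_ , w) _ with walk-inner (c ∷ l) w (s≤s z≤n)
  ... | c′ , b , p , l₁ , l₂ , refl , e = a , b , proj₁ w ∷ p , c ∷ l , a ∷ l₂ , refl , cong (a ∷_) e

  seg-unique : ∀ {ss ξ I η J v} → Unique (flat ss) → (ξ , I) ∈ ss → (η , J) ∈ ss → v ∈ I → v ∈ J → ξ ≡ η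
  seg-unique _ (here refl) (here refl) _ _ = refl
  seg-unique {(_ , I) ∷ ss} (_ ∷ u) (here refl) (there q) a b = ⊥-elim (Unique-disjoint I u a (∈-flat-I q b))
  seg-unique {(_ , I) ∷ ss} (_ ∷ u) (there p) (here refl) a b = ⊥-elim (Unique-disjoint I u b (∈-flat-I p a))
  seg-unique {(_ , I) ∷ ss} (_ ∷ u) (there p) (there q) a b = seg-unique (Unique-++⁻ʳ I u) p q a b

  ξ∉I : ∀ {ss ξ I η J} → Unique (flat ss) → (ξ , I) ∈ ss → (η , J) ∈ ss → η ∉ I
  ξ∉I {(_ , I) ∷ ss} (h ∷ _) (here refl) (here refl) e = All.lookup h (∈-++⁺ˡ e) refl
  ξ∉I {(_ , I) ∷ ss} (_ ∷ u) (here refl) (there q) e = Unique-disjoint I u e (∈-flat-ξ q)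
  ξ∉I {(_ , I) ∷ ss} (h ∷ _) (there p) (here refl) e = All.lookup h (∈-++⁺ʳ I (∈-flat-I p e)) refl
  ξ∉I {(_ , I) ∷ ss} (_ ∷ u) (there p) (there q) e = ξ∉I (Unique-++⁻ʳ I u) p q e

  hd-flat : ∀ ss z {η J} {ts} → (∀ {s} → s ∈ ss → s ∈ ts) → (η , J) ∈ ts → z ≡ η →
            ∃ λ J′ → (hd (flat ss) z , J′) ∈ ts
  hd-flat []            z sub η∈ refl = _ , η∈
  hd-flat ((ξ , J) ∷ _) z sub _  _    = J , sub (here refl)

  hdξ-idem : ∀ ss z → hdξ ss z ≡ hdξ ss (hdξ ss z)
  hdξ-idem []      z = refl
  hdξ-idem (_ ∷ _) z = refl

  hd-∈ : ∀ l z → hd l z ∈ l ++ [ z ]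
  hd-∈ []      z = here refl
  hd-∈ (_ ∷ _) z = here refl

  ξs-unique : ∀ ss → Unique (flat ss) → Unique (map proj₁ ss)
  ξs-unique []             _       = []
  ξs-unique ((ξ , I) ∷ ss) (h ∷ u) = Unique-∷ fresh (ξs-unique ss (Unique-++⁻ʳ I u))
    where
    fresh : ξ ∉ map proj₁ ss
    fresh p with ∈-map⁻ proj₁ p
    ... | s , s∈ , refl = All.lookup h (∈-++⁺ʳ I (∈-flat-ξ s∈)) refl

  path-finish : ∀ {x y z} l → Path Adj x y (l ++ [ z ]) → y ≡ z
  path-finish []          (end _) = refl
  path-finish (_ ∷ [])    (_ ∷ end _) = refl
  path-finish (_ ∷ c ∷ l) (_ ∷ p) = path-finish (c ∷ l) p

  pos : ∀ {v : V} {l} → v ∈ l → ℕ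
  pos p = toℕ (index p)

  split-at : ∀ {v : V} {l} (p : v ∈ l) → ∃₂ λ as bs → l ≡ as ++ v ∷ bs × length as ≡ pos p
  split-at (here refl) = [] , _ , refl , refl
  split-at (there p) with split-at p
  ... | as , bs , e , q = _ ∷ as , bs , cong (_ ∷_) e , cong suc q

  sum-two : ∀ a b c d → a + b ≡ 2 → c + d ≡ 2 → 2 ≤ a + c → 2 ≤ b + d → a + c ≡ 2
  sum-two a b c d e f l m = ℕ.≤-antisym (ℕ.+-cancelʳ-≤ 2 (a + c) 2
    (≤-trans (+-monoʳ-≤ (a + c) m) (≤-reflexive (trans (arith a b c d) (cong₂ _+_ e f))))) l
    where
    arith : ∀ a b c d → (a + c) + (b + d) ≡ (a + b) + (c + d)
    arith = solve-∀

  middle-of-five : ∀ {c₁ c₂ c₃ c₄ c₅ v : V} Y₁ {Y₂} → c₁ ∷ c₂ ∷ c₃ ∷ c₄ ∷ c₅ ∷ [] ≡ Y₁ ++ v ∷ Y₂ → 2 ≤ length Y₁ → 2 ≤ length Y₂ → v ≡ c₃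
  middle-of-five (_ ∷ []) _ (s≤s ()) _
  middle-of-five (_ ∷ _ ∷ []) refl _ _ = refl
  middle-of-five (_ ∷ _ ∷ _ ∷ []) refl _ (s≤s ())
  middle-of-five (_ ∷ _ ∷ _ ∷ _ ∷ []) refl _ ()
  middle-of-five (_ ∷ _ ∷ _ ∷ _ ∷ _ ∷ []) () _ _
  middle-of-five (_ ∷ _ ∷ _ ∷ _ ∷ _ ∷ _ ∷ _) () _ _

  total-filter : ∀ f {p : Seg → Set} (p? : ∀ s → Dec (p s)) ss → total f (filter p? ss) ≤ total f ss
  total-filter f p? []       = z≤n
  total-filter f p? (s ∷ ss) with p? s
  ... | yes _ = +-monoʳ-≤ (f s) (total-filter f p? ss)
  ... | no _  = ≤-trans (total-filter f p? ss) (m≤n+m _ (f s))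

  -- Exchanges on a longest cycle

  module LongestCycle (tough : Toughness) (Λ : ℕ) (longest : ∀ D → IsCyc D → length D ≤ Λ)
                      (δ : ℕ) (δ≤ : ∀ v → δ ≤ degree G v) (n≤ : n ≤ 3 * δ + 2) where

    Lng : List V → Set
    Lng C = IsCyc C × length C ≡ Λ

    lng-rot : ∀ xs ys → Lng (xs ++ ys) → Lng (ys ++ xs)
    lng-rot xs ys (c , e) = cyc-rot xs ys c ,
      trans (Perm.↭-length (Perm.++-comm ys xs)) e

    -- The permutation says that `D` arises from `C` by dropping `X` and taking in `Z`, with no
    -- reference to positions on the cycle.
    exchange-bound : ∀ C D X Z → Lng C → IsCyc D → D ++ X ↭ C ++ Z → length Z ≤ length X
    exchange-bound C D X Z (_ , e) d p = +-cancelˡ-≤ Λ (length Z) (length X) (begin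
      Λ + length Z         ≡⟨ cong (_+ length Z) e ⟨
      length C + length Z  ≡⟨ length-++ C ⟨
      length (C ++ Z)      ≡⟨ Perm.↭-length p ⟨
      length (D ++ X)      ≡⟨ length-++ D ⟩
      length D + length X  ≤⟨ +-monoˡ-≤ (length X) (longest D d) ⟩
      Λ + length X         ∎)
      where open ≤-Reasoning

    exchange-lng : ∀ C D X Z → Lng C → IsCyc D → D ++ X ↭ C ++ Z → length X ≡ length Z → Lng D
    exchange-lng C D X Z (_ , e) d p q = d , trans (+-cancelʳ-≡ (length X) _ _ (begin
      length D + length X  ≡⟨ length-++ D ⟨
      length (D ++ X)      ≡⟨ Perm.↭-length p ⟩
      length (C ++ Z)      ≡⟨ length-++ C ⟩
      length C + length Z  ≡⟨ cong (length C +_) q ⟨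
      length C + length X  ∎)) e
      where
      open import Data.Nat.Properties using (+-cancelʳ-≡)
      open ≡-Reasoning

    chord : ∀ {ξ η} I R Z → Lng (ξ ∷ I ++ η ∷ R) → Walk ξ Z η → Unique ((ξ ∷ I ++ η ∷ R) ++ Z) →
            IsCyc (ξ ∷ Z ++ η ∷ R) × (ξ ∷ Z ++ η ∷ R) ++ I ↭ (ξ ∷ I ++ η ∷ R) ++ Z
    chord {ξ} {η} I R Z ((w , _) , _) z u =
      (walk-join Z z (proj₂ (walk-split I w)) , Unique-part (ξ ∷ Z ++ η ∷ R) perm u) , perm
      where
      perm : (ξ ∷ Z ++ η ∷ R) ++ I ↭ (ξ ∷ I ++ η ∷ R) ++ Z
      perm = solve 5 (λ x i e r z → (x ⊕ z ⊕ e ⊕ r) ⊕ i ⊜ (x ⊕ i ⊕ e ⊕ r) ⊕ z) ↭-refl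
               [ ξ ] I [ η ] R Z

    chord-bound : ∀ {ξ η} I R Z → Lng (ξ ∷ I ++ η ∷ R) → Walk ξ Z η →
                  Unique ((ξ ∷ I ++ η ∷ R) ++ Z) → length Z ≤ length I
    chord-bound {ξ} {η} I R Z c z u =
      let d , p = chord I R Z c z u in exchange-bound (ξ ∷ I ++ η ∷ R) (ξ ∷ Z ++ η ∷ R) I Z c d p

    -- The arcs from ξ′ to η and from η′ to ξ are kept, the first one reversed,
    -- and are joined through Z₁ and Z₂ instead of I and J.
    reroute : ∀ {ξ η} I K J K′ Z₁ Z₂ X Z →
              Lng (ξ ∷ I ++ K ++ η ∷ J ++ K′) →
              Walk ξ Z₁ η → Walk (hd K η) Z₂ (hd K′ ξ) →
              (Z₁ ++ Z₂) ++ X ↭ (I ++ J) ++ Z →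
              Unique ((ξ ∷ I ++ K ++ η ∷ J ++ K′) ++ Z) →
              ∃ λ D → IsCyc D × D ++ X ↭ (ξ ∷ I ++ K ++ η ∷ J ++ K′) ++ Z
    reroute {ξ} {η} I K J K′ Z₁ Z₂ X Z ((w , _) , _) z₁ z₂ p u =
      D , cyc-intro Z₂ (path-join Z₁ N z₁ (path-rev M)) z₂ (Unique-part D perm u) , perm
      where
      open import Data.List.Relation.Binary.Permutation.Propositional using (module PermutationReasoning)
      -- From η′ forward to ξ, through `Z₁` to η, backward to ξ′, and through `Z₂` to η′ again.
      D = ((K′ ++ [ ξ ]) ++ Z₁ ++ reverse (K ++ [ η ])) ++ Z₂
      w′ : Walk ξ ((I ++ K) ++ η ∷ J ++ K′) ξ
      w′ = subst (λ l → Walk ξ l ξ) (sym (++-assoc I K (η ∷ J ++ K′))) w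
      M : Path Adj (hd K η) η (K ++ [ η ])
      M = proj₂ (walk-cut I K (proj₁ (walk-split (I ++ K) w′)))
      N : Path Adj (hd K′ ξ) ξ (K′ ++ [ ξ ])
      N = proj₂ (walk-cut J K′ (proj₂ (walk-split (I ++ K) w′)))
      perm : D ++ X ↭ (ξ ∷ I ++ K ++ η ∷ J ++ K′) ++ Z
      perm = begin
        (((K′ ++ [ ξ ]) ++ Z₁ ++ reverse (K ++ [ η ])) ++ Z₂) ++ X
          ↭⟨ Perm.++⁺ʳ X (Perm.++⁺ʳ Z₂ (Perm.++⁺ˡ (K′ ++ [ ξ ]) (Perm.++⁺ˡ Z₁ (Perm.↭-reverse (K ++ [ η ]))))) ⟩
        (((K′ ++ [ ξ ]) ++ Z₁ ++ (K ++ [ η ])) ++ Z₂) ++ X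
          ↭⟨ solve 7 (λ k′ x z₁ k e z₂ y → (((k′ ⊕ x) ⊕ z₁ ⊕ (k ⊕ e)) ⊕ z₂) ⊕ y ⊜ (k′ ⊕ x ⊕ k ⊕ e) ⊕ ((z₁ ⊕ z₂) ⊕ y))
               ↭-refl K′ [ ξ ] Z₁ K [ η ] Z₂ X ⟩
        (K′ ++ [ ξ ] ++ K ++ [ η ]) ++ ((Z₁ ++ Z₂) ++ X)
          ↭⟨ Perm.++⁺ˡ (K′ ++ [ ξ ] ++ K ++ [ η ]) p ⟩
        (K′ ++ [ ξ ] ++ K ++ [ η ]) ++ ((I ++ J) ++ Z)
          ↭⟨ solve 7 (λ k′ x k e i j z → (k′ ⊕ x ⊕ k ⊕ e) ⊕ ((i ⊕ j) ⊕ z) ⊜ (x ⊕ i ⊕ k ⊕ e ⊕ j ⊕ k′) ⊕ z)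
               ↭-refl K′ [ ξ ] K [ η ] I J Z ⟩
        (ξ ∷ I ++ K ++ η ∷ J ++ K′) ++ Z ∎
        where open PermutationReasoning

    -- An outside path L joining the arcs at a and b, together with the outside
    -- path Q from ξ to η, respectively from ξ′ to η′.
    cross-before : ∀ {ξ η a b} X₁ X₂ K Y₁ Y₂ K′ Q L →
      let C = ξ ∷ (X₁ ++ a ∷ X₂) ++ K ++ η ∷ (Y₁ ++ b ∷ Y₂) ++ K′ in
      Lng C → Walk ξ Q η → Walk a L b → Unique (C ++ Q ++ L) →
      ∃ λ D → IsCyc D × D ++ X₁ ++ Y₁ ↭ C ++ Q ++ L
    cross-before {ξ} {η} {a} {b} X₁ X₂ K Y₁ Y₂ K′ Q L c q l u =
      reroute (X₁ ++ a ∷ X₂) K (Y₁ ++ b ∷ Y₂) K′ Q (reverse X₂ ++ a ∷ L ++ b ∷ Y₂)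
        (X₁ ++ Y₁) (Q ++ L) c q z₂ perm u
      where
      w′ : Walk ξ (((X₁ ++ a ∷ X₂) ++ K) ++ η ∷ (Y₁ ++ b ∷ Y₂) ++ K′) ξ
      w′ = subst (λ l → Walk ξ l ξ) (sym (++-assoc (X₁ ++ a ∷ X₂) K _)) (proj₁ (proj₁ c))
      ws = walk-split ((X₁ ++ a ∷ X₂) ++ K) w′
      -- From ξ′ backward through `X₂` to `a`, across `L` to `b`, and forward through `Y₂` to η′.
      -- Thus `X₁` and `Y₁` are the parts left out.
      z₂ : Walk (hd K η) (reverse X₂ ++ a ∷ L ++ b ∷ Y₂) (hd K′ ξ)
      z₂ = walk-join (reverse X₂)
             (walk-rev X₂ (proj₂ (walk-split X₁ (proj₁ (walk-cut (X₁ ++ a ∷ X₂) K (proj₁ ws))))))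
             (walk-join L l (proj₂ (walk-split Y₁ (proj₁ (walk-cut (Y₁ ++ b ∷ Y₂) K′ (proj₂ ws))))))
      perm : (Q ++ reverse X₂ ++ a ∷ L ++ b ∷ Y₂) ++ X₁ ++ Y₁ ↭
             ((X₁ ++ a ∷ X₂) ++ Y₁ ++ b ∷ Y₂) ++ Q ++ L
      perm = ↭-trans (Perm.++⁺ʳ (X₁ ++ Y₁) (Perm.++⁺ˡ Q (Perm.++⁺ʳ (a ∷ L ++ b ∷ Y₂) (Perm.↭-reverse X₂))))
        (solve 8 (λ q x₂ a l b y₂ x₁ y₁ →
                    (q ⊕ x₂ ⊕ a ⊕ l ⊕ b ⊕ y₂) ⊕ x₁ ⊕ y₁ ⊜ ((x₁ ⊕ a ⊕ x₂) ⊕ y₁ ⊕ b ⊕ y₂) ⊕ q ⊕ l)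
           ↭-refl Q X₂ [ a ] L [ b ] Y₂ X₁ Y₁)

    cross-after : ∀ {ξ η a b} X₁ X₂ K Y₁ Y₂ K′ Q L →
      let C = ξ ∷ (X₁ ++ a ∷ X₂) ++ K ++ η ∷ (Y₁ ++ b ∷ Y₂) ++ K′ in
      Lng C → Walk (hd K η) Q (hd K′ ξ) → Walk a L b → Unique (C ++ Q ++ L) →
      ∃ λ D → IsCyc D × D ++ X₂ ++ Y₂ ↭ C ++ Q ++ L
    cross-after {ξ} {η} {a} {b} X₁ X₂ K Y₁ Y₂ K′ Q L c q l u =
      reroute (X₁ ++ a ∷ X₂) K (Y₁ ++ b ∷ Y₂) K′ (X₁ ++ a ∷ L ++ b ∷ reverse Y₁) Q
        (X₂ ++ Y₂) (Q ++ L) c z₁ q perm u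
      where
      w′ : Walk ξ (((X₁ ++ a ∷ X₂) ++ K) ++ η ∷ (Y₁ ++ b ∷ Y₂) ++ K′) ξ
      w′ = subst (λ l → Walk ξ l ξ) (sym (++-assoc (X₁ ++ a ∷ X₂) K _)) (proj₁ (proj₁ c))
      ws = walk-split ((X₁ ++ a ∷ X₂) ++ K) w′
      z₁ : Walk ξ (X₁ ++ a ∷ L ++ b ∷ reverse Y₁) η
      z₁ = walk-join X₁
             (proj₁ (walk-split X₁ (proj₁ (walk-cut (X₁ ++ a ∷ X₂) K (proj₁ ws)))))
             (walk-join L l (walk-rev Y₁ (proj₁ (walk-split Y₁ (proj₁ (walk-cut (Y₁ ++ b ∷ Y₂) K′ (proj₂ ws)))))))
      perm : ((X₁ ++ a ∷ L ++ b ∷ reverse Y₁) ++ Q) ++ X₂ ++ Y₂ ↭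
             ((X₁ ++ a ∷ X₂) ++ Y₁ ++ b ∷ Y₂) ++ Q ++ L
      perm = ↭-trans (Perm.++⁺ʳ (X₂ ++ Y₂) (Perm.++⁺ʳ Q (Perm.++⁺ˡ X₁ (↭-prep a (Perm.++⁺ˡ L (↭-prep b (Perm.↭-reverse Y₁)))))))
        (solve 8 (λ q x₂ a l b y₂ x₁ y₁ →
                    ((x₁ ⊕ a ⊕ l ⊕ b ⊕ y₁) ⊕ q) ⊕ x₂ ⊕ y₂ ⊜ ((x₁ ⊕ a ⊕ x₂) ⊕ y₁ ⊕ b ⊕ y₂) ⊕ q ⊕ l)
           ↭-refl Q X₂ [ a ] L [ b ] Y₂ X₁ Y₁)

    -- Cycles outside a longest cycle

    -- A separator with at most two vertices misses some vertex of each list, so it leaves two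
    -- components, for which toughness above 1 demands three cut vertices.
    no-small-cut : ∀ {xs ys} → Unique xs → Unique ys → 3 ≤ length xs → 3 ≤ length ys →
                   ∀ S → length S < 3 → ¬ Separates edges xs ys S
    no-small-cut ux uy lx ly S l<3 sep =
      let u , u∈ , u∉ = pick-outside S ux (ℕ.<-≤-trans l<3 lx)
          v , v∈ , v∉ = pick-outside S uy (ℕ.<-≤-trans l<3 ly)
      in ℕ.<⇒≱ l<3 (tough S (u ∷ v ∷ []) (u∉ ∷ v∉ ∷ [])
           (((λ c → let l , p , f = conn⇒path u∉ c
                        w , w∈l , w∈S = sep u∈ v∈ p in f w∈l w∈S) ∷ []) ∷ [] ∷ []) (s≤s (s≤s z≤n)))

    record Spoke (C D p : List V) : Set where
      field
        {foot top} : V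
        {inner}    : List V
        foot∈ : foot ∈ D
        top∈  : top ∈ C
        walk  : Walk foot inner top
        uniq  : Unique inner
        avoid : ∀ {w} → w ∈ inner → w ∉ C × w ∉ D
        part  : ∀ {w} → w ∈ foot ∷ top ∷ inner → w ∈ p

    -- A path from Menger's theorem may visit both cycles repeatedly. Read from its far end, it is
    -- trimmed to the piece from its last vertex on `D` to the first vertex on `C` after that.
    spoke : ∀ {C D u v p} → u ∈ D → v ∈ C → (∀ {w} → w ∈ D → w ∉ C) → Path Adj u v p → Unique p → Spoke C D p
    spoke {C} {D} u∈ v∈ dis p uq with go p uq v∈
      where
      Exit : V → List V → Set
      Exit u p = ∃₂ λ l c → Walk u l c × c ∈ C × Unique l × (∀ {w} → w ∈ l → w ∉ C × w ∉ D) ×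
                            (∀ {w} → w ∈ c ∷ l → w ∈ p)
      go : ∀ {u v p} → Path Adj u v p → Unique p → v ∈ C → (u ∈ C ⊎ Exit u p) ⊎ Spoke C D p
      go (end _) _ v∈ = inj₁ (inj₁ v∈)
      go {u} (_∷_ {w = w} e p) (q ∷ uq) v∈ with go p uq v∈
      ... | inj₂ s = inj₂ record { foot∈ = foot∈ ; top∈ = top∈ ; walk = walk ; uniq = uniq ; avoid = avoid
                                 ; part = there ∘ part }
        where open Spoke s
      ... | inj₁ (inj₁ w∈C) = inj₁ (inj₂ ([] , w , e , w∈C , [] , (λ ()) , λ { (here refl) → there (path-head p) }))
      ... | inj₁ (inj₂ (l , c , wk , c∈ , ul , av , pt)) with w ∈? D | w ∈? C
      ...   | _      | yes w∈C = inj₁ (inj₂ ([] , w , e , w∈C , [] , (λ ()) , λ { (here refl) → there (path-head p) }))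
      ...   | yes w∈D | no _   = inj₂ record { foot∈ = w∈D ; top∈ = c∈ ; walk = wk ; uniq = ul ; avoid = av
          ; part = λ { (here refl) → there (path-head p) ; (there x) → there (pt x) } }
      ...   | no w∉D | no w∉C with w ∈? l
      ...     | no w∉l = inj₁ (inj₂ (w ∷ l , c , (e , wk) , c∈ , Unique-∷ w∉l ul
          , (λ { (here refl) → w∉C , w∉D ; (there x) → av x })
          , λ { (here refl) → there (pt (here refl)) ; (there (here refl)) → there (path-head p)
              ; (there (there x)) → there (pt (there x)) }))
      ...     | yes w∈l with ∈-∃++ w∈l
      ...       | as , bs , refl = inj₁ (inj₂ (w ∷ bs , c , (e , proj₂ (walk-split as wk)) , c∈ , Unique-++⁻ʳ as ul
          , (λ x → av (∈-++⁺ʳ as x))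
          , λ { (here refl) → there (pt (here refl)) ; (there x) → there (pt (there (∈-++⁺ʳ as x))) }))
    ... | inj₂ s = s
    ... | inj₁ (inj₁ u∈C) = ⊥-elim (dis u∈ u∈C)
    ... | inj₁ (inj₂ (l , c , wk , c∈ , ul , av , pt)) = record
      { foot∈ = u∈ ; top∈ = c∈ ; walk = wk ; uniq = ul ; avoid = av
      ; part = λ { (here refl) → path-head p ; (there x) → pt x } }

    record Wheel (c₁ : V) (J₁ : List V) (c₂ : V) (J₂ : List V) (c₃ : V) (J₃ : List V)
                 (d₁ : V) (U₁ : List V) (d₂ : V) (U₂ : List V) (d₃ : V) (U₃ : List V)
                 (L₁ L₂ L₃ : List V) : Set where
      field
        rim    : Lng (c₁ ∷ J₁ ++ c₂ ∷ J₂ ++ c₃ ∷ J₃)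
        hub    : IsCyc (d₁ ∷ U₁ ++ d₂ ∷ U₂ ++ d₃ ∷ U₃)
        spoke₁ : Walk d₁ L₁ c₁
        spoke₂ : Walk d₂ L₂ c₂
        spoke₃ : Walk d₃ L₃ c₃
        simple : Unique ((c₁ ∷ J₁ ++ c₂ ∷ J₂ ++ c₃ ∷ J₃) ++ (d₁ ∷ U₁ ++ d₂ ∷ U₂ ++ d₃ ∷ U₃) ++ L₁ ++ L₂ ++ L₃)

    module _ {c₁ J₁ c₂ J₂ c₃ J₃ d₁ U₁ d₂ U₂ d₃ U₃ L₁ L₂ L₃}
             (W : Wheel c₁ J₁ c₂ J₂ c₃ J₃ d₁ U₁ d₂ U₂ d₃ U₃ L₁ L₂ L₃) where
      open Wheel W

      rotate : Wheel c₂ J₂ c₃ J₃ c₁ J₁ d₂ U₂ d₃ U₃ d₁ U₁ L₂ L₃ L₁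
      rotate = record
        { rim = subst Lng (++-assoc (c₂ ∷ J₂) (c₃ ∷ J₃) (c₁ ∷ J₁)) (lng-rot (c₁ ∷ J₁) (c₂ ∷ J₂ ++ c₃ ∷ J₃) rim)
        ; hub = subst IsCyc (++-assoc (d₂ ∷ U₂) (d₃ ∷ U₃) (d₁ ∷ U₁)) (cyc-rot (d₁ ∷ U₁) (d₂ ∷ U₂ ++ d₃ ∷ U₃) hub)
        ; spoke₁ = spoke₂ ; spoke₂ = spoke₃ ; spoke₃ = spoke₁
        ; simple = Unique-↭ (solve 9 (λ c₁ c₂ c₃ d₁ d₂ d₃ l₁ l₂ l₃ →
              (c₁ ⊕ c₂ ⊕ c₃) ⊕ (d₁ ⊕ d₂ ⊕ d₃) ⊕ l₁ ⊕ l₂ ⊕ l₃ ⊜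
              (c₂ ⊕ c₃ ⊕ c₁) ⊕ (d₂ ⊕ d₃ ⊕ d₁) ⊕ l₂ ⊕ l₃ ⊕ l₁) ↭-refl
            (c₁ ∷ J₁) (c₂ ∷ J₂) (c₃ ∷ J₃) (d₁ ∷ U₁) (d₂ ∷ U₂) (d₃ ∷ U₃) L₁ L₂ L₃) simple
        }

      -- The rim arc from c₁ to c₂ cannot be shortcut by going round the hub
      -- through d₃, which leaves out U₁ only.
      arc-bound : length (d₁ ∷ U₁ ++ d₂ ∷ U₂ ++ d₃ ∷ U₃) ≤ length J₁ + length U₁
      arc-bound = begin
        length D                                ≤⟨ m≤m+n (length D) (length (L₁ ++ L₂)) ⟩
        length D + length (L₁ ++ L₂)            ≡⟨ length-++ D ⟨
        length (D ++ L₁ ++ L₂)                  ≡⟨ Perm.↭-length perm ⟨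
        length (Z ++ U₁)                        ≡⟨ length-++ Z ⟩
        length Z + length U₁                    ≤⟨ ℕ.+-monoˡ-≤ (length U₁) (chord-bound J₁ _ Z rim walk uq) ⟩
        length J₁ + length U₁                   ∎
        where
        open ≤-Reasoning
        D = d₁ ∷ U₁ ++ d₂ ∷ U₂ ++ d₃ ∷ U₃
        C = c₁ ∷ J₁ ++ c₂ ∷ J₂ ++ c₃ ∷ J₃
        Z = reverse L₁ ++ d₁ ∷ reverse U₃ ++ d₃ ∷ reverse U₂ ++ d₂ ∷ L₂
        hs = walk-split U₁ (proj₁ hub)
        hs′ = walk-split U₂ (proj₂ hs)
        walk : Walk c₁ Z c₂
        walk = walk-join (reverse L₁) (walk-rev L₁ spoke₁)
                 (walk-join (reverse U₃) (walk-rev U₃ (proj₂ hs′))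
                   (walk-join (reverse U₂) (walk-rev U₂ (proj₁ hs′)) spoke₂))
        perm : Z ++ U₁ ↭ D ++ L₁ ++ L₂
        perm = ↭-trans (Perm.++⁺ʳ U₁ (Perm.++⁺ (Perm.↭-reverse L₁) (↭-prep d₁
                 (Perm.++⁺ (Perm.↭-reverse U₃) (↭-prep d₃ (Perm.++⁺ʳ (d₂ ∷ L₂) (Perm.↭-reverse U₂)))))))
               (solve 8 (λ l₁ d₁ u₃ d₃ u₂ d₂ l₂ u₁ →
                  (l₁ ⊕ d₁ ⊕ u₃ ⊕ d₃ ⊕ u₂ ⊕ d₂ ⊕ l₂) ⊕ u₁ ⊜ (d₁ ⊕ u₁ ⊕ d₂ ⊕ u₂ ⊕ d₃ ⊕ u₃) ⊕ l₁ ⊕ l₂)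
                 ↭-refl L₁ [ d₁ ] U₃ [ d₃ ] U₂ [ d₂ ] L₂ U₁)
        uq : Unique (C ++ Z)
        uq = Unique-part (C ++ Z) perm-all simple
          where
          perm-all : (C ++ Z) ++ U₁ ++ L₃ ↭ C ++ D ++ L₁ ++ L₂ ++ L₃
          perm-all = ↭-trans
            (solve 4 (λ c z u l → (c ⊕ z) ⊕ u ⊕ l ⊜ c ⊕ (z ⊕ u) ⊕ l) ↭-refl C Z U₁ L₃)
            (↭-trans (Perm.++⁺ˡ C (Perm.++⁺ʳ L₃ perm))
              (solve 5 (λ c d a b l → c ⊕ (d ⊕ a ⊕ b) ⊕ l ⊜ c ⊕ d ⊕ a ⊕ b ⊕ l) ↭-refl C D L₁ L₂ L₃))

    length-three : ∀ (a : V) as (b : V) bs (c : V) cs → length (a ∷ as ++ b ∷ bs ++ c ∷ cs) ≡ 3 + (length as + length bs + length cs)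
    length-three _ as _ bs _ cs = trans (cong suc (trans (length-++ as) (cong (length as +_) (cong suc (length-++ bs)))))
      (arith (length as) (length bs) (length cs))
      where
      arith : ∀ a b c → suc (a + suc (b + suc c)) ≡ 3 + (a + b + c)
      arith = solve-∀

    -- In the sum of the three arc bounds the rim arcs contribute |C| - 3 and the omitted hub arcs
    -- |D| - 3, while |C| + |D| is at most `n`.
    wheel-bound : ∀ {c₁ J₁ c₂ J₂ c₃ J₃ d₁ U₁ d₂ U₂ d₃ U₃ L₁ L₂ L₃} →
                  Wheel c₁ J₁ c₂ J₂ c₃ J₃ d₁ U₁ d₂ U₂ d₃ U₃ L₁ L₂ L₃ →
                  3 * length (d₁ ∷ U₁ ++ d₂ ∷ U₂ ++ d₃ ∷ U₃) + 6 ≤ n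
    wheel-bound {c₁} {J₁} {c₂} {J₂} {c₃} {J₃} {d₁} {U₁} {d₂} {U₂} {d₃} {U₃} {L₁} {L₂} {L₃} W = begin
      3 * d + 6
        ≡⟨ arith₁ d ⟩
      d + (d + d) + 6
        ≤⟨ ℕ.+-monoˡ-≤ 6 (+-mono-≤ (arc-bound W) (+-mono-≤
             (≤-trans (≤-reflexive e₁) (arc-bound (rotate W)))
             (≤-trans (≤-reflexive e₂) (arc-bound (rotate (rotate W)))))) ⟩
      (length J₁ + length U₁) + ((length J₂ + length U₂) + (length J₃ + length U₃)) + 6
        ≡⟨ arith₂ (length J₁) (length J₂) (length J₃) (length U₁) (length U₂) (length U₃) ⟩
      3 + (length J₁ + length J₂ + length J₃) + (3 + (length U₁ + length U₂ + length U₃))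
        ≡⟨ cong₂ _+_ (length-three c₁ J₁ c₂ J₂ c₃ J₃) (length-three d₁ U₁ d₂ U₂ d₃ U₃) ⟨
      length C + d
        ≡⟨ length-++ C ⟨
      length (C ++ D)
        ≤⟨ Unique-length≤ (Unique-++⁻ˡ (C ++ D) (subst Unique (sym (++-assoc C D (L₁ ++ L₂ ++ L₃))) (Wheel.simple W))) ⟩
      n ∎
      where
      open ≤-Reasoning
      open Relation.Binary.PropositionalEquality using (cong₂)
      C = c₁ ∷ J₁ ++ c₂ ∷ J₂ ++ c₃ ∷ J₃
      D = d₁ ∷ U₁ ++ d₂ ∷ U₂ ++ d₃ ∷ U₃
      d = length D
      arith₁ : ∀ d → 3 * d + 6 ≡ d + (d + d) + 6
      arith₁ = solve-∀
      arith₂ : ∀ a b c x y z → (a + x) + ((b + y) + (c + z)) + 6 ≡ 3 + (a + b + c) + (3 + (x + y + z))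
      arith₂ = solve-∀
      swap₁ : ∀ x y z → 3 + (x + y + z) ≡ 3 + (y + z + x)
      swap₁ = solve-∀
      e₁ : d ≡ length (d₂ ∷ U₂ ++ d₃ ∷ U₃ ++ d₁ ∷ U₁)
      e₁ = trans (length-three d₁ U₁ d₂ U₂ d₃ U₃) (trans (swap₁ (length U₁) (length U₂) (length U₃)) (sym (length-three d₂ U₂ d₃ U₃ d₁ U₁)))
      e₂ : d ≡ length (d₃ ∷ U₃ ++ d₁ ∷ U₁ ++ d₂ ∷ U₂)
      e₂ = trans e₁ (trans (length-three d₂ U₂ d₃ U₃ d₁ U₁) (trans (swap₁ (length U₂) (length U₃) (length U₁)) (sym (length-three d₃ U₃ d₁ U₁ d₂ U₂))))

    Round : List V → V → V → V → Set
    Round l x y z = ∃₂ λ U₁ U₂ → ∃ λ U₃ → l ≡ x ∷ U₁ ++ y ∷ U₂ ++ z ∷ U₃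

    -- Three vertices have two cyclic orders. On the rim either one is accepted by renumbering the
    -- spokes; on the hub the wrong one is corrected by reversing the cycle.
    three-on-cycle : ∀ {x y z} l → x ∈ l → y ∈ l → z ∈ l → x ≢ y → x ≢ z → y ≢ z →
                     ∃₂ λ as bs → l ≡ as ++ bs × (Round (bs ++ as) x y z ⊎ Round (bs ++ as) x z y)
    three-on-cycle {x} {y} {z} l x∈ y∈ z∈ x≢y x≢z y≢z with ∈-∃++ x∈
    ... | as , bs , refl = as , x ∷ bs , refl , order
      where
      rest : ∀ {w} → w ∈ as ++ x ∷ bs → x ≢ w → w ∈ bs ++ as
      rest w∈ x≢ with ∈-++⁻ as w∈
      ... | inj₁ p         = ∈-++⁺ʳ bs p
      ... | inj₂ (here e)  = ⊥-elim (x≢ (sym e))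
      ... | inj₂ (there p) = ∈-++⁺ˡ p
      order : Round (x ∷ bs ++ as) x y z ⊎ Round (x ∷ bs ++ as) x z y
      order with ∈-∃++ (rest y∈ x≢y)
      ... | p , q , e with ∈-++⁻ p (subst (z ∈_) e (rest z∈ x≢z))
      ...   | inj₂ (here z≡y) = ⊥-elim (y≢z (sym z≡y))
      ...   | inj₂ (there z∈q) with ∈-∃++ z∈q
      ...     | q₁ , q₂ , refl = inj₁ (p , q₁ , q₂ , cong (x ∷_) e)
      order | p , q , e | inj₁ z∈p with ∈-∃++ z∈p
      ...     | p₁ , p₂ , refl = inj₂ (p₁ , p₂ , q , cong (x ∷_) (trans e (++-assoc p₁ (z ∷ p₂) (y ∷ q))))

    round-rev : ∀ {l x y z} → IsCyc l → Round l x z y → ∃ λ l′ → IsCyc l′ × l′ ↭ l × Round l′ x y z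
    round-rev {x = x} {y} {z} c (U₁ , U₂ , U₃ , refl) =
      _ , cyc-rev x _ c , ↭-prep x (Perm.↭-reverse (U₁ ++ z ∷ U₂ ++ y ∷ U₃)) ,
      reverse U₃ , reverse U₂ , reverse U₁ , cong (x ∷_) eq
      where
      eq : reverse (U₁ ++ z ∷ U₂ ++ y ∷ U₃) ≡ reverse U₃ ++ y ∷ reverse U₂ ++ z ∷ reverse U₁
      eq rewrite reverse-++ U₁ (z ∷ U₂ ++ y ∷ U₃) | unfold-reverse z (U₂ ++ y ∷ U₃)
               | reverse-++ U₂ (y ∷ U₃) | unfold-reverse y U₃
               | ++-assoc (reverse U₃) [ y ] (reverse U₂)
               | ++-assoc (reverse U₃) (y ∷ reverse U₂) [ z ]
               | ++-assoc (reverse U₃) (y ∷ reverse U₂ ++ [ z ]) (reverse U₁)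
               | ++-assoc (reverse U₂) [ z ] (reverse U₁) = refl

    outside-cycle-bound : ∀ C D → Lng C → IsCyc D → Unique (C ++ D) → 3 ≤ length D → 3 * length D + 6 ≤ n
    -- `C` is at least as long as `D`, so both cycles have the three vertices that `no-small-cut`
    -- needs. The goal is decidable and can absorb the double negation of `menger`.
    outside-cycle-bound C D lngC cycD uq 3≤D = decidable-stable (_ ≤? _) λ ¬bound →
      menger edges D C 3 (no-small-cut uD uC 3≤D (≤-trans 3≤D (≤-trans (longest D cycD) (≤-reflexive (sym (proj₂ lngC))))))
        λ F → ¬bound (fromFamily F)
      where
      uD : Unique D
      uD = Unique-++⁻ʳ C uq
      uC : Unique C
      uC = Unique-++⁻ˡ C uq
      dis : ∀ {w} → w ∈ D → w ∉ C
      dis d c = Unique-disjoint C uq c d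
      fromFamily : Family edges D C 3 → 3 * length D + 6 ≤ n
      fromFamily F = by-rim (three-on-cycle C (top∈ (s 0F)) (top∈ (s 1F)) (top∈ (s 2F)) (top≢ λ ()) (top≢ λ ()) (top≢ λ ()))
        where
        open Spoke
        open import Data.Fin.Patterns using (0F; 1F; 2F)
        module F = Family F
        s : ∀ i → Spoke C D (F.list i)
        s i = spoke (F.src∈ i) (F.tgt∈ i) dis (path-map edge⇒adj (F.path i)) (F.uniq i)
        top≢ : ∀ {i j} → i ≢ j → top (s i) ≢ top (s j)
        top≢ {i} {j} i≢j e = i≢j (F.disj (part (s i) (there (here refl)))
                                     (subst (_∈ F.list j) (sym e) (part (s j) (there (here refl)))))
        foot≢ : ∀ {i j} → i ≢ j → foot (s i) ≢ foot (s j)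
        foot≢ {i} {j} i≢j e = i≢j (F.disj (part (s i) (here refl))
                                     (subst (_∈ F.list j) (sym e) (part (s j) (here refl))))
        inner≢ : ∀ {i j w} → i ≢ j → w ∈ inner (s i) → w ∉ inner (s j)
        inner≢ {i} {j} i≢j a b = i≢j (F.disj (part (s i) (there (there a))) (part (s j) (there (there b))))
        module _ (i j k : Fin 3) (i≢j : i ≢ j) (i≢k : i ≢ k) (j≢k : j ≢ k) where
          Ls = inner (s i) ++ inner (s j) ++ inner (s k)
          all-unique : Unique (C ++ D ++ Ls)
          all-unique = subst Unique (++-assoc C D Ls) (Unique.++⁺ uq
            (Unique.++⁺ (uniq (s i)) (Unique.++⁺ (uniq (s j)) (uniq (s k)) λ (a , b) → inner≢ j≢k a b)
              λ (a , b) → [ inner≢ i≢j a , inner≢ i≢k a ]′ (∈-++⁻ (inner (s j)) b))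
            λ (a , b) → case ∈-++⁻ C a , av b of λ
              { (inj₁ c , c∉ , _) → c∉ c ; (inj₂ d , _ , d∉) → d∉ d })
            where
            av : ∀ {w} → w ∈ Ls → w ∉ C × w ∉ D
            av b = case ∈-++⁻ (inner (s i)) b of λ
              { (inj₁ x) → avoid (s i) x
              ; (inj₂ x) → [ avoid (s j) , avoid (s k) ]′ (∈-++⁻ (inner (s j)) x) }
          finish : ∀ {C′ D′} → Lng C′ → C′ ↭ C → Round C′ (top (s i)) (top (s j)) (top (s k)) →
                   IsCyc D′ → D′ ↭ D → Round D′ (foot (s i)) (foot (s j)) (foot (s k)) → 3 * length D + 6 ≤ n
          finish l pC (J₁ , J₂ , J₃ , refl) c pD (U₁ , U₂ , U₃ , refl) =
            subst (λ d → 3 * d + 6 ≤ n) (Perm.↭-length pD) (wheel-bound {L₁ = inner (s i)} {inner (s j)} {inner (s k)} record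
              { rim = l ; hub = c ; spoke₁ = walk (s i) ; spoke₂ = walk (s j) ; spoke₃ = walk (s k)
              ; simple = Unique-↭ (Perm.++⁺ (↭-sym pC) (Perm.++⁺ʳ Ls (↭-sym pD))) all-unique })
          by-hub : ∀ {C′} → Lng C′ → C′ ↭ C → Round C′ (top (s i)) (top (s j)) (top (s k)) → 3 * length D + 6 ≤ n
          by-hub l pC r with three-on-cycle D (foot∈ (s i)) (foot∈ (s j)) (foot∈ (s k)) (foot≢ i≢j) (foot≢ i≢k) (foot≢ j≢k)
          ... | as , bs , refl , inj₁ r′ = finish l pC r (cyc-rot as bs cycD) (Perm.++-comm bs as) r′
          ... | as , bs , refl , inj₂ r′ with round-rev (cyc-rot as bs cycD) r′
          ...   | _ , c , p , r″ = finish l pC r c (↭-trans p (Perm.++-comm bs as)) r″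
        by-rim : (∃₂ λ as bs → C ≡ as ++ bs ×
                   (Round (bs ++ as) (top (s 0F)) (top (s 1F)) (top (s 2F)) ⊎
                    Round (bs ++ as) (top (s 0F)) (top (s 2F)) (top (s 1F)))) → 3 * length D + 6 ≤ n
        by-rim (as , bs , e , inj₁ r) = by-hub 0F 1F 2F (λ ()) (λ ()) (λ ()) (lng-rot as bs (subst Lng e lngC))
          (↭-trans (Perm.++-comm bs as) (↭-reflexive (sym e))) r
        by-rim (as , bs , e , inj₂ r) = by-hub 0F 2F 1F (λ ()) (λ ()) (λ ()) (lng-rot as bs (subst Lng e lngC))
          (↭-trans (Perm.++-comm bs as) (↭-reflexive (sym e))) r

    -- Neighbours of an end of the outside path

    -- `capped` is all that the degree count uses of the maximality of P.
    record End (C : List V) (x y : V) (P : List V) : Set where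
      field
        lng    : Lng C
        path   : Path Adj x y P
        simple : Unique (C ++ P)
        two    : 2 ≤ length P
        capped : ∀ {z} → Adj x z → z ∈ C ⊎ z ∈ P

    -- Let `w` follow `x` on P. If `x` has no further neighbour on P, then `As` and `w` cut it off
    -- from C: toughness gives two vertices in `As`, and the degree of `x` is at most one more than
    -- their number. Otherwise the last neighbour of `x` on P closes a cycle outside C.
    end-degree : ∀ {C x y P} → End C x y P → ∀ As → (∀ {z} → z ∈ As → z ∈ C) →
                 (∀ {z} → z ∈ C → Adj x z → z ∈ As) →
                 δ + 1 ≤ length As + length P × 2 ≤ length As × (3 ≤ length As ⊎ δ ≤ 3)
    end-degree {C} record { path = end _ ; two = s≤s () }
    end-degree {C} {x} {y} e@(record { path = _∷_ {w = w} {l = P₀} x~w p }) As As⊆ covers =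
      bound₁ , proj₁ bounds , proj₂ bounds
      where
      open End e
      nbr : ∀ {z} → Adj x z → z ∈ As ++ P₀
      nbr a with capped a
      ... | inj₁ z∈C         = ∈-++⁺ˡ (covers z∈C a)
      ... | inj₂ (here refl) = ⊥-elim (irrefl refl a)
      ... | inj₂ (there z∈)  = ∈-++⁺ʳ As z∈
      bound₁ : δ + 1 ≤ length As + suc (length P₀)
      bound₁ = begin
        δ + 1                     ≡⟨ ℕ.+-comm δ 1 ⟩
        suc δ                     ≤⟨ s≤s (δ≤ x) ⟩
        suc (degree G x)          ≤⟨ s≤s (degree≤ x (As ++ P₀) nbr) ⟩
        suc (length (As ++ P₀))   ≡⟨ cong suc (length-++ As) ⟩
        suc (length As + length P₀) ≡⟨ ℕ.+-suc (length As) _ ⟨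
        length As + suc (length P₀) ∎
        where open ≤-Reasoning
      uP : Unique (x ∷ P₀)
      uP = Unique-++⁻ʳ C simple
      out : ∀ {z} → z ∈ x ∷ P₀ → z ∉ C
      out z∈P z∈C = Unique-disjoint C simple z∈C z∈P
      tail : ∃ λ P₁ → P₀ ≡ w ∷ P₁
      tail = first p
        where
        first : ∀ {w y l} → Path Adj w y l → ∃ λ l₁ → l ≡ w ∷ l₁
        first (end _) = _ , refl
        first (_ ∷ _) = _ , refl
      P₁ = proj₁ tail
      bounds : 2 ≤ length As × (3 ≤ length As ⊎ δ ≤ 3)
      bounds with last-such (adj? x) P₁
      ... | inj₁ none = two-As , [ inj₁ , (λ l → inj₂ (≤-trans few (ℕ.+-monoˡ-≤ 1 l))) ]′ (compare (length As))
        where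
        compare : ∀ a → 3 ≤ a ⊎ a ≤ 2
        compare a = case 3 ≤? a of λ { (yes p) → inj₁ p ; (no q) → inj₂ (s≤s⁻¹ (ℕ.≰⇒> q)) }
        nbr′ : ∀ {z} → Adj x z → z ∈ As ++ [ w ]
        nbr′ a with ∈-++⁻ As (nbr a)
        ... | inj₁ q = ∈-++⁺ˡ q
        ... | inj₂ q with subst (_ ∈_) (proj₂ tail) q
        ...   | here refl = ∈-++⁺ʳ As (here refl)
        ...   | there r   = ⊥-elim (All.lookup none r a)
        few : δ ≤ length As + 1
        few = ≤-trans (δ≤ x) (≤-trans (degree≤ x (As ++ [ w ]) nbr′) (≤-reflexive (length-++ As)))
        stuck : ∀ {c} → c ∈ C → ¬ Conn (As ++ [ w ]) x c
        stuck c∈ ε                  = out (here refl) c∈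
        stuck c∈ ((_ , v∉ , a) ◅ _) = v∉ (nbr′ a)
        two-As : 2 ≤ length As
        two-As = decidable-stable (2 ≤? length As) λ ¬2 →
          let 2≤C = ≤-trans (longest (x ∷ w ∷ []) ((x~w , adj-sym x~w) , Unique-∷ (λ { (here refl) → irrefl refl x~w }) ([] ∷ [])))
                            (≤-reflexive (sym (proj₂ lng)))
              c , c∈ , c∉ = pick-outside As (cyc-unique C (proj₁ lng)) (ℕ.<-≤-trans (ℕ.≰⇒> ¬2) 2≤C)
              S = As ++ [ w ]
              w∉C = out (there (subst (w ∈_) (sym (proj₂ tail)) (here refl)))
              x∉S : x ∉ S
              x∉S q = case ∈-++⁻ As q of λ
                { (inj₁ r) → out (here refl) (As⊆ r) ; (inj₂ (here refl)) → irrefl refl x~w }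
              c∉S : c ∉ S
              c∉S q = case ∈-++⁻ As q of λ { (inj₁ r) → c∉ r ; (inj₂ (here eq)) → w∉C (subst (_∈ C) eq c∈) }
          in ℕ.<⇒≱ (tough S (x ∷ c ∷ []) (x∉S ∷ c∉S ∷ []) ((stuck c∈ ∷ []) ∷ [] ∷ []) (s≤s (s≤s z≤n)))
               (≤-trans (≤-reflexive (trans (length-++ As) (ℕ.+-comm (length As) 1))) (ℕ.≰⇒> ¬2))
      ... | inj₂ (a , z , b , eq , x~z , none) = ≤-trans (s≤s (s≤s z≤n)) three , inj₁ three
        where
        whole : x ∷ P₀ ≡ x ∷ (w ∷ a) ++ z ∷ b
        whole = cong (x ∷_) (trans (proj₂ tail) (cong (w ∷_) eq))
        D = x ∷ (w ∷ a) ++ [ z ]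
        perm : D ++ b ↭ x ∷ P₀
        perm = ↭-reflexive (trans (cong (x ∷_) (++-assoc (w ∷ a) [ z ] b)) (sym whole))
        cyc : IsCyc D
        cyc = walk-join (w ∷ a) (path⇒walk (w ∷ a) (subst (Path Adj x y) whole path)) (adj-sym x~z)
            , Unique-part D perm uP
        lenD : length D ≡ 3 + length a
        lenD = cong (2 +_) (trans (length-++ a) (ℕ.+-comm (length a) 1))
        long : 3 * length D + 6 ≤ n
        long = outside-cycle-bound C D lng cyc
          (Unique-part (C ++ D) (↭-trans (↭-reflexive (++-assoc C D b)) (Perm.++⁺ˡ C perm)) simple)
          (≤-trans (m≤m+n 3 (length a)) (≤-reflexive (sym lenD)))
        nbr′ : ∀ {v} → Adj x v → v ∈ As ++ (w ∷ a) ++ [ z ]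
        nbr′ v~ with ∈-++⁻ As (nbr v~)
        ... | inj₁ q = ∈-++⁺ˡ q
        ... | inj₂ q with ∈-++⁻ ((w ∷ a) ++ [ z ]) {b}
                            (subst (_ ∈_) (trans (proj₂ tail) (trans (cong (w ∷_) eq) (sym (++-assoc (w ∷ a) [ z ] b)))) q)
        ...   | inj₁ r = ∈-++⁺ʳ As r
        ...   | inj₂ r = ⊥-elim (All.lookup none r v~)
        few : δ ≤ length As + (2 + length a)
        few = ≤-trans (δ≤ x) (≤-trans (degree≤ x _ nbr′) (≤-reflexive
                (trans (length-++ As) (cong (length As +_) (ℕ.suc-injective lenD)))))
        -- `D` contains `x` and all its neighbours on P, so δ ≤ |As| + |D| - 1. Together with 3|D| +
        -- 6 ≤ n ≤ 3δ + 2 this gives 3|As| ≥ 7.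
        three : 3 ≤ length As
        three = ℕ.*-cancelˡ-< 3 2 (length As) (ℕ.+-cancelʳ-≤ (3 * length a + 8) 7 (3 * length As) (begin
          7 + (3 * length a + 8)                 ≡⟨ arith₁ (length a) ⟩
          3 * (3 + length a) + 6                 ≡⟨ cong (λ d → 3 * d + 6) lenD ⟨
          3 * length D + 6                       ≤⟨ long ⟩
          n                                      ≤⟨ n≤ ⟩
          3 * δ + 2                              ≤⟨ ℕ.+-monoˡ-≤ 2 (ℕ.*-monoʳ-≤ 3 few) ⟩
          3 * (length As + (2 + length a)) + 2   ≡⟨ arith₂ (length As) (length a) ⟩
          3 * length As + (3 * length a + 8)     ∎))
          where
          open ≤-Reasoning
          arith₁ : ∀ a → 7 + (3 * a + 8) ≡ 3 * (3 + a) + 6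
          arith₁ = solve-∀
          arith₂ : ∀ s a → 3 * (s + (2 + a)) + 2 ≡ 3 * s + (3 * a + 8)
          arith₂ = solve-∀

    -- The arcs cut out by a maximal outside path

    module Extremal (j : ℕ)
      (maximal : ∀ {C x y P} → Lng C → Path Adj x y P → Unique (C ++ P) → length P ≤ 2 + j) where

      record Outer (C : List V) (x y : V) (P : List V) : Set where
        constructor outer
        field
          lng    : Lng C
          path   : Path Adj x y P
          simple : Unique (C ++ P)
          size   : length P ≡ 2 + j

      Bridged : V → V → V → V → Set
      Bridged x y ξ η = (Adj x ξ × Adj y η) ⊎ (Adj y ξ × Adj x η)

      excess : Seg → ℕ
      excess (_ , I) = length I ∸ (2 + j)

      -- The second alternative of `even` is the case with private neighbours; its excess is too
      -- small for any link, so `Thin` disposes of it.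
      record Config (x y : V) (P : List V) : Set where
        field
          segs   : List Seg
          ground : Outer (flat segs) x y P
          free   : ∀ {ξ I v} → (ξ , I) ∈ segs → v ∈ I → ¬ Adj x v × ¬ Adj y v
          linked : ∀ {ξ I η J} → (ξ , I) ∈ segs → (η , J) ∈ segs → ξ ≢ η → Bridged x y ξ η
          long   : ∀ {ξ I} → (ξ , I) ∈ segs → 2 + j ≤ length I
          many   : 2 ≤ length segs
          bound  : total excess segs ≤ 1 ⊎ (j ≡ 0 × total excess segs ≤ 3) ⊎ (j ≡ 1 × total excess segs ≤ 2)
          even   : (∀ {ξ I} → (ξ , I) ∈ segs → Adj x ξ × Adj y ξ) ⊎ (j ≡ 0 × total excess segs ≤ 1)
        open Outer ground public

      lng-flat-rot : ∀ ss ts → Lng (flat (ss ++ ts)) → Lng (flat (ts ++ ss))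
      lng-flat-rot ss ts l rewrite flat-++ ss ts | flat-++ ts ss = lng-rot (flat ss) (flat ts) l

      flat-rot-↭ : ∀ ss ts → flat (ss ++ ts) ↭ flat (ts ++ ss)
      flat-rot-↭ ss ts rewrite flat-++ ss ts | flat-++ ts ss = Perm.++-comm (flat ss) (flat ts)

      outer-walk : ∀ {C x y P ξ η} → Outer C x y P → Bridged x y ξ η → ∃ λ Q → Walk ξ Q η × Q ↭ P
      outer-walk {P = P} o (inj₁ (xξ , yη)) = P , path-walk (adj-sym xξ) (Outer.path o) yη , ↭-refl
      outer-walk {P = P} o (inj₂ (yξ , xη)) =
        reverse P , path-walk (adj-sym yξ) (path-rev (Outer.path o)) xη , Perm.↭-reverse P

      outer-rev : ∀ {C x y P} → Outer C x y P → Outer C y x (reverse P)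
      outer-rev {C} {P = P} (outer l p s z) = outer l (path-rev p)
        (Unique-↭ (Perm.++⁺ˡ C (↭-sym (Perm.↭-reverse P))) s) (trans (length-reverse P) z)

      outer-disjoint : ∀ {C x y P v} → Outer C x y P → v ∈ P → v ∉ C
      outer-disjoint {C} o v∈P v∈C = Unique-disjoint C (Outer.simple o) v∈C v∈P

      spaced : ∀ {x y P ξ I η J r} → Outer (flat ((ξ , I) ∷ (η , J) ∷ r)) x y P →
               Bridged x y ξ η → 2 + j ≤ length I
      spaced {ξ = ξ} {I} {η} {J} {r} o lk =
        let Q , w , p = outer-walk o lk in
        subst (_≤ length I) (trans (Perm.↭-length p) size)
          (chord-bound I (J ++ flat r) Q lng w (Unique-↭ (Perm.++⁺ˡ (flat ((ξ , I) ∷ (η , J) ∷ r)) (↭-sym p)) simple))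
        where open Outer o

      -- Between two neighbours of the same end of P, that end alone can be inserted.
      gap : ∀ {x y P ξ I η J r} → Outer (flat ((ξ , I) ∷ (η , J) ∷ r)) x y P →
            Adj x ξ ⊎ Adj y ξ → Adj x η ⊎ Adj y η → 1 ≤ length I
      gap {x} {y} {ξ = ξ} {I} {η} {J} {r} o = λ
        { (inj₁ a) (inj₁ b) → via (path-head path) a b
        ; (inj₂ a) (inj₂ b) → via (path-last path) a b
        ; (inj₁ a) (inj₂ b) → ≤-trans (s≤s z≤n) (spaced {J = J} {r} o (inj₁ (a , b)))
        ; (inj₂ a) (inj₁ b) → ≤-trans (s≤s z≤n) (spaced {J = J} {r} o (inj₂ (a , b))) }
        where
        open Outer o
        C = flat ((ξ , I) ∷ (η , J) ∷ r)
        via : ∀ {z} → z ∈ _ → Adj z ξ → Adj z η → 1 ≤ length I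
        via {z} z∈ a b = chord-bound I (J ++ flat r) [ z ] lng (adj-sym a , b)
          (Unique.++⁺ (Unique-++⁻ˡ C simple) ([] ∷ []) λ { (c , here refl) → outer-disjoint o z∈ c })

      outer-end : ∀ {C x y P} → Outer C x y P → End C x y P
      outer-end {C} {x} {y} {P} o = record
        { lng = lng ; path = path ; simple = simple
        ; two = ≤-trans (s≤s (s≤s z≤n)) (≤-reflexive (sym size))
        -- A neighbour anywhere else would extend P at `x`.
        ; capped = λ {z} a → decidable-stable (z ∈? C ⊎-dec z ∈? P) λ ¬in →
            ℕ.<⇒≱ (ℕ.≤-reflexive (cong suc (sym size))) (maximal lng (adj-sym a ∷ path)
              (Unique-↭ (↭-sym (Perm.shift z C P))
                (Unique-∷ (λ q → ¬in (∈-++⁻ C q)) simple)))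
        }
        where open Outer o

      total-excess : ∀ ss → (∀ {ξ I} → (ξ , I) ∈ ss → 2 + j ≤ length I) →
                     total inner-length ss ≡ length ss * (2 + j) + total excess ss
      total-excess []             _ = refl
      total-excess ((ξ , I) ∷ ss) l = trans
        (cong₂ _+_ (sym (ℕ.m+[n∸m]≡n (l (here refl)))) (total-excess ss (l ∘ there)))
        (arith (2 + j) (length I ∸ (2 + j)) (length ss * (2 + j)) (total excess ss))
        where
        arith : ∀ a b c d → a + b + (c + d) ≡ a + c + (b + d)
        arith = solve-∀

      module Build {x y : V} {P : List V} (v : V) (I : List V) (ss : List Seg)
                   (ground : Outer (flat ((v , I) ∷ ss)) x y P)
                   (all-parts : All (λ s → (Adj x (proj₁ s) ⊎ Adj y (proj₁ s)) ×
                                  All (λ z → ¬ (Adj x z ⊎ Adj y z)) (proj₂ s)) ((v , I) ∷ ss)) where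

        segs = (v , I) ∷ ss
        letter : V → Set
        letter z = Adj x z ⊎ Adj y z
        pv : letter v
        pv = proj₁ (All.lookup all-parts (here refl))
        open Outer ground
        free : ∀ {ξ I v} → (ξ , I) ∈ segs → v ∈ I → ¬ Adj x v × ¬ Adj y v
        free s∈ v∈ = let ¬l = All.lookup (proj₂ (All.lookup all-parts s∈)) v∈ in ¬l ∘ inj₁ , ¬l ∘ inj₂
        is-letter : ∀ {s} → s ∈ segs → letter (proj₁ s)
        is-letter s∈ = proj₁ (All.lookup all-parts s∈)
        module XY = Letters (adj? x) (adj? y)
        module YX = Letters (adj? y) (adj? x)
        hits-facts : ∀ {z} (z? : ∀ w → Dec (Adj z w)) → (∀ {w} → Adj z w → letter w) →
          let As = map proj₁ (filter (λ s → z? (proj₁ s)) segs) in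
          (∀ {w} → w ∈ As → w ∈ flat segs) × (∀ {w} → w ∈ flat segs → Adj z w → w ∈ As)
        hits-facts {z} z? toL = sub , cov
          where
          sub : ∀ {w} → w ∈ map proj₁ (filter (λ s → z? (proj₁ s)) segs) → w ∈ flat segs
          sub w∈ with ∈-map⁻ proj₁ w∈
          ... | s , s∈ , refl = ∈-flat-ξ (proj₁ (∈-filter⁻ (λ s → z? (proj₁ s)) s∈))
          cov : ∀ {w} → w ∈ flat segs → Adj z w → w ∈ map proj₁ (filter (λ s → z? (proj₁ s)) segs)
          cov w∈ a with ∈-flat⁻ segs w∈
          ... | s , s∈ , inj₁ refl = ∈-map⁺ proj₁ (∈-filter⁺ (λ s → z? (proj₁ s)) s∈ a)
          ... | s , s∈ , inj₂ w∈I  = ⊥-elim (All.lookup (proj₂ (All.lookup all-parts s∈)) w∈I (toL a))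
        c = total XY.both segs
        p = total XY.onlyX segs
        q = total XY.onlyY segs
        both-comm : ∀ ss → total YX.both ss ≡ total XY.both ss
        both-comm [] = refl
        both-comm ((ξ , _) ∷ ss) = cong₂ _+_ (one (adj? x ξ) (adj? y ξ)) (both-comm ss)
          where
          one : ∀ {A B : Set} (a : Dec A) (b : Dec B) → indicator (b ×-dec a) ≡ indicator (a ×-dec b)
          one (yes _) (yes _) = refl
          one (yes _) (no _)  = refl
          one (no _)  (yes _) = refl
          one (no _)  (no _)  = refl
        degX = let s , t = hits-facts {x} (adj? x) inj₁ in end-degree (outer-end ground) (XY.hits segs) s t
        degY = let s , t = hits-facts {y} (adj? y) inj₂ in end-degree (outer-end (outer-rev ground)) (YX.hits segs) s t
        lenX : length (XY.hits segs) ≡ c + p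
        lenX = XY.length-hits segs
        lenY : length (YX.hits segs) ≡ c + q
        lenY = trans (YX.length-hits segs) (cong (_+ q) (both-comm segs))
        len-segs : length segs ≡ c + p + q
        len-segs = XY.length-letters segs (All.map proj₁ all-parts)
        2≤x : 2 ≤ c + p
        2≤x = subst (2 ≤_) lenX (proj₁ (proj₂ degX))
        2≤y : 2 ≤ c + q
        2≤y = subst (2 ≤_) lenY (proj₁ (proj₂ degY))
        many : 2 ≤ length segs
        many = ≤-trans 2≤x (≤-trans (m≤m+n (c + p) q) (≤-reflexive (sym len-segs)))
        rotated : ∀ pre post → segs ≡ pre ++ post → Outer (flat (post ++ pre)) x y P
        rotated pre post e = outer (lng-flat-rot pre post (subst (Lng ∘ flat) e lng)) path
          (Unique-↭ (Perm.++⁺ʳ P (↭-trans (↭-reflexive (cong flat e)) (flat-rot-↭ pre post))) simple) size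
        spaced-all : ∀ pre post → segs ≡ pre ++ post → SpacedAll (adj? x) (adj? y) (1 + j) post v
        spaced-all pre [] e = tt
        spaced-all pre ((ξ , I′) ∷ post) e =
          step (rest-nonempty {v , I} pre post (subst (2 ≤_) (cong length e) many) (cong (λ ss → hdξ ss v) e)) ,
          spaced-all (pre ++ [ (ξ , I′) ]) post (trans e (sym (++-assoc pre [ (ξ , I′) ] post)))
          where
          step : (∃ λ J → ∃ λ r → post ++ pre ≡ (hdξ post v , J) ∷ r) → Spaced (adj? x) (adj? y) (1 + j) ξ I′ (hdξ post v)
          step (J , r , e′) = gap {J = J} {r} o′ (is-letter (back (here refl))) (is-letter (back (there (here refl)))) ,
                              spaced {J = J} {r} o′
            where
            o′ : Outer (flat ((ξ , I′) ∷ (hdξ post v , J) ∷ r)) x y P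
            o′ = subst (λ ss → Outer (flat ((ξ , I′) ∷ ss)) x y P) e′ (rotated pre ((ξ , I′) ∷ post) e)
            back : ∀ {s} → s ∈ (ξ , I′) ∷ (hdξ post v , J) ∷ r → s ∈ segs
            back {s} s∈ = subst (s ∈_) (sym e) (Perm.∈-resp-↭ (Perm.++-comm ((ξ , I′) ∷ post) pre)
              (subst (λ ss → s ∈ (ξ , I′) ∷ ss) (sym e′) s∈))
        low : c * (2 + j) + p + q + (1 + j) * (XY.turns segs v + YX.turns segs v) ≤ total inner-length segs
        low = letters-bound (adj? x) (adj? y) (1 + j) segs v (spaced-all [] segs refl) (All.map proj₁ all-parts) pv
        fits : (2 + j) + (c + p + q) + total inner-length segs ≤ n
        fits = ≤-trans (≤-reflexive (trans (arith (2 + j) (c + p + q) (total inner-length segs)) (trans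
            (cong₂ _+_ (trans (cong (_+ total inner-length segs) (sym len-segs)) (sym (length-flat segs))) (sym size))
            (sym (length-++ (flat segs)))))) (Unique-length≤ simple)
          where
          arith : ∀ a b c → a + b + c ≡ b + c + a
          arith = solve-∀
        Verdict : Set
        Verdict = (j ≡ 0 × p ≤ 1 × q ≤ 1 × total inner-length segs ≤ (c + p + q) * 2) ⊎
                  (p ≡ 0 × q ≡ 0 × EvenBound j c (total inner-length segs))
        nums : Verdict
        nums = letter-count-cases {j} {c} {p} {q} {total inner-length segs} {n} {δ} {XY.turns segs v} {YX.turns segs v}
          (subst₂ (λ a b → δ + 1 ≤ a + b) lenX size (proj₁ degX))
          (subst₂ (λ a b → δ + 1 ≤ a + b) lenY (trans (length-reverse P) size) (proj₁ degY))
          n≤ fits 2≤x 2≤y (subst (λ a → 3 ≤ a ⊎ δ ≤ 3) lenX (proj₂ (proj₂ degX)))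
          (λ h h′ → XY.turns≥1 v I ss h h′)
          (λ h h′ → YX.turns≥1 v I ss h (subst (λ b → 1 ≤ b + p) (sym (both-comm segs)) h′))
          low
        p≤1 : p ≤ 1
        p≤1 = case nums of λ { (inj₁ (_ , h , _)) → h ; (inj₂ (h , _)) → ≤-trans (≤-reflexive h) z≤n }
        q≤1 : q ≤ 1
        q≤1 = case nums of λ { (inj₁ (_ , _ , h , _)) → h ; (inj₂ (_ , h , _)) → ≤-trans (≤-reflexive h) z≤n }
        onlyX≥1 : ∀ {ξ I} → Adj x ξ → ¬ Adj y ξ → 1 ≤ XY.onlyX (ξ , I)
        onlyX≥1 {ξ} a b with adj? x ξ | adj? y ξ
        ... | yes _ | no _  = s≤s z≤n
        ... | no ¬a | _     = ⊥-elim (¬a a)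
        ... | yes _ | yes c = ⊥-elim (b c)
        onlyY≥1 : ∀ {ξ I} → Adj y ξ → ¬ Adj x ξ → 1 ≤ XY.onlyY (ξ , I)
        onlyY≥1 {ξ} a b with adj? y ξ | adj? x ξ
        ... | yes _ | no _  = s≤s z≤n
        ... | no ¬a | _     = ⊥-elim (¬a a)
        ... | yes _ | yes c = ⊥-elim (b c)
        -- P fails to join two marks only if both are private to the same end, and each end has at
        -- most one private mark.
        linked : ∀ {ξ I η J} → (ξ , I) ∈ segs → (η , J) ∈ segs → ξ ≢ η → Bridged x y ξ η
        linked {ξ} {I} {η} {J} s∈ t∈ ξ≢η with adj? x ξ | adj? y ξ | adj? x η | adj? y η
        ... | yes a | _     | _     | yes b = inj₁ (a , b)
        ... | _     | yes a | yes b | _     = inj₂ (a , b)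
        ... | no a  | no b  | _     | _     = ⊥-elim ([ a , b ]′ (is-letter s∈))
        ... | _     | _     | no a  | no b  = ⊥-elim ([ a , b ]′ (is-letter t∈))
        ... | yes a | no b  | yes c′ | no d = ⊥-elim (ℕ.<⇒≱ (s≤s (≤-trans
                (+-mono-≤ (onlyX≥1 {I = I} a b) (onlyX≥1 {I = J} c′ d)) (total-two XY.onlyX s∈ t∈ (ξ≢η ∘ cong proj₁)))) (s≤s p≤1))
        ... | no b | yes a | no d | yes c′ = ⊥-elim (ℕ.<⇒≱ (s≤s (≤-trans
                (+-mono-≤ (onlyY≥1 {I = I} a b) (onlyY≥1 {I = J} c′ d)) (total-two XY.onlyY s∈ t∈ (ξ≢η ∘ cong proj₁)))) (s≤s q≤1))
        long : ∀ {ξ I} → (ξ , I) ∈ segs → 2 + j ≤ length I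
        long {ξ} {I′} s∈ with ∈-∃++ s∈
        ... | pre , post , e with rest-nonempty {v , I} pre post (subst (2 ≤_) (cong length e) many) (cong (λ ss → hdξ ss v) e)
        ...   | J , r , e′ = spaced {J = J} {r} o′ (linked s∈ t∈ ξ≢)
          where
          o′ : Outer (flat ((ξ , I′) ∷ (hdξ post v , J) ∷ r)) x y P
          o′ = subst (λ ss → Outer (flat ((ξ , I′) ∷ ss)) x y P) e′ (rotated pre ((ξ , I′) ∷ post) e)
          t∈ : (hdξ post v , J) ∈ segs
          t∈ = subst (_ ∈_) (sym e) (Perm.∈-resp-↭ (Perm.++-comm ((ξ , I′) ∷ post) pre)
              (subst (λ ss → (hdξ post v , J) ∈ (ξ , I′) ∷ ss) (sym e′) (there (here refl))))
          ξ≢ : ξ ≢ hdξ post v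
          ξ≢ eq with Unique-++⁻ˡ (flat ((ξ , I′) ∷ (hdξ post v , J) ∷ r)) (Outer.simple o′)
          ... | h ∷ _ = All.lookup h (∈-++⁺ʳ I′ (here refl)) eq
        cancel : ∀ {E} → total inner-length segs ≤ length segs * (2 + j) + E → total excess segs ≤ E
        cancel h = ℕ.+-cancelˡ-≤ (length segs * (2 + j)) _ _ (≤-trans (≤-reflexive (sym (total-excess segs long))) h)
        Outcome : Set
        Outcome = p ≤ 1 × q ≤ 1 ×
          (total excess segs ≤ 1 ⊎ (j ≡ 0 × total excess segs ≤ 3) ⊎ (j ≡ 1 × total excess segs ≤ 2)) ×
          ((∀ {ξ I} → (ξ , I) ∈ segs → Adj x ξ × Adj y ξ) ⊎ (j ≡ 0 × total excess segs ≤ 1))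
        outcome : Outcome
        conclude : Verdict → Outcome
        outcome = conclude nums
        conclude (inj₁ (j≡0 , _ , _ , h)) = p≤1 , q≤1 , inj₁ none , inj₂ (j≡0 , none)
          where
          none : total excess segs ≤ 1
          none = cancel (≤-trans h (≤-trans (≤-reflexive (cong₂ (λ s k → s * (2 + k)) (sym len-segs) (sym j≡0))) (m≤m+n _ 1)))
        conclude (inj₂ (p≡0 , q≡0 , h)) = p≤1 , q≤1 , bnd h , inj₁ full
          where
          c≡ : c ≡ length segs
          c≡ = sym (trans len-segs (trans (cong₂ (λ a b → c + a + b) p≡0 q≡0)
                 (trans (ℕ.+-identityʳ (c + 0)) (ℕ.+-identityʳ c))))
          bnd : EvenBound j c (total inner-length segs) →
                total excess segs ≤ 1 ⊎ (j ≡ 0 × total excess segs ≤ 3) ⊎ (j ≡ 1 × total excess segs ≤ 2)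
          bnd (inj₁ h) = inj₁ (cancel (subst (λ s → total inner-length segs ≤ s * (2 + j) + 1) c≡ h))
          bnd (inj₂ (inj₁ (z , h))) = inj₂ (inj₁ (z , cancel (subst₂ (λ s k → total inner-length segs ≤ s * (2 + k) + 3) c≡ (sym z) h)))
          bnd (inj₂ (inj₂ (z , h))) = inj₂ (inj₂ (z , cancel (subst₂ (λ s k → total inner-length segs ≤ s * (2 + k) + 2) c≡ (sym z) h)))
          full : ∀ {ξ I} → (ξ , I) ∈ segs → Adj x ξ × Adj y ξ
          full {ξ} {I} s∈ with adj? x ξ | adj? y ξ
          ... | yes a | yes b = a , b
          ... | yes a | no b  = ⊥-elim (ℕ.<⇒≱ (≤-trans (onlyX≥1 {I = I} a b) (total-∈ XY.onlyX s∈)) (≤-reflexive p≡0))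
          ... | no a  | yes b = ⊥-elim (ℕ.<⇒≱ (≤-trans (onlyY≥1 {I = I} b a) (total-∈ XY.onlyY s∈)) (≤-reflexive q≡0))
          ... | no a  | no b  = ⊥-elim ([ a , b ]′ (is-letter s∈))

        config : Config x y P
        config = record
          { segs = segs ; ground = ground ; free = free ; linked = linked ; long = long ; many = many
          ; bound = proj₁ (proj₂ (proj₂ outcome)) ; even = proj₂ (proj₂ (proj₂ outcome)) }

      configure : ∀ {C x y P} → Outer C x y P → Σ (Config x y P) λ K → flat (Config.segs K) ↭ C
      configure {C} {x} {y} {P} o with any? (λ z → adj? x z ⊎-dec adj? y z) C
      ... | no none = ⊥-elim (ℕ.<⇒≱ (proj₁ (proj₂ (end-degree (outer-end o) [] (λ ())
                        λ z∈ a → ⊥-elim (none (lose z∈ (inj₁ a)))))) z≤n)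
      ... | yes some with find some
      ...   | v , v∈ , pv with ∈-∃++ v∈
      ...     | as , bs , refl with cut (λ z → adj? x z ⊎-dec adj? y z) (bs ++ as)
      ...       | I , ss , eq , none-I , parts =
        Build.config v I ss ground ((pv , none-I) ∷ parts) , perm
        where
        perm : flat ((v , I) ∷ ss) ↭ as ++ v ∷ bs
        perm = ↭-trans (↭-reflexive (cong (v ∷_) (sym eq))) (Perm.++-comm (v ∷ bs) as)
        ground : Outer (flat ((v , I) ∷ ss)) x y P
        ground = outer (subst Lng (cong (v ∷_) eq) (lng-rot as (v ∷ bs) (Outer.lng o))) (Outer.path o)
          (Unique-↭ (Perm.++⁺ʳ P (↭-sym perm)) (Outer.simple o)) (Outer.size o)

      -- Links between the arcs and P

      module Links {x y P} (K : Config x y P) where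
        open Config K public

        C : List V
        C = flat segs

        uC : Unique C
        uC = Unique-++⁻ˡ C simple

        P∉C : ∀ {v} → v ∈ P → v ∉ C
        P∉C = outer-disjoint ground

        Fresh : List V → Set
        Fresh L = Unique (C ++ P ++ L)

        -- The cycle read from `ξ`, with the second arc starting at `η`. The marks `hd M η` and
        -- `hd N ξ` close the two arcs, so `front` and `back` supply the copy of P for the two
        -- reroutings.
        record View (ξ : V) (I : List V) (η : V) (J : List V) : Set where
          field
            M N   : List V
            lngV  : Lng (ξ ∷ I ++ M ++ η ∷ J ++ N)
            perm  : (ξ ∷ I ++ M ++ η ∷ J ++ N) ↭ C
            front : Bridged x y ξ η
            back  : Bridged x y (hd M η) (hd N ξ)

        view : ∀ {ξ I η J} → (ξ , I) ∈ segs → (η , J) ∈ segs → ξ ≢ η → View ξ I η J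
        view {ξ} {I} {η} {J} s∈ t∈ ξ≢η with ∈-∃++ s∈
        ... | pre , post , e with ∈-∃++ (rest t∈)
          where
          rest : (η , J) ∈ segs → (η , J) ∈ post ++ pre
          rest t∈ with Perm.∈-resp-↭ (Perm.++-comm pre ((ξ , I) ∷ post)) (subst ((η , J) ∈_) e t∈)
          ... | here eq = ⊥-elim (ξ≢η (sym (cong proj₁ eq)))
          ... | there p = p
        ...   | l₂ , l₃ , e′ = record
          { M = flat l₂ ; N = flat l₃ ; lngV = subst Lng shape lngR ; perm = permV
          ; front = linked s∈ t∈ ξ≢η
          ; back = linked (proj₂ (hd-flat l₂ η (λ p → back∈ (there (∈-++⁺ˡ p))) t∈ refl))
                          (proj₂ (hd-flat l₃ ξ (λ p → back∈ (there (∈-++⁺ʳ l₂ (there p)))) s∈ refl)) distinct }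
          where
          shape : flat ((ξ , I) ∷ post ++ pre) ≡ ξ ∷ I ++ flat l₂ ++ η ∷ J ++ flat l₃
          shape = trans (cong (λ ss → flat ((ξ , I) ∷ ss)) e′) (cong (λ l → ξ ∷ I ++ l) (flat-++ l₂ ((η , J) ∷ l₃)))
          lngR : Lng (flat ((ξ , I) ∷ post ++ pre))
          lngR = lng-flat-rot pre ((ξ , I) ∷ post) (subst (Lng ∘ flat) e lng)
          permV : ξ ∷ I ++ flat l₂ ++ η ∷ J ++ flat l₃ ↭ C
          permV = ↭-trans (↭-reflexive (sym shape)) (↭-trans (flat-rot-↭ ((ξ , I) ∷ post) pre) (↭-reflexive (sym (cong flat e))))
          back∈ : ∀ {s} → s ∈ (ξ , I) ∷ l₂ ++ (η , J) ∷ l₃ → s ∈ segs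
          back∈ {s} p = subst (s ∈_) (sym e) (Perm.∈-resp-↭ (Perm.++-comm ((ξ , I) ∷ post) pre)
                          (subst (λ ss → s ∈ (ξ , I) ∷ ss) (sym e′) p))
          distinct : hd (flat l₂) η ≢ hd (flat l₃) ξ
          distinct eq = Unique-disjoint (flat l₂ ++ [ η ])
            (Unique-part ((flat l₂ ++ [ η ]) ++ flat l₃ ++ [ ξ ])
              (solve 6 (λ m e n x i j → ((m ⊕ e) ⊕ n ⊕ x) ⊕ i ⊕ j ⊜ x ⊕ i ⊕ m ⊕ e ⊕ j ⊕ n) ↭-refl
                 (flat l₂) [ η ] (flat l₃) [ ξ ] I J) (Unique-↭ (↭-sym permV) uC))
            (hd-∈ (flat l₂) η) (subst (_∈ flat l₃ ++ [ ξ ]) (sym eq) (hd-∈ (flat l₃) ξ))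

        fresh-walk : ∀ {ξ η D L} → Bridged x y ξ η → D ↭ C → Fresh L →
                     ∃ λ Q → Walk ξ Q η × Q ↭ P × length Q ≡ 2 + j × Unique (D ++ Q ++ L)
        fresh-walk {D = D} {L} lk p u =
          let Q , w , q = outer-walk ground lk in
          Q , w , q , trans (Perm.↭-length q) size , Unique-↭ (↭-sym (Perm.++⁺ p (Perm.++⁺ʳ L q))) u

        cross : ∀ {ξ η a b} X₁ X₂ Y₁ Y₂ L → (ξ , X₁ ++ a ∷ X₂) ∈ segs → (η , Y₁ ++ b ∷ Y₂) ∈ segs → ξ ≢ η →
                Walk a L b → Fresh L →
                (2 + j) + length L ≤ length X₁ + length Y₁ × (2 + j) + length L ≤ length X₂ + length Y₂
        cross X₁ X₂ Y₁ Y₂ L s∈ t∈ ξ≢η w fr = before , after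
          where
          open View (view s∈ t∈ ξ≢η)
          before : (2 + j) + length L ≤ length X₁ + length Y₁
          before = let Q , q , _ , lenQ , u = fresh-walk front perm fr
                       D , cyc , p = cross-before X₁ X₂ M Y₁ Y₂ N Q L lngV q w u
                   in subst₂ _≤_ (trans (length-++ Q) (cong (_+ length L) lenQ)) (length-++ X₁)
                        (exchange-bound _ D (X₁ ++ Y₁) (Q ++ L) lngV cyc p)
          after : (2 + j) + length L ≤ length X₂ + length Y₂
          after = let Q , q , _ , lenQ , u = fresh-walk back perm fr
                      D , cyc , p = cross-after X₁ X₂ M Y₁ Y₂ N Q L lngV q w u
                  in subst₂ _≤_ (trans (length-++ Q) (cong (_+ length L) lenQ)) (length-++ X₂)
                       (exchange-bound _ D (X₂ ++ Y₂) (Q ++ L) lngV cyc p)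

        length-split : ∀ (X₁ : List V) {a X₂} → length (X₁ ++ a ∷ X₂) ≡ suc (length X₁ + length X₂)
        length-split X₁ {a} {X₂} = trans (length-++ X₁) (ℕ.+-suc (length X₁) (length X₂))

        -- Each of the two reroutings takes in all of P and `L`, whereas the parts that they give up
        -- make up both arcs except for the ends of the link.
        link-excess : ∀ {ξ I η J a b L} → (ξ , I) ∈ segs → (η , J) ∈ segs → ξ ≢ η → a ∈ I → b ∈ J →
                      Walk a L b → Fresh L → 2 + 2 * length L ≤ excess (ξ , I) + excess (η , J)
        link-excess {ξ} {I} {η} {J} {L = L} s∈ t∈ ξ≢η a∈ b∈ w fr with ∈-∃++ a∈ | ∈-∃++ b∈
        ... | X₁ , X₂ , refl | Y₁ , Y₂ , refl = ℕ.+-cancelˡ-≤ (2 * (2 + j)) _ _ (begin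
          2 * (2 + j) + (2 + 2 * l)       ≡⟨ arith₁ (2 + j) l ⟩
          2 + ((2 + j + l) + (2 + j + l)) ≤⟨ +-monoʳ-≤ 2 (+-mono-≤ (proj₁ cr) (proj₂ cr)) ⟩
          2 + ((length X₁ + length Y₁) + (length X₂ + length Y₂))
            ≡⟨ arith₂ (length X₁) (length X₂) (length Y₁) (length Y₂) ⟩
          suc (length X₁ + length X₂) + suc (length Y₁ + length Y₂)
            ≡⟨ cong₂ _+_ (length-split X₁) (length-split Y₁) ⟨
          length I + length J             ≡⟨ cong₂ _+_ (ℕ.m+[n∸m]≡n (long s∈)) (ℕ.m+[n∸m]≡n (long t∈)) ⟨
          (2 + j + e₁) + (2 + j + e₂)     ≡⟨ arith₃ (2 + j) e₁ e₂ ⟩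
          2 * (2 + j) + (e₁ + e₂)         ∎)
          where
          open ≤-Reasoning
          l = length L
          e₁ = excess (ξ , I)
          e₂ = excess (η , J)
          cr = cross X₁ X₂ Y₁ Y₂ L s∈ t∈ ξ≢η w fr
          arith₁ : ∀ k l → 2 * k + (2 + 2 * l) ≡ 2 + ((k + l) + (k + l))
          arith₁ = solve-∀
          arith₂ : ∀ a b c d → 2 + ((a + c) + (b + d)) ≡ suc (a + b) + suc (c + d)
          arith₂ = solve-∀
          arith₃ : ∀ k a b → (k + a) + (k + b) ≡ 2 * k + (a + b)
          arith₃ = solve-∀

        record Next (ξ : V) (I : List V) : Set where
          field
            η    : V
            J R  : List V
            lngN : Lng (ξ ∷ I ++ η ∷ R)
            perm : (ξ ∷ I ++ η ∷ R) ↭ C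
            η∈   : (η , J) ∈ segs
            ξ≢η  : ξ ≢ η

        next : ∀ {ξ I} → (ξ , I) ∈ segs → Next ξ I
        next {ξ} {I} s∈ with ∈-∃++ s∈
        ... | pre , post , e = build (rest-nonempty {hdξ segs ξ , []} pre post (subst (2 ≤_) (cong length e) many)
                                       (trans (hdξ-idem segs ξ) (cong (λ ss → hdξ ss (hdξ segs ξ)) e)))
          where
          build : (∃ λ J → ∃ λ r → post ++ pre ≡ (hdξ post (hdξ segs ξ) , J) ∷ r) → Next ξ I
          build (J , r , e′) = record
            { η = η ; J = J ; R = J ++ flat r ; lngN = lngR ; perm = permR
            ; η∈ = subst ((η , J) ∈_) (sym e) (Perm.∈-resp-↭ (Perm.++-comm ((ξ , I) ∷ post) pre)
                     (subst (λ ss → (η , J) ∈ (ξ , I) ∷ ss) (sym e′) (there (here refl))))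
            ; ξ≢η = ξ≢ }
            where
            η = hdξ post (hdξ segs ξ)
            lngR : Lng (flat ((ξ , I) ∷ (η , J) ∷ r))
            lngR = subst (λ ss → Lng (flat ((ξ , I) ∷ ss))) e′ (lng-flat-rot pre ((ξ , I) ∷ post) (subst (Lng ∘ flat) e lng))
            permR : flat ((ξ , I) ∷ (η , J) ∷ r) ↭ C
            permR = ↭-trans (↭-reflexive (cong (λ ss → flat ((ξ , I) ∷ ss)) (sym e′)))
                      (↭-trans (flat-rot-↭ ((ξ , I) ∷ post) pre) (↭-reflexive (sym (cong flat e))))
            ξ≢ : ξ ≢ η
            ξ≢ eq with Unique-↭ (↭-sym permR) uC
            ... | h ∷ _ = All.lookup h (∈-++⁺ʳ I (here refl)) eq

        fresh-[] : Fresh []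
        fresh-[] = subst (λ l → Unique (C ++ l)) (sym (++-identityʳ P)) simple

        fresh-∷ : ∀ {v M} → v ∉ C → v ∉ P → v ∉ M → Fresh M → Fresh (v ∷ M)
        fresh-∷ {v} {M} v∉C v∉P v∉M fr =
          Unique-↭ (solve 4 (λ v c p m → v ⊕ c ⊕ p ⊕ m ⊜ c ⊕ p ⊕ v ⊕ m) ↭-refl [ v ] C P M)
            (Unique-∷ (λ q → [ v∉C , (λ r → [ v∉P , v∉M ]′ (∈-++⁻ P r)) ]′ (∈-++⁻ C q)) fr)

        fresh-part : ∀ M {N R} → M ++ R ↭ N → Fresh N → Fresh M
        fresh-part M {N} {R} p fr = Unique-part (C ++ P ++ M)
          (↭-trans (solve 4 (λ c p m r → (c ⊕ p ⊕ m) ⊕ r ⊜ c ⊕ p ⊕ m ⊕ r) ↭-refl C P M R)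
                   (Perm.++⁺ˡ C (Perm.++⁺ˡ P p))) fr

        not-capped : ∀ {z u l L} → Fresh (l ∷ L) → u ∈ C ⊎ u ∈ z → (∀ {w} → w ∈ z → w ∈ P) → u ≢ l
        not-capped {l = l} {L} fr (inj₁ q) _ refl = Unique-disjoint C fr q (∈-++⁺ʳ P (here refl))
        not-capped {l = l} {L} fr (inj₂ q) s refl = Unique-disjoint P (Unique-++⁻ʳ C fr) (s q) (here refl)

        -- All neighbours of an end of P lie on P or C, and inner vertices of arcs are not among
        -- them.
        not-at-end : ∀ {x′ y′ P′ v L} → Outer C x′ y′ P′ → (∀ {w} → w ∈ P′ → w ∈ P) → ¬ Adj x′ v →
                     Walk x′ L v → Fresh L → ⊥
        not-at-end {L = []}    _ _ ¬a a fr = ¬a a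
        not-at-end {L = l ∷ L} o s _ (a , _) fr = not-capped fr (End.capped (outer-end o) a) s refl

        -- By `not-at-end` the vertex `u` has vertices of P on both sides, so `1 ≤ j` and all marks
        -- are common to both ends. Hence the arc before `v` can be replaced by the first part of P
        -- with `u` and `L`, and the arc after `v` by `L` with `u` and the last part.
        path-link : ∀ {u v ξ L} Y₁ Y₂ → u ∈ P → (ξ , Y₁ ++ v ∷ Y₂) ∈ segs → Walk u L v → Fresh L →
                    1 ≤ j × 2 ≤ length Y₁ × 2 ≤ length Y₂ × 2 + 2 * length L ≤ excess (ξ , Y₁ ++ v ∷ Y₂)
        path-link {u} {v} {ξ} {L} Y₁ Y₂ u∈ s∈ w fr with ∈-∃++ u∈
        ... | [] , P₂ , refl with path-start path
        ...   | refl = ⊥-elim (not-at-end ground (λ z → z) (proj₁ (free s∈ (∈-insert Y₁))) w fr)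
        path-link {u} {v} {ξ} {L} Y₁ Y₂ u∈ s∈ w fr | P₁@(_ ∷ _) , [] , refl with path-finish P₁ path
        ...   | refl = ⊥-elim (not-at-end (outer-rev ground) (Perm.∈-resp-↭ (Perm.↭-reverse P))
                         (proj₂ (free s∈ (∈-insert Y₁))) w fr)
        path-link {u} {v} {ξ} {L} Y₁ Y₂ u∈ s∈ w fr | P₁@(_ ∷ P₁′) , P₂@(_ ∷ P₂′) , refl =
          1≤j , ≤-trans (s≤s (≤-trans (s≤s z≤n) (m≤n+m (suc l) (length P₁′)))) (b₁ Z₁ w₁ perm₁ len₁) ,
                ≤-trans (≤-trans (s≤s (s≤s z≤n)) (m≤n+m (2 + length P₂′) l)) (b₂ Z₃ w₃ perm₃ len₃) , big
          where
          lenP : suc (length P₁ + length P₂) ≡ 2 + j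
          lenP = trans (sym (trans (length-++ P₁) (ℕ.+-suc (length P₁) (length P₂)))) size
          1≤j : 1 ≤ j
          1≤j = ℕ.+-cancelˡ-≤ 2 1 j (≤-trans (s≤s (s≤s (m≤n+m 1 (length P₁′))))
                  (≤-trans (s≤s (s≤s (+-monoʳ-≤ (length P₁′) (s≤s z≤n)))) (≤-reflexive lenP)))
          full : ∀ {ξ I} → (ξ , I) ∈ segs → Adj x ξ × Adj y ξ
          full = case even of λ { (inj₁ f) → f ; (inj₂ (z , _)) → ⊥-elim (ℕ.<⇒≱ 1≤j (≤-reflexive z)) }
          open Next (next s∈)
          through : ∀ {ζ I} → (ζ , I) ∈ segs → Walk ζ P₁ u × Walk u P₂ ζ
          through z∈ = let a , b = full z∈ in walk-split P₁ (path-walk (adj-sym a) path b)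
          l = length L
          Z₁ = P₁ ++ u ∷ L
          Z₃ = reverse L ++ u ∷ P₂
          w₁ : Walk ξ Z₁ v
          w₁ = walk-join P₁ (proj₁ (through s∈)) w
          w₃ : Walk v Z₃ η
          w₃ = walk-join (reverse L) (walk-rev L w) (proj₂ (through η∈))
          perm₁ : Z₁ ++ P₂ ↭ P ++ L
          perm₁ = solve 4 (λ p u l q → (p ⊕ u ⊕ l) ⊕ q ⊜ (p ⊕ u ⊕ q) ⊕ l) ↭-refl P₁ [ u ] L P₂
          perm₃ : Z₃ ++ P₁ ↭ P ++ L
          perm₃ = ↭-trans (Perm.++⁺ʳ P₁ (Perm.++⁺ʳ (u ∷ P₂) (Perm.↭-reverse L)))
            (solve 4 (λ p u l q → (l ⊕ u ⊕ q) ⊕ p ⊜ (p ⊕ u ⊕ q) ⊕ l) ↭-refl P₁ [ u ] L P₂)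
          len₁ : length Z₁ ≡ length P₁ + suc l
          len₁ = length-++ P₁
          len₃ : length Z₃ ≡ l + suc (length P₂)
          len₃ = trans (length-++ (reverse L)) (cong (_+ suc (length P₂)) (length-reverse L))
          unique-with : ∀ {D} Z {R} → D ↭ C → Z ++ R ↭ P ++ L → Unique (D ++ Z)
          unique-with {D} Z {R} d p = Unique-part (D ++ Z) (↭-trans (↭-reflexive (++-assoc D Z R)) (Perm.++⁺ d p)) fr
          b₁ : ∀ Z {R m} → Walk ξ Z v → Z ++ R ↭ P ++ L → length Z ≡ m → m ≤ length Y₁
          b₁ Z wk p refl = chord-bound Y₁ (Y₂ ++ η ∷ R) Z (subst Lng shape lngN) wk
              (unique-with Z (↭-trans (↭-reflexive (sym shape)) perm) p)
            where
            shape : ξ ∷ (Y₁ ++ v ∷ Y₂) ++ η ∷ R ≡ ξ ∷ Y₁ ++ v ∷ Y₂ ++ η ∷ R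
            shape = cong (ξ ∷_) (++-assoc Y₁ (v ∷ Y₂) (η ∷ R))
          b₂ : ∀ Z {R m} → Walk v Z η → Z ++ R ↭ P ++ L → length Z ≡ m → m ≤ length Y₂
          b₂ Z wk p refl = chord-bound Y₂ (R ++ ξ ∷ Y₁) Z (subst Lng shape′ (lng-rot (ξ ∷ Y₁) (v ∷ Y₂ ++ η ∷ R) (subst Lng shape lngN))) wk
              (unique-with Z (↭-trans (↭-reflexive (sym shape′)) (↭-trans (Perm.++-comm (v ∷ Y₂ ++ η ∷ R) (ξ ∷ Y₁))
                 (↭-trans (↭-reflexive (sym shape)) perm))) p)
            where
            shape : ξ ∷ (Y₁ ++ v ∷ Y₂) ++ η ∷ R ≡ ξ ∷ Y₁ ++ v ∷ Y₂ ++ η ∷ R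
            shape = cong (ξ ∷_) (++-assoc Y₁ (v ∷ Y₂) (η ∷ R))
            shape′ : (v ∷ Y₂ ++ η ∷ R) ++ ξ ∷ Y₁ ≡ v ∷ Y₂ ++ η ∷ R ++ ξ ∷ Y₁
            shape′ = cong (v ∷_) (++-assoc Y₂ (η ∷ R) (ξ ∷ Y₁))
          big : 2 + 2 * l ≤ excess (ξ , Y₁ ++ v ∷ Y₂)
          big = ℕ.+-cancelˡ-≤ (2 + j) _ _ (begin
            2 + j + (2 + 2 * l)                          ≡⟨ cong (_+ (2 + 2 * l)) lenP ⟨
            suc (length P₁ + length P₂) + (2 + 2 * l)    ≡⟨ arith (length P₁) (length P₂) l ⟩
            suc ((length P₁ + suc l) + (l + suc (length P₂))) ≤⟨ s≤s (+-mono-≤ (b₁ Z₁ w₁ perm₁ len₁) (b₂ Z₃ w₃ perm₃ len₃)) ⟩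
            suc (length Y₁ + length Y₂)                  ≡⟨ length-split Y₁ ⟨
            length (Y₁ ++ v ∷ Y₂)                        ≡⟨ ℕ.m+[n∸m]≡n (long s∈) ⟨
            2 + j + excess (ξ , Y₁ ++ v ∷ Y₂)            ∎)
            where
            open ≤-Reasoning
            arith : ∀ p q l → suc (p + q) + (2 + 2 * l) ≡ suc ((p + suc l) + (l + suc q))
            arith = solve-∀

        -- Labels of components and cuts that violate toughness

        inC⊎P : V → Set
        inC⊎P v = v ∈ C ⊎ v ∈ P

        -- A label stands for a union of components off `S`. Only vertices of C and P are labelled,
        -- so that invariance has to be checked just along walks with fresh inner vertices.
        Respects : List V → (V → V → Set) → Set
        Respects S Lab = ∀ {u v L w} → Lab u w → u ∉ S → inC⊎P v → v ∉ S → Walk u L v → Fresh L → Lab v w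

        module _ {S : List V} {Lab : V → V → Set} (respects : Respects S Lab) where

          -- Off C ∪ P a label is carried along by a path from the last labelled vertex.
          Carried : V → V → Set
          Carried w v = (Lab v w × v ∉ S × inC⊎P v) ⊎
                        (v ∉ C × v ∉ P × ∃₂ λ u L → Lab u w × u ∉ S × Walk u L v × Fresh (v ∷ L))

          carry : ∀ {w v v′} → Carried w v → v′ ∉ S → Adj v v′ → Carried w v′
          carry {w} {v} {v′} st v′∉S a with v′ ∈? C ⊎-dec v′ ∈? P
          carry (inj₁ (lab , v∉S , _)) v′∉S a | yes i = inj₁ (respects {L = []} lab v∉S i v′∉S a fresh-[] , v′∉S , i)
          carry {v = v} (inj₂ (_ , _ , u , L , lab , u∉S , w , fr)) v′∉S a | yes i =
            inj₁ (respects {L = L ++ [ v ]} lab u∉S i v′∉S (walk-join L w a)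
                    (fresh-part (L ++ [ v ]) {R = []} (↭-trans (↭-reflexive (++-identityʳ _)) (Perm.++-comm L [ v ])) fr) , v′∉S , i)
          carry {v = v} (inj₁ (lab , v∉S , _)) v′∉S a | no o =
            inj₂ (o ∘ inj₁ , o ∘ inj₂ , v , [] , lab , v∉S , a , fresh-∷ (o ∘ inj₁) (o ∘ inj₂) (λ ()) fresh-[])
          carry {v = v} {v′} (inj₂ (v∉C , v∉P , u , L , lab , u∉S , w , fr)) v′∉S a | no o with v′ ∈? L
          ... | yes p with ∈-∃++ p
          ...   | L₁ , L₂ , refl = inj₂ (o ∘ inj₁ , o ∘ inj₂ , u , L₁ , lab , u∉S , proj₁ (walk-split L₁ w) ,
                    fresh-part (v′ ∷ L₁) {R = v ∷ L₂} (solve 4 (λ a b c d → (a ⊕ b) ⊕ c ⊕ d ⊜ c ⊕ b ⊕ a ⊕ d) ↭-refl [ v′ ] L₁ [ v ] L₂) fr)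
          carry {v = v} {v′} (inj₂ (v∉C , v∉P , u , L , lab , u∉S , w , fr)) v′∉S a | no o | no v′∉L =
            inj₂ (o ∘ inj₁ , o ∘ inj₂ , u , L ++ [ v ] , lab , u∉S , walk-join L w a ,
              fresh-∷ (o ∘ inj₁) (o ∘ inj₂)
                (λ q → [ v′∉L , (λ { (here refl) → irrefl refl a }) ]′ (∈-++⁻ L q))
                (fresh-part (L ++ [ v ]) {R = []} (↭-trans (↭-reflexive (++-identityʳ _)) (Perm.++-comm L [ v ])) fr))

          carried : ∀ {w u v} → Carried w u → Conn S u v → Carried w v
          carried st ε                       = st
          carried st ((_ , v∉S , a) ◅ c) = carried (carry st v∉S a) c

          label-conn : ∀ {w u v} → Lab u w → u ∉ S → inC⊎P u → inC⊎P v → Conn S u v → Lab v w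
          label-conn lab u∉S iu iv c with carried (inj₁ (lab , u∉S , iu)) c
          ... | inj₁ (l , _)       = l
          ... | inj₂ (v∉C , v∉P , _) = ⊥-elim ([ v∉C , v∉P ]′ iv)

          -- A representative that lacks the label of another one lies in a different component, so
          -- as many representatives as cut vertices are impossible.
          too-many : ∀ reps → All (λ r → proj₁ r ∉ S × inC⊎P (proj₁ r) × Lab (proj₁ r) (proj₂ r)) reps →
                     AllPairs (λ r r′ → ¬ Lab (proj₁ r′) (proj₂ r)) reps → 2 ≤ length reps → length S ≤ length reps → ⊥
          too-many reps ok apart 2≤ S≤ = ℕ.<⇒≱ (tough S (map proj₁ reps) (All.map⁺ (All.map proj₁ ok))
              (AllPairs.map⁺ (conns reps ok apart)) (subst (2 ≤_) (sym (length-map proj₁ reps)) 2≤))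
              (subst (length S ≤_) (sym (length-map proj₁ reps)) S≤)
            where
            conns : ∀ reps → All (λ r → proj₁ r ∉ S × inC⊎P (proj₁ r) × Lab (proj₁ r) (proj₂ r)) reps →
                    AllPairs (λ r r′ → ¬ Lab (proj₁ r′) (proj₂ r)) reps → AllPairs (λ r r′ → ¬ Conn S (proj₁ r) (proj₁ r′)) reps
            conns [] _ _ = []
            conns (r ∷ rs) (ok ∷ oks) (ap ∷ aps) =
              All.tabulate (λ {r′} r′∈ c → All.lookup ap r′∈
                (label-conn (proj₂ (proj₂ ok)) (proj₁ ok) (proj₁ (proj₂ ok)) (proj₁ (proj₂ (All.lookup oks r′∈))) c))
              ∷ conns rs oks aps

        ξs : List V
        ξs = map proj₁ segs

        ∈-ξs : ∀ {ξ I} → (ξ , I) ∈ segs → ξ ∈ ξs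
        ∈-ξs = ∈-map⁺ proj₁

        locate : ∀ {S v} → (∀ {w} → w ∈ ξs → w ∈ S) → v ∈ C → v ∉ S → ∃₂ λ ξ I → (ξ , I) ∈ segs × v ∈ I
        locate sub v∈ v∉ with ∈-flat⁻ segs v∈
        ... | (ξ , I) , s∈ , inj₁ refl = ⊥-elim (v∉ (sub (∈-ξs s∈)))
        ... | (ξ , I) , s∈ , inj₂ v∈I  = ξ , I , s∈ , v∈I

        I∉ξs : ∀ {ξ I v} → (ξ , I) ∈ segs → v ∈ I → v ∉ ξs
        I∉ξs s∈ v∈ q with ∈-map⁻ proj₁ q
        ... | t , t∈ , refl = ξ∉I uC s∈ t∈ v∈

        I-unique : ∀ {ξ I} → (ξ , I) ∈ segs → Unique I
        I-unique {ξ} {I} s∈ = Unique-++⁻ˡ I (go segs uC s∈)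
          where
          go : ∀ ss → Unique (flat ss) → (ξ , I) ∈ ss → Unique (I ++ [])
          go ((_ , J) ∷ ss) (_ ∷ u) (here refl) = subst Unique (sym (++-identityʳ I)) (Unique-++⁻ˡ I u)
          go ((_ , J) ∷ ss) (_ ∷ u) (there p)   = go ss (Unique-++⁻ʳ J u) p

        x∈P : x ∈ P
        x∈P = path-head path

        -- P takes its end `x` as label. An arc takes the image of its mark, so that a suitable `f`
        -- lets two linked arcs count as one component.
        SegLab : (V → V) → V → V → Set
        SegLab f v w = (v ∈ P × w ≡ x) ⊎ ∃₂ λ ξ I → (ξ , I) ∈ segs × v ∈ I × w ≡ f ξ

        PathFree : List V → Set
        PathFree S = ∀ {u v ξ I L} → u ∈ P → (ξ , I) ∈ segs → v ∈ I → v ∉ S → Walk u L v → Fresh L → ⊥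

        walk-back : ∀ {u v} L → Walk u L v → Fresh L → Walk v (reverse L) u × Fresh (reverse L)
        walk-back L w fr = walk-rev L w , fresh-part (reverse L) {R = []}
          (↭-trans (↭-reflexive (++-identityʳ _)) (Perm.↭-reverse L)) fr

        seg-respects : ∀ f S → (∀ {w} → w ∈ ξs → w ∈ S) → PathFree S →
          (∀ {ξ I η J u v L} → (ξ , I) ∈ segs → (η , J) ∈ segs → ξ ≢ η → u ∈ I → v ∈ J → u ∉ S → v ∉ S →
             Walk u L v → Fresh L → f ξ ≡ f η) → Respects S (SegLab f)
        seg-respects f S sub pf hs (inj₁ (u∈P , e)) u∉S (inj₂ v∈P) v∉S w fr = inj₁ (v∈P , e)
        seg-respects f S sub pf hs (inj₁ (u∈P , e)) u∉S (inj₁ v∈C) v∉S w fr =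
          let ξ , I , s∈ , v∈I = locate sub v∈C v∉S in ⊥-elim (pf u∈P s∈ v∈I v∉S w fr)
        seg-respects f S sub pf hs {L = L} (inj₂ (ξ , I , s∈ , u∈I , e)) u∉S (inj₂ v∈P) v∉S w fr =
          let w′ , fr′ = walk-back L w fr in ⊥-elim (pf v∈P s∈ u∈I u∉S w′ fr′)
        seg-respects f S sub pf hs (inj₂ (ξ , I , s∈ , u∈I , e)) u∉S (inj₁ v∈C) v∉S w fr
          with locate sub v∈C v∉S
        ... | η , J , t∈ , v∈J with ξ ≟ η
        ...   | yes refl = inj₂ (η , J , t∈ , v∈J , e)
        ...   | no ξ≢η   = inj₂ (η , J , t∈ , v∈J , trans e (hs s∈ t∈ ξ≢η u∈I v∈J u∉S v∉S w fr))

        pick : List V → Seg → V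
        -- The default `x` is never reached when `B` has at most one vertex, because every arc has
        -- at least two inner vertices.
        pick B (_ , I) = hd (filter (λ v → ¬? (v ∈? B)) I) x

        pick-spec : ∀ B {ξ I} → (ξ , I) ∈ segs → length B < 2 → pick B (ξ , I) ∈ I × pick B (ξ , I) ∉ B
        pick-spec B {ξ} {I} s∈ l =
          let v , v∈ , v∉ = pick-outside B (I-unique s∈) (ℕ.<-≤-trans l (≤-trans (s≤s (s≤s z≤n)) (long s∈)))
          in ∈-filter⁻ (λ v → ¬? (v ∈? B)) (hd-of (∈-filter⁺ (λ v → ¬? (v ∈? B)) v∈ v∉))
          where
          hd-of : ∀ {l v z} → v ∈ l → hd l z ∈ l
          hd-of {_ ∷ _} _ = here refl

        -- The cut consists of `B` and all marks; the representatives are `x` for P and one vertex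
        -- for every arc in `ss`.
        separate : ∀ f B ss → length B < 2 → (∀ {s} → s ∈ ss → s ∈ segs) →
          AllPairs (λ s t → f (proj₁ s) ≢ f (proj₁ t)) ss →
          (∀ {ξ I} → (ξ , I) ∈ segs → f ξ ∈ C) →
          Respects (B ++ ξs) (SegLab f) → 1 ≤ length ss → length B + length segs ≤ suc (length ss) →
          x ∉ B → ⊥
        separate f B ss l sub apart f∈C resp 1≤ S≤ x∉B = too-many resp
            ((x , x) ∷ map (λ s → pick B s , f (proj₁ s)) ss)
            ((x∉S , inj₂ x∈P , inj₁ (x∈P , refl)) ∷ All.map⁺ (All.tabulate λ s∈ → rep s∈))
            (All.map⁺ (All.tabulate λ s∈ → not-x s∈) ∷ AllPairs.map⁺ (pairs ss sub apart))
            (s≤s (subst (1 ≤_) (sym (length-map _ ss)) 1≤))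
            (≤-trans (≤-reflexive (trans (length-++ B) (cong (length B +_) (length-map proj₁ segs))))
                     (≤-trans S≤ (≤-reflexive (cong suc (sym (length-map _ ss))))))
          where
          ξs⊆C : ∀ {w} → w ∈ ξs → w ∈ C
          ξs⊆C q with ∈-map⁻ proj₁ q
          ... | t , t∈ , refl = ∈-flat-ξ t∈
          x∉S : x ∉ B ++ ξs
          x∉S q = [ x∉B , (λ r → P∉C x∈P (ξs⊆C r)) ]′ (∈-++⁻ B q)
          pick∈C : ∀ {s} → s ∈ ss → pick B s ∈ C
          pick∈C s∈ = ∈-flat-I (sub s∈) (proj₁ (pick-spec B (sub s∈) l))
          rep : ∀ {s} → s ∈ ss → pick B s ∉ B ++ ξs × inC⊎P (pick B s) × SegLab f (pick B s) (f (proj₁ s))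
          rep s∈ = let a , b = pick-spec B (sub s∈) l in
            (λ q → [ b , I∉ξs (sub s∈) a ]′ (∈-++⁻ B q)) , inj₁ (pick∈C s∈) , inj₂ (_ , _ , sub s∈ , a , refl)
          not-x : ∀ {s} → s ∈ ss → ¬ SegLab f (pick B s) x
          not-x s∈ (inj₁ (p , _))              = P∉C p (pick∈C s∈)
          not-x s∈ (inj₂ (ξ , I , t∈ , _ , e)) = P∉C x∈P (subst (_∈ C) (sym e) (f∈C t∈))
          pairs : ∀ ts → (∀ {s} → s ∈ ts → s ∈ segs) → AllPairs (λ s t → f (proj₁ s) ≢ f (proj₁ t)) ts →
                  AllPairs (λ s t → ¬ SegLab f (pick B t) (f (proj₁ s))) ts
          pairs []       _ []         = []
          pairs (s ∷ ts) h (ap ∷ aps) = All.tabulate no-label ∷ pairs ts (h ∘ there) aps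
            where
            no-label : ∀ {t} → t ∈ ts → ¬ SegLab f (pick B t) (f (proj₁ s))
            no-label t∈ (inj₁ (p , _)) = P∉C p (∈-flat-I (h (there t∈)) (proj₁ (pick-spec B (h (there t∈)) l)))
            no-label t∈ (inj₂ (ξ , I , u∈ , v∈ , e)) = All.lookup ap t∈ (trans e (cong f
              (seg-unique uC u∈ (h (there t∈)) v∈ (proj₁ (pick-spec B (h (there t∈)) l)))))

        -- Removing `b` destroys all links at the price of one cut vertex: P and the s arcs stand
        -- against s + 1 cut vertices.
        star : ∀ {β J} b → (β , J) ∈ segs → b ∈ J → PathFree (b ∷ ξs) →
               (∀ {ξ I η J u v L} → (ξ , I) ∈ segs → (η , J) ∈ segs → ξ ≢ η → u ∈ I → v ∈ J → u ≢ b → v ≢ b →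
                  Walk u L v → Fresh L → ⊥) → ⊥
        star b s∈ b∈ pf hs = separate (λ v → v) [ b ] segs (s≤s (s≤s z≤n)) (λ p → p)
          (AllPairs.map⁻ (ξs-unique segs uC)) ∈-flat-ξ
          (seg-respects (λ v → v) (b ∷ ξs) there pf
            λ s∈ t∈ ne u∈ v∈ u∉ v∉ w fr → ⊥-elim (hs s∈ t∈ ne u∈ v∈ (u∉ ∘ here) (v∉ ∘ here) w fr))
          (≤-trans (s≤s z≤n) many) ℕ.≤-refl λ { (here refl) → P∉C x∈P (∈-flat-I s∈ b∈) }

        -- If only two arcs can be linked to each other, s - 1 labels remain on the arcs, and P
        -- makes s, as many as there are marks. With `α` equal to `β` this is the case without
        -- links.
        merge : ∀ {α I β J} → (α , I) ∈ segs → (β , J) ∈ segs → PathFree ξs →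
                (∀ {ξ I η J u v L} → (ξ , I) ∈ segs → (η , J) ∈ segs → ξ ≢ η → u ∈ I → v ∈ J →
                   Walk u L v → Fresh L → (ξ ≡ α × η ≡ β) ⊎ (ξ ≡ β × η ≡ α)) → ⊥
        merge {α} {_} {β} {J} α∈ β∈ pf hs with ∈-∃++ β∈
        ... | pre , post , e = separate f [] (pre ++ post) (s≤s z≤n) sub (apart (pre ++ post) β-unique) f∈C
            (seg-respects f ξs (λ p → p) pf λ s∈ t∈ ne u∈ v∈ _ _ w fr → glued ne (hs s∈ t∈ ne u∈ v∈ w fr))
            (s≤s⁻¹ (subst (2 ≤_) len many)) (≤-reflexive len) λ ()
          where
          f : V → V
          f v with v ≟ β
          ... | yes _ = α
          ... | no _  = v
          f-β : f β ≡ α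
          f-β with β ≟ β
          ... | yes _ = refl
          ... | no ne = ⊥-elim (ne refl)
          f-other : ∀ {v} → v ≢ β → f v ≡ v
          f-other {v} ne with v ≟ β
          ... | yes e = ⊥-elim (ne e)
          ... | no _  = refl
          len : length segs ≡ suc (length (pre ++ post))
          len = trans (cong length e) (Perm.↭-length (Perm.shift (β , J) pre post))
          moved : ∀ {s} → s ∈ (β , J) ∷ pre ++ post → s ∈ segs
          moved {s} p = subst (s ∈_) (sym e) (Perm.∈-resp-↭ (↭-sym (Perm.shift (β , J) pre post)) p)
          sub : ∀ {s} → s ∈ pre ++ post → s ∈ segs
          sub p = moved (there p)
          β-unique : Unique (β ∷ map proj₁ (pre ++ post))
          β-unique = Unique-↭ (Perm.map⁺ proj₁ (↭-trans (↭-reflexive e) (Perm.shift (β , J) pre post))) (ξs-unique segs uC)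
          apart : ∀ ss → Unique (β ∷ map proj₁ ss) → AllPairs (λ s t → f (proj₁ s) ≢ f (proj₁ t)) ss
          apart []       _ = []
          apart (s ∷ ss) ((s≢ ∷ h) ∷ (k ∷ u)) =
            All.tabulate (λ {t} t∈ eq → All.lookup k (∈-map⁺ proj₁ t∈)
              (trans (sym (f-other (s≢ ∘ sym))) (trans eq (f-other (All.lookup h (∈-map⁺ proj₁ t∈) ∘ sym)))))
            ∷ apart ss (h ∷ u)
          f∈C : ∀ {ξ I} → (ξ , I) ∈ segs → f ξ ∈ C
          f∈C {ξ} s∈ with ξ ≟ β
          ... | yes _ = ∈-flat-ξ α∈
          ... | no _  = ∈-flat-ξ s∈
          glued : ∀ {ξ η} → ξ ≢ η → (ξ ≡ α × η ≡ β) ⊎ (ξ ≡ β × η ≡ α) → f ξ ≡ f η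
          glued ne (inj₁ (refl , refl)) = trans (f-other ne) (sym f-β)
          glued ne (inj₂ (refl , refl)) = trans f-β (sym (f-other (ne ∘ sym)))

      -- Small excess, and ends with equal neighbourhoods

      module Thin {x y P} (K : Config x y P) where
        open Links K

        a-seg : ∃ λ s → s ∈ segs
        a-seg = first segs many
          where
          first : ∀ ss → 2 ≤ length ss → ∃ λ s → s ∈ ss
          first (s ∷ _) _ = s , here refl

        -- Every link, between arcs or from P, needs an excess of two.
        thin : total excess segs ≤ 1 → ⊥
        thin t≤1 = merge (proj₂ a-seg) (proj₂ a-seg) no-path no-link
          where
          no-path : PathFree ξs
          no-path u∈ s∈ v∈ _ w fr with ∈-∃++ v∈
          ... | Y₁ , Y₂ , refl = ℕ.<⇒≱ (≤-trans (m≤m+n 2 _) (proj₂ (proj₂ (proj₂ (path-link Y₁ Y₂ u∈ s∈ w fr)))))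
                                   (≤-trans (total-∈ excess s∈) t≤1)
          no-link : ∀ {ξ I η J u v L} → (ξ , I) ∈ segs → (η , J) ∈ segs → ξ ≢ η → u ∈ I → v ∈ J →
                    Walk u L v → Fresh L → _
          no-link s∈ t∈ ne u∈ v∈ w fr = ⊥-elim (ℕ.<⇒≱ (≤-trans (m≤m+n 2 _) (link-excess s∈ t∈ ne u∈ v∈ w fr))
                                            (≤-trans (total-two excess s∈ t∈ (ne ∘ cong proj₁)) t≤1))

      -- Private neighbours would come with an excess excluded by `thin`. The statement covers every
      -- extremal pair of cycle and path, and so also those produced by an exchange.
      twins : ∀ {C x y P z} → Outer C x y P → z ∈ C → Adj x z → Adj y z
      twins o z∈ a with configure o
      ... | K , perm = decide (Config.even K)
        where
        open Config K using (segs; free)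
        decide : _ → _
        decide (inj₂ (_ , t≤1)) = ⊥-elim (Thin.thin K t≤1)
        decide (inj₁ full) with ∈-flat⁻ segs (Perm.∈-resp-↭ (↭-sym perm) z∈)
        ... | s , s∈ , inj₁ refl = proj₂ (full s∈)
        ... | s , s∈ , inj₂ z∈I  = ⊥-elim (proj₁ (free s∈ z∈I) a)

      module Ending {x y P} (K : Config x y P) (t≤3 : total excess (Config.segs K) ≤ 3) where
        open Links K public
        open Thin K using (a-seg)

        -- After the exchange `X` lies outside the longest cycle `D` and has as many vertices as P,
        -- so it is extremal too.
        twin-swap : ∀ {D C′ X Q a b v} → Lng D → D ++ X ↭ C′ ++ Q → C′ ↭ C → Q ↭ P → Path Adj a b X → length X ≡ 2 + j →
                    v ∈ C → v ∉ X → (Adj a v → Adj b v) × (Adj b v → Adj a v)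
        twin-swap {D} {C′} {X} {Q} {a} {b} {v} l p c q path size v∈C v∉X = twins o v∈D , twins (outer-rev o) v∈D
          where
          o : Outer D a b X
          o = outer l path (Unique-↭ (↭-sym (↭-trans p (Perm.++⁺ c q))) simple) size
          v∈D : v ∈ D
          v∈D with ∈-++⁻ D (Perm.∈-resp-↭ (↭-sym p) (∈-++⁺ˡ (Perm.∈-resp-↭ (↭-sym c) v∈C)))
          ... | inj₁ r = r
          ... | inj₂ r = ⊥-elim (v∉X r)

        -- A single inner vertex of `L` would already raise the excess needed to four.
        direct : ∀ {ξ I η J u v L} → (ξ , I) ∈ segs → (η , J) ∈ segs → ξ ≢ η → u ∈ I → v ∈ J →
                 Walk u L v → Fresh L → Adj u v × 2 ≤ excess (ξ , I) + excess (η , J)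
        direct {L = []} s∈ t∈ ne u∈ v∈ w fr = w , link-excess s∈ t∈ ne u∈ v∈ w fr
        direct {L = l ∷ L} s∈ t∈ ne u∈ v∈ w fr = ⊥-elim (ℕ.<⇒≱ {3} (≤-trans four (link-excess s∈ t∈ ne u∈ v∈ w fr))
          (≤-trans (total-two excess s∈ t∈ (ne ∘ cong proj₁)) t≤3))
          where
          four : 4 ≤ 2 + 2 * suc (length L)
          four = +-monoʳ-≤ 2 (ℕ.*-monoʳ-≤ 2 (s≤s z≤n))

        cross₂ : ∀ {ξ η a b} X₁ X₂ Y₁ Y₂ → (ξ , X₁ ++ a ∷ X₂) ∈ segs → (η , Y₁ ++ b ∷ Y₂) ∈ segs → ξ ≢ η → Adj a b →
                 2 + j ≤ length X₁ + length Y₁ × 2 + j ≤ length X₂ + length Y₂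
        cross₂ X₁ X₂ Y₁ Y₂ s∈ t∈ ne a = let p , q = cross X₁ X₂ Y₁ Y₂ [] s∈ t∈ ne a fresh-[] in
          ≤-trans (m≤m+n (2 + j) 0) p , ≤-trans (m≤m+n (2 + j) 0) q

        module _ {ξ I} (s∈ : (ξ , I) ∈ segs) (zero-I : length I ≡ 2 + j) where
          open Next (next s∈)

          ends-twin : ∀ {a b v} → Path Adj a b I → v ∈ C → v ∉ I → (Adj a v → Adj b v) × (Adj b v → Adj a v)
          ends-twin p v∈ v∉ =
            let Q , w , q , lenQ , u = fresh-walk (linked s∈ η∈ ξ≢η) perm fresh-[]
                u′ = subst (λ l → Unique ((ξ ∷ I ++ η ∷ R) ++ l)) (++-identityʳ Q) u
                D , pD = chord I R Q lngN w u′
            in twin-swap (exchange-lng (ξ ∷ I ++ η ∷ R) (ξ ∷ Q ++ η ∷ R) I Q lngN D pD (trans zero-I (sym lenQ)))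
                 pD perm q p zero-I v∈ v∉

          inner-path : ∃₂ λ a b → Path Adj a b I × ∃₂ λ l₁ l₂ → I ≡ a ∷ l₁ × I ≡ l₂ ++ [ b ]
          inner-path = walk-inner I (proj₁ (walk-split I (proj₁ (proj₁ lngN)))) (≤-trans (s≤s z≤n) (≤-reflexive (sym zero-I)))

          -- A link at one end of `I` can be moved to the other end by `ends-twin`; crossing at
          -- either end leaves nothing of `I` on one side, so the other arc must provide all `2 + j`
          -- vertices there. A link from the middle of `I` leaves at most `j` vertices of `I` on
          -- each side.
          zero-link : ∀ {ζ v u} Y₁ Y₂ → (ζ , Y₁ ++ v ∷ Y₂) ∈ segs → ξ ≢ ζ → u ∈ I → Adj u v →
                      2 ≤ length Y₁ × 2 ≤ length Y₂
          zero-link {ζ} {v} {u} Y₁ Y₂ t∈ ne u∈ u~v with ∈-∃++ u∈ | inner-path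
          ... | [] , X₂ , refl | a , b , p , _ , l₂ , refl , e =
            ≤-trans (m≤m+n 2 j) (proj₁ (cross₂ [] X₂ Y₁ Y₂ s∈ t∈ ne u~v)) ,
            ≤-trans (m≤m+n 2 j) (proj₂ (cross₂ l₂ [] Y₁ Y₂ (subst (λ I → (ξ , I) ∈ segs) e s∈) t∈ ne
              (proj₁ (ends-twin p (∈-flat-I t∈ (∈-insert Y₁)) v∉I) u~v)))
            where
            v∉I : v ∉ u ∷ X₂
            v∉I q = ne (seg-unique uC s∈ t∈ q (∈-insert Y₁))
          ... | X₁@(_ ∷ _) , [] , refl | a , b , p , l₁ , l₂ , e₁ , e with path-finish X₁ p
          ...   | refl =
            ≤-trans (m≤m+n 2 j) (proj₁ (cross₂ [] l₁ Y₁ Y₂ (subst (λ I → (ξ , I) ∈ segs) e₁ s∈) t∈ ne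
              (proj₂ (ends-twin p (∈-flat-I t∈ (∈-insert Y₁)) v∉I) u~v))) ,
            ≤-trans (m≤m+n 2 j) (proj₂ (cross₂ X₁ [] Y₁ Y₂ s∈ t∈ ne u~v))
            where
            v∉I : v ∉ X₁ ++ [ u ]
            v∉I q = ne (seg-unique uC s∈ t∈ q (∈-insert Y₁))
          zero-link {ζ} {v} {u} Y₁ Y₂ t∈ ne u∈ u~v | X₁@(_ ∷ X₁′) , X₂@(_ ∷ X₂′) , refl | _ =
            middle X₂ X₁ (s≤s z≤n) lenI (proj₁ cr) , middle X₁ X₂ (s≤s z≤n) lenI′ (proj₂ cr)
            where
            cr = cross₂ X₁ X₂ Y₁ Y₂ s∈ t∈ ne u~v
            lenI : suc (length X₂ + length X₁) ≡ 2 + j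
            lenI = trans (cong suc (ℕ.+-comm (length X₂) (length X₁))) (trans (sym (length-split X₁)) zero-I)
            lenI′ : suc (length X₁ + length X₂) ≡ 2 + j
            lenI′ = trans (sym (length-split X₁)) zero-I
            -- The other part of I is nonempty, so this part has at most j vertices.
            middle : ∀ (A B : List V) {y} → 1 ≤ length A → suc (length A + length B) ≡ 2 + j → 2 + j ≤ length B + y → 2 ≤ y
            middle A B {y} 1≤A e l = ℕ.+-cancelˡ-≤ (length B) 2 y (≤-trans
              (≤-trans (≤-reflexive (ℕ.+-comm (length B) 2)) (s≤s (≤-trans (ℕ.+-monoˡ-≤ (length B) 1≤A) (≤-reflexive (ℕ.suc-injective e))))) l)

      -- Three arcs of excess one

      module TrioOf {x y P} (K : Config x y P) (t≤3 : total excess (Config.segs K) ≤ 3) (j≡0 : j ≡ 0) where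
        open Ending K t≤3 public

        two≡ : 2 ≡ 2 + j
        two≡ = cong (2 +_) (sym j≡0)

        -- The parts before and behind the link need two vertices each, and off the link the two
        -- arcs have just four, so both bounds are equalities. Only first to third, second to second
        -- and third to first vertices can be joined.
        pos-sum : ∀ {ξ I η J u v} → (ξ , I) ∈ segs → (η , J) ∈ segs → ξ ≢ η → length I ≡ 3 → length J ≡ 3 →
                  (p : u ∈ I) (q : v ∈ J) → Adj u v → pos p + pos q ≡ 2
        pos-sum s∈ t∈ ne lI lJ p q a with split-at p | split-at q
        ... | X₁ , X₂ , refl , e | Y₁ , Y₂ , refl , f =
          trans (sym (cong₂ _+_ e f)) (sum-two (length X₁) (length X₂) (length Y₁) (length Y₂) (ℕ.suc-injective (trans (sym (length-split X₁)) lI))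
            (ℕ.suc-injective (trans (sym (length-split Y₁)) lJ))
            (≤-trans (m≤m+n 2 j) (proj₁ cr)) (≤-trans (m≤m+n 2 j) (proj₂ cr)))
          where
          cr = cross₂ X₁ X₂ Y₁ Y₂ s∈ t∈ ne a

        record Triple : Set where
          field
            ξ v₁ v₂ v₃ : V
          inside : List V
          inside = v₁ ∷ v₂ ∷ v₃ ∷ []
          field
            seg∈ : (ξ , inside) ∈ segs
        open Triple

        link-pos : ∀ s t → ξ s ≢ ξ t → ∀ {u v} (p : u ∈ inside s) (q : v ∈ inside t) → Adj u v → pos p + pos q ≡ 2
        link-pos s t ne = pos-sum (seg∈ s) (seg∈ t) ne refl refl

        elsewhere : ∀ s t {v} → ξ s ≢ ξ t → v ∈ inside s → v ∉ inside t
        elsewhere s t ne p q = ne (seg-unique uC (seg∈ s) (seg∈ t) p q)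

        steps : ∀ t → Adj (v₁ t) (v₂ t) × Adj (v₂ t) (v₃ t)
        steps t = let _ , a , b , _ = proj₁ (proj₁ (Next.lngN (next (seg∈ t)))) in a , b

        clash : ∀ {a b} → 0 + a ≡ b → 1 + a ≡ b → ⊥
        clash refl ()

        -- After rerouting through the link v₁ v₃ the two skipped vertices form an
        -- outside path, and twins of adjacent positions cannot both be linked.
        corner : ∀ s t → ξ s ≢ ξ t → Adj (v₁ s) (v₃ t) →
                 (∀ r {v} → ξ r ≢ ξ t → v ∈ inside r → ¬ Adj (v₁ t) v × ¬ Adj (v₂ t) v) ×
                 (∀ r {v} → ξ r ≢ ξ s → v ∈ inside r → ¬ Adj (v₂ s) v × ¬ Adj (v₃ s) v)
        corner s t ne a = left , right
          where
          open View (view (seg∈ s) (seg∈ t) ne)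
          CV = ξ s ∷ inside s ++ M ++ ξ t ∷ inside t ++ N
          detour : ∀ {D X Q} → IsCyc D → D ++ X ↭ CV ++ Q ++ [] → Q ↭ P → length Q ≡ 2 + j → length X ≡ 2 →
                   ∀ {a b v} → Path Adj a b X → v ∈ C → v ∉ X → (Adj a v → Adj b v) × (Adj b v → Adj a v)
          detour {D} {X} {Q} cyc p q lenQ lenX path v∈ v∉ =
            twin-swap (exchange-lng CV D X Q lngV cyc p′ (trans lenX (trans two≡ (sym lenQ)))) p′ perm q path
              (trans lenX two≡) v∈ v∉
            where
            p′ : D ++ X ↭ CV ++ Q
            p′ = ↭-trans p (↭-reflexive (cong (CV ++_) (++-identityʳ Q)))
          left : ∀ r {v} → ξ r ≢ ξ t → v ∈ inside r → ¬ Adj (v₁ t) v × ¬ Adj (v₂ t) v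
          left r {v} r≢t v∈ = reroute-front (fresh-walk front perm fresh-[])
            where
            at : ∀ {u} (p : u ∈ inside t) → Adj u v → pos p + pos v∈ ≡ 2
            at p = link-pos t r (r≢t ∘ sym) p v∈
            v∉ : v ∉ v₁ t ∷ v₂ t ∷ []
            v∉ (here e)         = elsewhere r t r≢t v∈ (here e)
            v∉ (there (here e)) = elsewhere r t r≢t v∈ (there (here e))
            conclude : (Adj (v₁ t) v → Adj (v₂ t) v) × (Adj (v₂ t) v → Adj (v₁ t) v) → ¬ Adj (v₁ t) v × ¬ Adj (v₂ t) v
            conclude (f , g) = (λ b → clash (at (here refl) b) (at (there (here refl)) (f b)))
                             , (λ b → clash (at (here refl) (g b)) (at (there (here refl)) b))
            reroute-front : (∃ λ Q → Walk (ξ s) Q (ξ t) × Q ↭ P × length Q ≡ 2 + j × Unique (CV ++ Q ++ [])) →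
                            ¬ Adj (v₁ t) v × ¬ Adj (v₂ t) v
            reroute-front (Q , w , q , lenQ , u) =
              conclude (apply (cross-before [] (v₂ s ∷ v₃ s ∷ []) M (v₁ t ∷ v₂ t ∷ []) [] N Q [] lngV w a u))
              where
              apply : (∃ λ D → IsCyc D × D ++ v₁ t ∷ v₂ t ∷ [] ↭ CV ++ Q ++ []) →
                      (Adj (v₁ t) v → Adj (v₂ t) v) × (Adj (v₂ t) v → Adj (v₁ t) v)
              apply (D , cyc , p) = detour cyc p q lenQ refl (proj₁ (steps t) ∷ end _) (∈-flat-I (seg∈ r) v∈) v∉
          right : ∀ r {v} → ξ r ≢ ξ s → v ∈ inside r → ¬ Adj (v₂ s) v × ¬ Adj (v₃ s) v
          right r {v} r≢s v∈ = reroute-back (fresh-walk back perm fresh-[])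
            where
            at : ∀ {u} (p : u ∈ inside s) → Adj u v → pos p + pos v∈ ≡ 2
            at p = link-pos s r (r≢s ∘ sym) p v∈
            v∉ : v ∉ v₂ s ∷ v₃ s ∷ []
            v∉ (here e)         = elsewhere r s r≢s v∈ (there (here e))
            v∉ (there (here e)) = elsewhere r s r≢s v∈ (there (there (here e)))
            conclude : (Adj (v₂ s) v → Adj (v₃ s) v) × (Adj (v₃ s) v → Adj (v₂ s) v) → ¬ Adj (v₂ s) v × ¬ Adj (v₃ s) v
            conclude (f , g) =
                (λ b → clash (ℕ.suc-injective (at (there (here refl)) b)) (ℕ.suc-injective (at (there (there (here refl))) (f b))))
              , (λ b → clash (ℕ.suc-injective (at (there (here refl)) (g b))) (ℕ.suc-injective (at (there (there (here refl))) b)))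
            reroute-back : (∃ λ Q → Walk (hd M (ξ t)) Q (hd N (ξ s)) × Q ↭ P × length Q ≡ 2 + j × Unique (CV ++ Q ++ [])) →
                           ¬ Adj (v₂ s) v × ¬ Adj (v₃ s) v
            reroute-back (Q , w , q , lenQ , u) =
              conclude (apply (cross-after [] (v₂ s ∷ v₃ s ∷ []) M (v₁ t ∷ v₂ t ∷ []) [] N Q [] lngV w a u))
              where
              apply : (∃ λ D → IsCyc D × D ++ v₂ s ∷ v₃ s ∷ [] ↭ CV ++ Q ++ []) →
                      (Adj (v₂ s) v → Adj (v₃ s) v) × (Adj (v₃ s) v → Adj (v₂ s) v)
              apply (D , cyc , p) = detour cyc p q lenQ refl (proj₂ (steps s) ∷ end _) (∈-flat-I (seg∈ r) v∈) v∉

        record Trio (A B D : Triple) : Set where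
          field
            A≢B   : ξ A ≢ ξ B
            A≢D   : ξ A ≢ ξ D
            B≢D   : ξ B ≢ ξ D
            cover : ∀ {ζ Z} → (ζ , Z) ∈ segs → 1 ≤ excess (ζ , Z) → ζ ≡ ξ A ⊎ ζ ≡ ξ B ⊎ ζ ≡ ξ D

        flip : ∀ {A B D} → Trio A B D → Trio B A D
        flip T = record { A≢B = A≢B ∘ sym ; A≢D = B≢D ; B≢D = A≢D
          ; cover = λ s l → case cover s l of λ { (inj₁ p) → inj₂ (inj₁ p) ; (inj₂ (inj₁ p)) → inj₁ p ; (inj₂ (inj₂ p)) → inj₂ (inj₂ p) } }
          where open Trio T

        turn : ∀ {A B D} → Trio A B D → Trio B D A
        turn T = record { A≢B = B≢D ; A≢D = A≢B ∘ sym ; B≢D = A≢D ∘ sym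
          ; cover = λ s l → case cover s l of λ { (inj₁ p) → inj₂ (inj₂ p) ; (inj₂ (inj₁ p)) → inj₁ p ; (inj₂ (inj₂ p)) → inj₂ (inj₁ p) } }
          where open Trio T

        module _ {A B D} (T : Trio A B D) where
          open Trio T

          no-path : ∀ {S} → PathFree S
          no-path u∈ s∈ v∈ _ w fr with ∈-∃++ v∈
          ... | Y₁ , Y₂ , refl = ℕ.<⇒≱ (proj₁ (path-link Y₁ Y₂ u∈ s∈ w fr)) (≤-reflexive j≡0)

          inside-of : ∀ t {Z} → (ξ t , Z) ∈ segs → ∀ {v} → v ∈ Z → v ∈ inside t
          inside-of t z∈ v∈ = subst (_ ∈_) (ξ-unique uC z∈ (seg∈ t)) v∈

          excess≤1 : ∀ {ζ Z} → (ζ , Z) ∈ segs → excess (ζ , Z) ≤ 1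
          excess≤1 {ζ} {Z} z∈ with 1 ≤? excess (ζ , Z)
          ... | no ¬l = ℕ.≤-pred (ℕ.m≤n⇒m≤1+n (ℕ.≰⇒> ¬l))
          ... | yes l = case cover z∈ l of λ
            { (inj₁ refl) → at A z∈ ; (inj₂ (inj₁ refl)) → at B z∈ ; (inj₂ (inj₂ refl)) → at D z∈ }
            where
            at : ∀ t {Z} → (ξ t , Z) ∈ segs → excess (ξ t , Z) ≤ 1
            at t z∈ rewrite ξ-unique uC z∈ (seg∈ t) = ℕ.m∸n≤m 1 j

          Pairs : (V → V → Set) → Set
          Pairs R = (∀ {u v} → u ∈ inside A → v ∈ inside B → R u v) ×
                    (∀ {u v} → u ∈ inside A → v ∈ inside D → R u v) ×
                    (∀ {u v} → u ∈ inside B → v ∈ inside D → R u v)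

          -- No arc has excess above one and a link needs two, so both of its arcs belong to the
          -- trio.
          links-in : ∀ {R : V → V → Set} → (∀ {u v} → R u v → R v u) → Pairs R →
                     ∀ {ζ Z η Y u v L} → (ζ , Z) ∈ segs → (η , Y) ∈ segs → ζ ≢ η → u ∈ Z → v ∈ Y →
                     Walk u L v → Fresh L → Adj u v × R u v
          links-in {R} R-sym (ab , ad , bd) {ζ} {Z} {η} {Y} s∈ t∈ ne u∈ v∈ w fr =
            proj₁ dir , go (cover s∈ (left (proj₂ dir) (excess≤1 t∈))) (cover t∈ (left (≤-trans (proj₂ dir) (≤-reflexive (ℕ.+-comm (excess (ζ , Z)) (excess (η , Y))))) (excess≤1 s∈)))
            where
            dir = direct s∈ t∈ ne u∈ v∈ w fr
            left : ∀ {a b} → 2 ≤ a + b → b ≤ 1 → 1 ≤ a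
            left {a} {b} l m = ℕ.+-cancelʳ-≤ 1 1 a (≤-trans l (+-monoʳ-≤ a m))
            go : ζ ≡ ξ A ⊎ ζ ≡ ξ B ⊎ ζ ≡ ξ D → η ≡ ξ A ⊎ η ≡ ξ B ⊎ η ≡ ξ D → R _ _
            go (inj₁ refl) (inj₁ refl) = ⊥-elim (ne refl)
            go (inj₁ refl) (inj₂ (inj₁ refl)) = ab (inside-of A s∈ u∈) (inside-of B t∈ v∈)
            go (inj₁ refl) (inj₂ (inj₂ refl)) = ad (inside-of A s∈ u∈) (inside-of D t∈ v∈)
            go (inj₂ (inj₁ refl)) (inj₁ refl) = R-sym (ab (inside-of A t∈ v∈) (inside-of B s∈ u∈))
            go (inj₂ (inj₁ refl)) (inj₂ (inj₁ refl)) = ⊥-elim (ne refl)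
            go (inj₂ (inj₁ refl)) (inj₂ (inj₂ refl)) = bd (inside-of B s∈ u∈) (inside-of D t∈ v∈)
            go (inj₂ (inj₂ refl)) (inj₁ refl) = R-sym (ad (inside-of A t∈ v∈) (inside-of D s∈ u∈))
            go (inj₂ (inj₂ refl)) (inj₂ (inj₁ refl)) = R-sym (bd (inside-of B t∈ v∈) (inside-of D s∈ u∈))
            go (inj₂ (inj₂ refl)) (inj₂ (inj₂ refl)) = ⊥-elim (ne refl)

          Off : V → V → V → Set
          Off b u v = Adj u v → u ≢ b → v ≢ b → ⊥

          star-trio : ∀ t {b} → b ∈ inside t → Pairs (Off b) → ⊥
          star-trio t {b} b∈ ps = star b (seg∈ t) b∈ no-path λ s∈ t∈ ne u∈ v∈ u≢ v≢ w fr →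
            let a , h = links-in {R = Off b} (λ h a p q → h (adj-sym a) q p) ps s∈ t∈ ne u∈ v∈ w fr in h a u≢ v≢

          module Corner (a : Adj (v₁ A) (v₃ B))
                        (unB : ∀ r {v} → ξ r ≢ ξ B → v ∈ inside r → ¬ Adj (v₁ B) v × ¬ Adj (v₂ B) v)
                        (unA : ∀ r {v} → ξ r ≢ ξ A → v ∈ inside r → ¬ Adj (v₂ A) v × ¬ Adj (v₃ A) v) where

            only-first : ∀ r {u v} → ξ r ≢ ξ A → u ∈ inside A → v ∈ inside r → Adj u v → u ≡ v₁ A
            only-first r ne (here e)                 v∈ _ = e
            only-first r ne (there (here refl))         v∈ e = ⊥-elim (proj₁ (unA r ne v∈) e)
            only-first r ne (there (there (here refl))) v∈ e = ⊥-elim (proj₂ (unA r ne v∈) e)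

            only-last : ∀ r {u v} → ξ r ≢ ξ B → u ∈ inside B → v ∈ inside r → Adj u v → u ≡ v₃ B
            only-last r ne (here refl)         v∈ e = ⊥-elim (proj₁ (unB r ne v∈) e)
            only-last r ne (there (here refl)) v∈ e = ⊥-elim (proj₂ (unB r ne v∈) e)
            only-last r ne (there (there (here e))) v∈ _ = e

            last-first : ∀ {v} (p : v ∈ inside D) → Adj (v₃ B) v → v ≡ v₁ D
            last-first p e = go p (link-pos B D B≢D (there (there (here refl))) p e)
              where
              go : ∀ {v} (p : v ∈ inside D) → 2 + pos p ≡ 2 → v ≡ v₁ D
              go (here e) _ = e
              go (there _) ()

            first-last : ∀ {v} (p : v ∈ inside D) → Adj (v₁ A) v → v ≡ v₃ D
            first-last p e = go p (link-pos A D A≢D (here refl) p e)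
              where
              go : ∀ {v} (p : v ∈ inside D) → pos p ≡ 2 → v ≡ v₃ D
              go (here _) ()
              go (there (here _)) ()
              go (there (there (here e))) _ = e

            at-first : ¬ Adj (v₃ B) (v₁ D) → ⊥
            at-first none = star-trio A {v₁ A} (here refl)
              ( (λ u∈ v∈ e u≢ _ → u≢ (only-first B (A≢B ∘ sym) u∈ v∈ e))
              , (λ u∈ v∈ e u≢ _ → u≢ (only-first D (A≢D ∘ sym) u∈ v∈ e))
              , (λ u∈ v∈ e _ _ → absurd v∈ e (only-last D (B≢D ∘ sym) u∈ v∈ e)) )
              where
              absurd : ∀ {u v} → v ∈ inside D → Adj u v → u ≡ v₃ B → ⊥
              absurd v∈ e refl = none (subst (Adj _) (last-first v∈ e) e)

            at-last : ¬ Adj (v₁ A) (v₃ D) → ⊥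
            at-last none = star-trio B {v₃ B} (there (there (here refl)))
              ( (λ u∈ v∈ e _ v≢ → v≢ (only-last A A≢B v∈ u∈ (adj-sym e)))
              , (λ u∈ v∈ e _ _ → absurd v∈ e (only-first D (A≢D ∘ sym) u∈ v∈ e))
              , (λ u∈ v∈ e u≢ _ → u≢ (only-last D (B≢D ∘ sym) u∈ v∈ e)) )
              where
              absurd : ∀ {u v} → v ∈ inside D → Adj u v → u ≡ v₁ A → ⊥
              absurd v∈ e refl = none (subst (Adj _) (first-last v∈ e) e)

            -- Besides the given edge, only `v₃ B` to `v₁ D` and `v₁ A` to `v₃ D` can be links. If
            -- either is missing, the remaining links share a vertex, which `star-trio` forbids; if
            -- both are present, `corner` for `A` and `D` rules out the first.
            impossible : ⊥
            impossible = at-first λ p → at-last λ q →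
              proj₁ (proj₁ (corner A D A≢D q) B B≢D (there (there (here refl)))) (adj-sym p)

          corner-impossible : ¬ Adj (v₁ A) (v₃ B)
          corner-impossible a = Corner.impossible a (proj₁ (corner A B A≢B a)) (proj₂ (corner A B A≢B a))

        -- An outside path L (or edge) joining v₁ and v₃ would allow the reroute
        -- ξ P η … v₃ L v₁ v₂ w₂ w₃, which leaves out w₁ only, for w₁ w₂ w₃ the inner
        -- vertices of the other arc.
        no-bypass : ∀ s t → ξ s ≢ ξ t → Adj (v₂ s) (v₂ t) → ∀ L → Walk (v₁ s) L (v₃ s) → Fresh L → ⊥
        no-bypass s t ne a L l fr = build (fresh-walk front perm fr)
          where
          open View (view (seg∈ s) (seg∈ t) ne)
          CV = ξ s ∷ inside s ++ M ++ ξ t ∷ inside t ++ N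
          around : Walk (ξ s) ((inside s ++ M) ++ ξ t ∷ inside t ++ N) (ξ s)
          around = proj₁ (proj₁ lngV)
          split = walk-split (inside s ++ M) around
          arc-s : Walk (ξ s) (inside s) (hd M (ξ t))
          arc-s = proj₁ (walk-cut (inside s) M (proj₁ split))
          arc-t : Walk (ξ t) (inside t) (hd N (ξ s))
          arc-t = proj₁ (walk-cut (inside t) N (proj₂ split))
          Z = v₃ s ∷ reverse L ++ v₁ s ∷ v₂ s ∷ v₂ t ∷ v₃ t ∷ []
          new : Walk (hd M (ξ t)) Z (hd N (ξ s))
          new = adj-sym (proj₂ (proj₂ (proj₂ arc-s))) , walk-join (reverse L) (walk-rev L l)
                  (proj₁ (proj₂ arc-s) , a , proj₂ (proj₂ arc-t))
          build : (∃ λ Q → Walk (ξ s) Q (ξ t) × Q ↭ P × length Q ≡ 2 + j × Unique (CV ++ Q ++ L)) → ⊥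
          build (Q , w , _ , lenQ , u) = apply (reroute (inside s) M (inside t) N Q Z [ v₁ t ] (Q ++ L) lngV w new swapped u)
            where
            swapped : (Q ++ Z) ++ [ v₁ t ] ↭ (inside s ++ inside t) ++ Q ++ L
            swapped = ↭-trans (Perm.++⁺ʳ [ v₁ t ] (Perm.++⁺ˡ Q (↭-prep (v₃ s) (Perm.++⁺ʳ (v₁ s ∷ v₂ s ∷ v₂ t ∷ v₃ t ∷ []) (Perm.↭-reverse L)))))
              (solve 8 (λ q l a₁ a₂ a₃ b₁ b₂ b₃ → (q ⊕ a₃ ⊕ l ⊕ a₁ ⊕ a₂ ⊕ b₂ ⊕ b₃) ⊕ b₁ ⊜ ((a₁ ⊕ a₂ ⊕ a₃) ⊕ (b₁ ⊕ b₂ ⊕ b₃)) ⊕ q ⊕ l)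
                ↭-refl Q L [ v₁ s ] [ v₂ s ] [ v₃ s ] [ v₁ t ] [ v₂ t ] [ v₃ t ])
            apply : (∃ λ D → IsCyc D × D ++ [ v₁ t ] ↭ CV ++ Q ++ L) → ⊥
            apply (D , cyc , p) = ℕ.<⇒≱ (≤-trans (≤-trans (s≤s (s≤s z≤n)) (≤-reflexive (sym lenQ)))
              (≤-trans (m≤m+n (length Q) (length L)) (≤-reflexive (sym (length-++ Q)))))
              (exchange-bound CV D [ v₁ t ] (Q ++ L) lngV cyc p)

        module _ {A B D} (T : Trio A B D) where
          open Trio T

          middles : ∀ s t → ξ s ≢ ξ t → ¬ Adj (v₁ s) (v₃ t) → ¬ Adj (v₁ t) (v₃ s) →
                    ∀ {u v} → u ∈ inside s → v ∈ inside t → Adj u v → u ≡ v₂ s × v ≡ v₂ t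
          middles s t ne no₁ no₂ p q e = go p q e (link-pos s t ne p q e)
            where
            go : ∀ {u v} (p : u ∈ inside s) (q : v ∈ inside t) → Adj u v → pos p + pos q ≡ 2 → u ≡ v₂ s × v ≡ v₂ t
            go (here refl) (there (there (here refl))) e _ = ⊥-elim (no₁ e)
            go (there (here u≡)) (there (here v≡)) e _ = u≡ , v≡
            go (there (there (here refl))) (here refl) e _ = ⊥-elim (no₂ (adj-sym e))
            go (here _) (here _) e ()
            go (here _) (there (here _)) e ()
            go (there (here _)) (here _) e ()
            go (there (here _)) (there (there (here _))) e ()
            go (there (there (here _))) (there (here _)) e ()
            go (there (there (here _))) (there (there (here _))) e ()

          Mid : Triple → Triple → V → V → Set
          Mid s t u v = u ≡ v₂ s × v ≡ v₂ t

          mid-AB : ∀ {u v} → u ∈ inside A → v ∈ inside B → Adj u v → Mid A B u v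
          mid-AB = middles A B A≢B (corner-impossible T) (corner-impossible (flip T))
          mid-AD : ∀ {u v} → u ∈ inside A → v ∈ inside D → Adj u v → Mid A D u v
          mid-AD = middles A D A≢D (corner-impossible (flip (turn (turn T)))) (corner-impossible (turn (turn T)))
          mid-BD : ∀ {u v} → u ∈ inside B → v ∈ inside D → Adj u v → Mid B D u v
          mid-BD = middles B D B≢D (corner-impossible (turn T)) (corner-impossible (flip (turn T)))

          second : ∀ t → v₂ t ∈ inside t
          second t = there (here refl)

          -- The links that remain all pass through `v₂ D`.
          missing-AB : ¬ Adj (v₂ A) (v₂ B) → ⊥
          missing-AB none = star-trio T D {v₂ D} (second D)
            ( (λ u∈ v∈ e _ _ → absurd (mid-AB u∈ v∈ e) e)
            , (λ u∈ v∈ e _ v≢ → v≢ (proj₂ (mid-AD u∈ v∈ e)))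
            , (λ u∈ v∈ e _ v≢ → v≢ (proj₂ (mid-BD u∈ v∈ e))) )
            where
            absurd : ∀ {u v} → Mid A B u v → Adj u v → ⊥
            absurd (refl , refl) e = none e

          module Full (ab : Adj (v₂ A) (v₂ B)) where

            -- Two extra cut vertices destroy all links but call for one more component than P and
            -- the arcs provide. It comes from the arc of `A`, which falls apart into `v₁ A` and
            -- `v₃ A` by `no-bypass`; hence the separate label for `v₃ A`.
            S : List V
            S = v₂ A ∷ v₂ B ∷ ξs

            Lab : V → V → Set
            Lab v w = (v ∈ P × w ≡ x) ⊎ (v ≡ v₃ A × w ≡ v₃ A) ⊎
                      (v ≢ v₃ A × ∃₂ λ ζ Z → (ζ , Z) ∈ segs × v ∈ Z × w ≡ ζ)

            third : v₃ A ∈ inside A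
            third = there (there (here refl))

            outside-path : ∀ {u v ζ Z L} → u ∈ P → (ζ , Z) ∈ segs → v ∈ Z → Walk u L v → Fresh L → ⊥
            outside-path u∈ z∈ v∈ w fr = no-path T {[]} u∈ z∈ v∈ (λ ()) w fr

            Apart : V → V → Set
            Apart u v = u ∉ S → v ∉ S → ⊥

            seg-seg : ∀ {ζ Z η Y u v L} → (ζ , Z) ∈ segs → (η , Y) ∈ segs → ζ ≢ η → u ∈ Z → v ∈ Y →
                      u ∉ S → v ∉ S → Walk u L v → Fresh L → ⊥
            seg-seg s∈ t∈ ne u∈ v∈ u∉ v∉ w fr =
              let a , h = links-in T {R = λ u v → Adj u v → Apart u v} (λ h a p q → h (adj-sym a) q p)
                    ( (λ p q e u∉ _ → u∉ (here (proj₁ (mid-AB p q e))))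
                    , (λ p q e u∉ _ → u∉ (here (proj₁ (mid-AD p q e))))
                    , (λ p q e u∉ _ → u∉ (there (here (proj₁ (mid-BD p q e))))) ) s∈ t∈ ne u∈ v∈ w fr
              in h a u∉ v∉

            rest-of-A : ∀ {v} → v ∈ inside A → v ∉ S → v ≢ v₃ A → v ≡ v₁ A
            rest-of-A (here e)                 _  _ = e
            rest-of-A (there (here e))         v∉ _ = ⊥-elim (v∉ (here e))
            rest-of-A (there (there (here e))) _  n = ⊥-elim (n e)

            A-label : ∀ {u Z ζ} → (ζ , Z) ∈ segs → u ∈ Z → u ∈ inside A → ζ ≡ ξ A
            A-label z∈ u∈ p = seg-unique uC z∈ (seg∈ A) u∈ p

            in-C : ∀ t {v} → v ∈ inside t → v ∈ C
            in-C t p = ∈-flat-I (seg∈ t) p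

            step : ∀ {u v L w} → Lab u w → u ∉ S → (v ∈ P ⊎ ∃₂ λ ζ Z → (ζ , Z) ∈ segs × v ∈ Z) → v ∉ S →
                   Walk u L v → Fresh L → Lab v w
            step (inj₁ (_ , e)) _ (inj₁ v∈P) _ _ _ = inj₁ (v∈P , e)
            step (inj₁ (u∈P , e)) _ (inj₂ (ζ , Z , z∈ , v∈)) _ w fr = ⊥-elim (outside-path u∈P z∈ v∈ w fr)
            step {L = L} (inj₂ (inj₁ (refl , e))) _ (inj₁ v∈P) _ w fr =
              ⊥-elim (outside-path v∈P (seg∈ A) third (proj₁ (walk-back L w fr)) (proj₂ (walk-back L w fr)))
            step {v = v} {L} (inj₂ (inj₁ (refl , e))) u∉ (inj₂ (ζ , Z , z∈ , v∈)) v∉ w fr with ζ ≟ ξ A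
            ... | no ne = ⊥-elim (seg-seg (seg∈ A) z∈ (ne ∘ sym) third v∈ u∉ v∉ w fr)
            ... | yes refl with v ≟ v₃ A
            ...   | yes v≡ = inj₂ (inj₁ (v≡ , e))
            ...   | no v≢ with rest-of-A (inside-of T A z∈ v∈) v∉ v≢
            ...     | refl = ⊥-elim (no-bypass A B A≢B ab (reverse L) (proj₁ (walk-back L w fr)) (proj₂ (walk-back L w fr)))
            step {L = L} (inj₂ (inj₂ (u≢ , ζ , Z , z∈ , u∈ , e))) _ (inj₁ v∈P) _ w fr =
              ⊥-elim (outside-path v∈P z∈ u∈ (proj₁ (walk-back L w fr)) (proj₂ (walk-back L w fr)))
            step {v = v} {L} (inj₂ (inj₂ (u≢ , ζ , Z , z∈ , u∈ , e))) u∉ (inj₂ (η , Y , y∈ , v∈)) v∉ w fr with ζ ≟ η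
            ... | no ne = ⊥-elim (seg-seg z∈ y∈ ne u∈ v∈ u∉ v∉ w fr)
            ... | yes refl with v ≟ v₃ A
            ...   | no v≢ = inj₂ (inj₂ (v≢ , ζ , Y , y∈ , v∈ , e))
            ...   | yes refl with A-label y∈ v∈ third
            ...     | refl with rest-of-A (inside-of T A z∈ u∈) u∉ u≢
            ...       | refl = ⊥-elim (no-bypass A B A≢B ab L w fr)

            place : ∀ {v} → inC⊎P v → v ∉ S → v ∈ P ⊎ ∃₂ λ ζ Z → (ζ , Z) ∈ segs × v ∈ Z
            place (inj₂ v∈P) _  = inj₁ v∈P
            place (inj₁ v∈C) v∉ = inj₂ (locate (λ q → there (there q)) v∈C v∉)

            first-of : Seg → V
            first-of (_ , Z) = hd Z x

            first∈ : ∀ {ζ Z} → (ζ , Z) ∈ segs → first-of (ζ , Z) ∈ Z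
            first∈ {Z = Z} z∈ = go Z (long z∈)
              where
              go : ∀ Z → 2 + j ≤ length Z → hd Z x ∈ Z
              go (_ ∷ _) _ = here refl

            first≢ : ∀ t {ζ Z} → (ζ , Z) ∈ segs → ∀ {w} → w ∈ v₂ t ∷ v₃ t ∷ [] → first-of (ζ , Z) ≢ w
            first≢ t {ζ} {Z} z∈ {w} w∈ e = go (seg-unique uC z∈ (seg∈ t) (first∈ z∈) (subst (_∈ inside t) (sym e) (there w∈)))
              where
              go : ζ ≡ ξ t → ⊥
              go refl = clash′ (ξ-unique uC z∈ (seg∈ t))
                where
                clash′ : Z ≡ inside t → ⊥
                clash′ refl with I-unique (seg∈ t)
                ... | h ∷ _ = All.lookup h w∈ e

            reps : List (V × V)
            reps = (x , x) ∷ (v₃ A , v₃ A) ∷ map (λ s → first-of s , proj₁ s) segs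

            ξs⊆C : ∀ {w} → w ∈ ξs → w ∈ C
            ξs⊆C q with ∈-map⁻ proj₁ q
            ... | t , t∈ , refl = ∈-flat-ξ t∈

            impossible : ⊥
            impossible = too-many {S} {Lab} (λ l u∉ i v∉ w fr → step l u∉ (place i v∉) v∉ w fr) reps
              ((x∉S , inj₂ x∈P , inj₁ (x∈P , refl)) ∷ (third∉S , inj₁ (in-C A third) , inj₂ (inj₁ (refl , refl)))
                 ∷ All.map⁺ (All.tabulate seg-rep))
              ((x-third ∷ All.map⁺ (All.tabulate x-seg)) ∷ All.map⁺ (All.tabulate third-seg) ∷
                 AllPairs.map⁺ (seg-pairs segs (λ p → p) (AllPairs.map⁻ (ξs-unique segs uC))))
              (s≤s (s≤s z≤n))
              (s≤s (s≤s (≤-reflexive (trans (length-map proj₁ segs) (sym (length-map _ segs))))))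
              where
              x∉C : x ∉ C
              x∉C = P∉C x∈P
              x∉S : x ∉ S
              x∉S (here refl)         = x∉C (in-C A (second A))
              x∉S (there (here refl)) = x∉C (in-C B (second B))
              x∉S (there (there q))   = x∉C (ξs⊆C q)
              third∉S : v₃ A ∉ S
              third∉S (here e) with I-unique (seg∈ A)
              ... | _ ∷ h ∷ _ = All.lookup h (here refl) (sym e)
              third∉S (there (here e)) = A≢B (seg-unique uC (seg∈ A) (seg∈ B) third (subst (_∈ inside B) (sym e) (second B)))
              third∉S (there (there q)) = I∉ξs (seg∈ A) third q
              seg-rep : ∀ {s} → s ∈ segs → first-of s ∉ S × inC⊎P (first-of s) × Lab (first-of s) (proj₁ s)
              seg-rep {s} s∈ = out , inj₁ (∈-flat-I s∈ (first∈ s∈)) ,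
                inj₂ (inj₂ (first≢ A s∈ (there (here refl)) , _ , _ , s∈ , first∈ s∈ , refl))
                where
                out : first-of s ∉ S
                out (here e)          = first≢ A s∈ (here refl) e
                out (there (here e))  = first≢ B s∈ (here refl) e
                out (there (there q)) = I∉ξs s∈ (first∈ s∈) q
              x-third : ¬ Lab (v₃ A) x
              x-third (inj₁ (p , _))                          = P∉C p (in-C A third)
              x-third (inj₂ (inj₁ (_ , e)))                   = x∉C (subst (_∈ C) (sym e) (in-C A third))
              x-third (inj₂ (inj₂ (n , _)))                   = n refl
              x-seg : ∀ {s} → s ∈ segs → ¬ Lab (first-of s) x
              x-seg s∈ (inj₁ (p , _))        = P∉C p (∈-flat-I s∈ (first∈ s∈))
              x-seg s∈ (inj₂ (inj₁ (_ , e))) = x∉C (subst (_∈ C) (sym e) (in-C A third))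
              x-seg s∈ (inj₂ (inj₂ (_ , ζ , Z , z∈ , _ , e))) = x∉C (subst (_∈ C) (sym e) (∈-flat-ξ z∈))
              third-seg : ∀ {s} → s ∈ segs → ¬ Lab (first-of s) (v₃ A)
              third-seg s∈ (inj₁ (p , _))        = P∉C p (∈-flat-I s∈ (first∈ s∈))
              third-seg s∈ (inj₂ (inj₁ (e , _))) = first≢ A s∈ (there (here refl)) e
              third-seg s∈ (inj₂ (inj₂ (_ , ζ , Z , z∈ , _ , e))) = ξ∉I uC (seg∈ A) z∈ (subst (_∈ inside A) e third)
              seg-pairs : ∀ ts → (∀ {s} → s ∈ ts → s ∈ segs) → AllPairs (λ s t → proj₁ s ≢ proj₁ t) ts →
                          AllPairs (λ s t → ¬ Lab (first-of t) (proj₁ s)) ts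
              seg-pairs []       _ []         = []
              seg-pairs (s ∷ ts) h (ap ∷ aps) = All.tabulate none ∷ seg-pairs ts (h ∘ there) aps
                where
                none : ∀ {t} → t ∈ ts → ¬ Lab (first-of t) (proj₁ s)
                none t∈ (inj₁ (p , _)) = P∉C p (∈-flat-I (h (there t∈)) (first∈ (h (there t∈))))
                none t∈ (inj₂ (inj₁ (e , _))) = first≢ A (h (there t∈)) (there (here refl)) e
                none t∈ (inj₂ (inj₂ (_ , ζ , Z , z∈ , p , e))) =
                  All.lookup ap t∈ (trans e (seg-unique uC z∈ (h (there t∈)) p (first∈ (h (there t∈)))))

          full-impossible : ¬ Adj (v₂ A) (v₂ B)
          full-impossible ab = Full.impossible ab

        trio-impossible : ∀ {A B D} → ¬ Trio A B D
        trio-impossible T = missing-AB T (full-impossible T)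

      -- How the excess can be distributed

      module FinaleOf {x y P} (K : Config x y P) (t≤3 : total excess (Config.segs K) ≤ 3)
                      (tight : j ≡ 0 ⊎ (j ≡ 1 × total excess (Config.segs K) ≤ 2)) where
        open Ending K t≤3
        open Thin K using (a-seg)

        zero-length : ∀ {ζ Z} → (ζ , Z) ∈ segs → ¬ 1 ≤ excess (ζ , Z) → length Z ≡ 2 + j
        zero-length z∈ ¬l = ℕ.≤-antisym (ℕ.m∸n≡0⇒m≤n (ℕ.n<1⇒n≡0 (ℕ.≰⇒> ¬l))) (long z∈)

        excess-length : ∀ {ζ Z e} → 2 + j + e ≤ length Z → e ≤ excess (ζ , Z)
        excess-length {Z = Z} {e} l = ≤-trans (≤-reflexive (sym (ℕ.m+n∸m≡n (2 + j) e))) (ℕ.∸-monoˡ-≤ (2 + j) l)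

        -- Both cases of `tight` lead to 5, as 2 + 3 and as 3 + 2.
        length≤5 : ∀ {ζ Z} → (ζ , Z) ∈ segs → length Z ≤ 5
        length≤5 {ζ} {Z} z∈ = ≤-trans (≤-reflexive (sym (ℕ.m+[n∸m]≡n (long z∈)))) (bnd tight)
          where
          bnd : j ≡ 0 ⊎ (j ≡ 1 × total excess segs ≤ 2) → 2 + j + excess (ζ , Z) ≤ 5
          bnd (inj₁ e) = subst (λ j → 2 + j + excess (ζ , Z) ≤ 5) (sym e) (+-monoʳ-≤ 2 (≤-trans (total-∈ excess z∈) t≤3))
          bnd (inj₂ (e , l)) = subst (λ i → 2 + i + excess (ζ , Z) ≤ 5) (sym e) (+-monoʳ-≤ 3 (≤-trans (total-∈ excess z∈) l))

        -- The position forced on the end of any link that comes from P or from an arc without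
        -- excess.
        Deep : List V → V → Set
        Deep J v = ∃₂ λ Y₁ Y₂ → J ≡ Y₁ ++ v ∷ Y₂ × 2 ≤ length Y₁ × 2 ≤ length Y₂

        deep-long : ∀ {J v} → Deep J v → 5 ≤ length J
        deep-long (Y₁ , Y₂ , refl , l , m) = ≤-trans (s≤s (+-mono-≤ l m)) (≤-reflexive (sym (length-split Y₁)))

        path-deep : ∀ {u v ζ Z L} → u ∈ P → (ζ , Z) ∈ segs → v ∈ Z → Walk u L v → Fresh L →
                    Deep Z v × 1 ≤ j × 2 ≤ excess (ζ , Z)
        path-deep u∈ z∈ v∈ w fr with ∈-∃++ v∈
        ... | Y₁ , Y₂ , refl = let a , b , c , d = path-link Y₁ Y₂ u∈ z∈ w fr in
          (Y₁ , Y₂ , refl , b , c) , a , ≤-trans (m≤m+n 2 _) d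

        zero-deep : ∀ {ζ Z η Y u v} → (ζ , Z) ∈ segs → ¬ 1 ≤ excess (ζ , Z) → (η , Y) ∈ segs → ζ ≢ η →
                    u ∈ Z → v ∈ Y → Adj u v → Deep Y v
        zero-deep z∈ ¬l y∈ ne u∈ v∈ a with ∈-∃++ v∈
        ... | Y₁ , Y₂ , refl = let b , c = zero-link z∈ (zero-length z∈ ¬l) Y₁ Y₂ y∈ ne u∈ a in Y₁ , Y₂ , refl , b , c

        Big : Seg → Set
        Big s = 1 ≤ excess s

        one-big : ∀ s t → 2 ≤ excess s + excess t → ¬ Big s → ¬ Big t → ⊥
        one-big s t l a b = ℕ.<⇒≱ l (≤-trans (+-mono-≤ (ℕ.≤-pred (ℕ.≰⇒> a)) (ℕ.≤-pred (ℕ.≰⇒> b))) z≤n)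

        no-big : (∀ {s} → s ∈ segs → ¬ Big s) → ⊥
        no-big none = merge (proj₂ a-seg) (proj₂ a-seg)
          (λ u∈ z∈ v∈ _ w fr → none z∈ (≤-trans (s≤s z≤n) (proj₂ (proj₂ (path-deep u∈ z∈ v∈ w fr)))))
          λ {ζ} {Z} {η} {Y} s∈ t∈ ne u∈ v∈ w fr →
            ⊥-elim (one-big (ζ , Z) (η , Y) (proj₂ (direct s∈ t∈ ne u∈ v∈ w fr)) (none s∈) (none t∈))

        module OneBig {β J} (β∈ : (β , J) ∈ segs) (only : ∀ {s} → s ∈ segs → Big s → s ≡ (β , J)) where

          path-lands : ∀ {u v ζ Z L} → u ∈ P → (ζ , Z) ∈ segs → v ∈ Z → Walk u L v → Fresh L → Deep J v
          path-lands {v = v} u∈ z∈ v∈ w fr = let d , _ , l = path-deep u∈ z∈ v∈ w fr in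
            subst (λ Z → Deep Z v) (cong proj₂ (only z∈ (≤-trans (s≤s z≤n) l))) d

          link-lands : ∀ {ζ Z η Y u v L} → (ζ , Z) ∈ segs → (η , Y) ∈ segs → ζ ≢ η → u ∈ Z → v ∈ Y →
                       Walk u L v → Fresh L → Deep J u ⊎ Deep J v
          link-lands {ζ} {Z} {η} {Y} {u} {v} s∈ t∈ ne u∈ v∈ w fr = go (direct s∈ t∈ ne u∈ v∈ w fr) (1 ≤? excess (ζ , Z)) (1 ≤? excess (η , Y))
            where
            go : Adj u v × 2 ≤ excess (ζ , Z) + excess (η , Y) → Dec (Big (ζ , Z)) → Dec (Big (η , Y)) → Deep J u ⊎ Deep J v
            go _ (yes p) (yes q) = ⊥-elim (ne (cong proj₁ (trans (only s∈ p) (sym (only t∈ q)))))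
            go (a , _) (yes p) (no q) = inj₁ (subst (λ Z → Deep Z u) (cong proj₂ (only s∈ p)) (zero-deep t∈ q s∈ (ne ∘ sym) v∈ u∈ (adj-sym a)))
            go (a , _) (no p) (yes q) = inj₂ (subst (λ Z → Deep Z v) (cong proj₂ (only t∈ q)) (zero-deep s∈ p t∈ ne u∈ v∈ a))
            go (_ , l) (no p) (no q) = ⊥-elim (one-big (ζ , Z) (η , Y) l p q)

          shallow : length J < 5 → ⊥
          shallow lt = merge β∈ β∈ (λ u∈ z∈ v∈ _ w fr → no-hit (path-lands u∈ z∈ v∈ w fr))
              λ s∈ t∈ ne u∈ v∈ w fr → ⊥-elim ([ no-hit , no-hit ]′ (link-lands s∈ t∈ ne u∈ v∈ w fr))
            where
            no-hit : ∀ {v} → ¬ Deep J v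
            no-hit d = ℕ.<⇒≱ lt (deep-long d)

          -- Of five vertices only the third is deep, so it is common to all links and may serve as
          -- the centre for `star`.
          five : ∀ J′ → J ≡ J′ → length J′ ≡ 5 → ⊥
          five (c₁ ∷ c₂ ∷ c₃ ∷ c₄ ∷ c₅ ∷ []) e _ = star c₃ β∈ (subst (c₃ ∈_) (sym e) (there (there (here refl))))
            (λ u∈ z∈ v∈ v∉ w fr → v∉ (here (centre (path-lands u∈ z∈ v∈ w fr))))
            λ s∈ t∈ ne u∈ v∈ u≢ v≢ w fr → [ u≢ ∘ centre , v≢ ∘ centre ]′ (link-lands s∈ t∈ ne u∈ v∈ w fr)
            where
            centre : ∀ {v} → Deep J v → v ≡ c₃
            centre (Y₁ , Y₂ , e′ , l , m) = middle-of-five Y₁ (trans (sym e) e′) l m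

          one-big-impossible : ⊥
          one-big-impossible with length J ℕ.<? 5
          ... | yes lt = shallow lt
          ... | no ¬lt = five J refl (ℕ.≤-antisym (length≤5 β∈) (ℕ.≮⇒≥ ¬lt))

        module TwoBig {α I β J} (α∈ : (α , I) ∈ segs) (β∈ : (β , J) ∈ segs) (ne : α ≢ β)
                      (big-α : Big (α , I)) (big-β : Big (β , J))
                      (only : ∀ {s} → s ∈ segs → Big s → s ≡ (α , I) ⊎ s ≡ (β , J)) where

          both : excess (α , I) + excess (β , J) ≤ total excess segs
          both = total-two excess α∈ β∈ (ne ∘ cong proj₁)

          -- A deep vertex requires five inner vertices and thus the entire excess that `tight`
          -- allows, but the other big arc holds some of it.
          no-deep : ∀ {ζ Z v} → (ζ , Z) ∈ segs → Big (ζ , Z) → ¬ Deep Z v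
          no-deep {ζ} {Z} z∈ big d = decide tight
            where
            other : ∀ {E} → E ≤ excess (ζ , Z) → suc E ≤ total excess segs
            other {E} l = case only z∈ big of λ
              { (inj₁ refl) → ≤-trans (≤-reflexive (ℕ.+-comm 1 E)) (≤-trans (+-mono-≤ l big-β) both)
              ; (inj₂ refl) → ≤-trans (+-mono-≤ big-α l) both }
            decide : j ≡ 0 ⊎ (j ≡ 1 × total excess segs ≤ 2) → ⊥
            decide (inj₁ e) = ℕ.<⇒≱ {3} (other (excess-length {ζ} {Z} (subst (λ i → 2 + i + 3 ≤ length Z) (sym e) (deep-long d)))) t≤3
            decide (inj₂ (e , l)) = ℕ.<⇒≱ {2} (other (excess-length {ζ} {Z} (subst (λ i → 2 + i + 2 ≤ length Z) (sym e) (deep-long d)))) l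

          two-big-impossible : ⊥
          two-big-impossible = merge α∈ β∈
            (λ u∈ z∈ v∈ _ w fr → let d , _ , l = path-deep u∈ z∈ v∈ w fr in no-deep z∈ (≤-trans (s≤s z≤n) l) d)
            λ {ζ} {Z} {η} {Y} s∈ t∈ ne′ u∈ v∈ w fr →
              go s∈ t∈ ne′ u∈ v∈ (direct s∈ t∈ ne′ u∈ v∈ w fr) (1 ≤? excess (ζ , Z)) (1 ≤? excess (η , Y))
            where
            go : ∀ {ζ Z η Y u v} → (ζ , Z) ∈ segs → (η , Y) ∈ segs → ζ ≢ η → u ∈ Z → v ∈ Y →
                 Adj u v × 2 ≤ excess (ζ , Z) + excess (η , Y) → Dec (Big (ζ , Z)) → Dec (Big (η , Y)) →
                 (ζ ≡ α × η ≡ β) ⊎ (ζ ≡ β × η ≡ α)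
            go {ζ} {Z} {η} {Y} s∈ t∈ ne′ u∈ v∈ (_ , l) (no p) (no q) = ⊥-elim (one-big (ζ , Z) (η , Y) l p q)
            go s∈ t∈ ne′ u∈ v∈ (a , _) (yes p) (no q) = ⊥-elim (no-deep s∈ p (zero-deep t∈ q s∈ (ne′ ∘ sym) v∈ u∈ (adj-sym a)))
            go s∈ t∈ ne′ u∈ v∈ (a , _) (no p) (yes q) = ⊥-elim (no-deep t∈ q (zero-deep s∈ p t∈ ne′ u∈ v∈ a))
            go s∈ t∈ ne′ u∈ v∈ _ (yes p) (yes q) with only s∈ p | only t∈ q
            ... | inj₁ refl | inj₁ refl = ⊥-elim (ne′ refl)
            ... | inj₁ refl | inj₂ refl = inj₁ (refl , refl)
            ... | inj₂ refl | inj₁ refl = inj₂ (refl , refl)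
            ... | inj₂ refl | inj₂ refl = ⊥-elim (ne′ refl)

        -- `bs` lists the arcs with positive excess. A total of at most 3 permits three of them only
        -- with excess one each, and then `tight` leaves just the case where `j` is 0.
        by-bigs : ∀ bs → (∀ {s} → s ∈ bs → s ∈ segs × Big s) → (∀ {s} → s ∈ segs → Big s → s ∈ bs) →
                  AllPairs (λ s t → proj₁ s ≢ proj₁ t) bs → total excess bs ≤ total excess segs → ⊥
        by-bigs [] _ all _ _ = no-big λ s∈ b → case all s∈ b of λ ()
        by-bigs (b ∷ []) mem all _ _ = OneBig.one-big-impossible (proj₁ (mem (here refl)))
          λ s∈ l → case all s∈ l of λ { (here e) → e }
        by-bigs (a ∷ b ∷ []) mem all ((ne ∷ []) ∷ _) _ =
          TwoBig.two-big-impossible (proj₁ (mem (here refl))) (proj₁ (mem (there (here refl)))) ne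
            (proj₂ (mem (here refl))) (proj₂ (mem (there (here refl))))
            λ s∈ l → case all s∈ l of λ { (here e) → inj₁ e ; (there (here e)) → inj₂ e }
        by-bigs (a ∷ b ∷ d ∷ []) mem all ((ab ∷ ad ∷ []) ∷ (bd ∷ []) ∷ _) t≤ = decide tight
          where
          three : 3 ≤ total excess (a ∷ b ∷ d ∷ [])
          three = +-mono-≤ (proj₂ (mem (here refl))) (+-mono-≤ (proj₂ (mem (there (here refl))))
                    (≤-trans (proj₂ (mem (there (there (here refl))))) (m≤m+n _ 0)))
          decide : j ≡ 0 ⊎ (j ≡ 1 × total excess segs ≤ 2) → ⊥
          decide (inj₂ (_ , l)) = ℕ.<⇒≱ (≤-trans three t≤) l
          decide (inj₁ j≡0) = trio-impossible {A = triple a (here refl)} {triple b (there (here refl))} {triple d (there (there (here refl)))}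
              record { A≢B = ab ; A≢D = ad ; B≢D = bd
                     ; cover = λ s∈ l → case all s∈ l of λ
                         { (here refl) → inj₁ refl ; (there (here refl)) → inj₂ (inj₁ refl)
                         ; (there (there (here refl))) → inj₂ (inj₂ refl) } }
            where
            open TrioOf K t≤3 j≡0 using (Triple; Trio; trio-impossible)
            one : ∀ {s} → s ∈ a ∷ b ∷ d ∷ [] → excess s ≡ 1
            one {s} s∈ = ℕ.≤-antisym (≤1 s∈) (proj₂ (mem s∈))
              where
              sum3 : ∀ {x y z} → x + (y + (z + 0)) ≤ 3 → 1 ≤ y → 1 ≤ z → x ≤ 1
              sum3 {x} {y} {z} l m o = ℕ.+-cancelʳ-≤ 2 x 1 (≤-trans (+-monoʳ-≤ x (+-mono-≤ m (≤-trans o (m≤m+n z 0)))) l)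
              sum3′ : ∀ {x y z} → x + (y + (z + 0)) ≤ 3 → 1 ≤ x → 1 ≤ z → y ≤ 1
              sum3′ {x} {y} {z} l m o = sum3 {y} {x} {z} (≤-trans (≤-reflexive (arith x y z)) l) m o
                where
                arith : ∀ x y z → y + (x + (z + 0)) ≡ x + (y + (z + 0))
                arith = solve-∀
              sum3″ : ∀ {x y z} → x + (y + (z + 0)) ≤ 3 → 1 ≤ x → 1 ≤ y → z ≤ 1
              sum3″ {x} {y} {z} l m o = sum3 {z} {x} {y} (≤-trans (≤-reflexive (arith x y z)) l) m o
                where
                arith : ∀ x y z → z + (x + (y + 0)) ≡ x + (y + (z + 0))
                arith = solve-∀
              l3 = ≤-trans t≤ t≤3
              ≤1 : ∀ {s} → s ∈ a ∷ b ∷ d ∷ [] → excess s ≤ 1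
              ≤1 (here refl) = sum3 l3 (proj₂ (mem (there (here refl)))) (proj₂ (mem (there (there (here refl)))))
              ≤1 (there (here refl)) = sum3′ l3 (proj₂ (mem (here refl))) (proj₂ (mem (there (there (here refl)))))
              ≤1 (there (there (here refl))) = sum3″ l3 (proj₂ (mem (here refl))) (proj₂ (mem (there (here refl))))
            triple : ∀ s → s ∈ a ∷ b ∷ d ∷ [] → Triple
            triple s s∈ = record { ξ = proj₁ s ; v₁ = proj₁ vs ; v₂ = proj₁ (proj₂ vs) ; v₃ = proj₁ (proj₂ (proj₂ vs))
                                 ; seg∈ = subst (λ Z → (proj₁ s , Z) ∈ segs) (proj₂ (proj₂ (proj₂ vs))) (proj₁ (mem s∈)) }
              where
              split : ∀ (Z : List V) → length Z ≡ 3 → ∃₂ λ v₁ v₂ → ∃ λ v₃ → Z ≡ v₁ ∷ v₂ ∷ v₃ ∷ []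
              split (v₁ ∷ v₂ ∷ v₃ ∷ []) _ = v₁ , v₂ , v₃ , refl
              vs = split (proj₂ s) (trans (sym (ℕ.m+[n∸m]≡n (long (proj₁ (mem s∈)))))
                                     (cong₂ (λ i e → 2 + i + e) j≡0 (one s∈)))
        by-bigs (a ∷ b ∷ d ∷ e ∷ bs) mem all _ t≤ = ℕ.<⇒≱ {3} (≤-trans four t≤) t≤3
          where
          four : 4 ≤ total excess (a ∷ b ∷ d ∷ e ∷ bs)
          four = +-mono-≤ (proj₂ (mem (here refl))) (+-mono-≤ (proj₂ (mem (there (here refl))))
                   (+-mono-≤ (proj₂ (mem (there (there (here refl)))))
                     (≤-trans (proj₂ (mem (there (there (there (here refl)))))) (m≤m+n _ _))))

        finish : ⊥
        finish = by-bigs (filter big? segs) (λ s∈ → ∈-filter⁻ big? s∈) (λ s∈ b → ∈-filter⁺ big? s∈ b)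
          (AllPairs.filter⁺ big? (AllPairs.map⁻ (ξs-unique segs uC))) (total-filter excess big? segs)
          where
          big? : ∀ s → Dec (Big s)
          big? s = 1 ≤? excess s

      -- Conclusion

      no-config : ∀ {x y P} → Config x y P → ⊥
      no-config K = decide (Config.bound K)
        where
        decide : _ → ⊥
        decide (inj₁ l)              = Thin.thin K l
        decide (inj₂ (inj₁ (e , l))) = FinaleOf.finish K l (inj₁ e)
        decide (inj₂ (inj₂ (e , l))) = FinaleOf.finish K (≤-trans l (s≤s (s≤s z≤n))) (inj₂ (e , l))

    -- Induction on n − |P|: by the induction hypothesis P has maximal length.
    no-outside-path : ∀ m j {C x y P} → Lng C → Path Adj x y P → Unique (C ++ P) → length P ≡ 2 + j →
                      n < 2 + j + m → ⊥
    no-outside-path zero j {C} l p u e lt = ℕ.<⇒≱ lt (≤-trans (≤-reflexive (trans (ℕ.+-identityʳ (2 + j)) (sym e)))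
      (Unique-length≤ (Unique-++⁻ʳ C u)))
    no-outside-path (suc m) j l p u e lt =
      Extremal.no-config j maximal
        (proj₁ (Extremal.configure j maximal (Extremal.outer l p u e)))
      where
      maximal : ∀ {C x y P} → Lng C → Path Adj x y P → Unique (C ++ P) → length P ≤ 2 + j
      maximal {P = P} l p u = decidable-stable (length P ≤? 2 + j) λ ¬le → longer (ℕ.≰⇒> ¬le)
        where
        longer : 2 + j < length P → ⊥
        longer gt = no-outside-path m (length P ∸ 2) l p u size (≤-trans lt (≤-trans (≤-reflexive (ℕ.+-suc (2 + j) m))
            (ℕ.+-monoˡ-≤ m (≤-trans gt (≤-reflexive size)))))
          where
          size : length P ≡ 2 + (length P ∸ 2)
          size = sym (ℕ.m+[n∸m]≡n (≤-trans (s≤s (s≤s z≤n)) gt))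

    no-outside-edge : ∀ {C u v} → Lng C → u ∉ C → v ∉ C → ¬ Adj u v
    no-outside-edge {C} {u} {v} l u∉ v∉ a = no-outside-path (suc n) 0 l (a ∷ end v)
      (Unique.++⁺ (cyc-unique C (proj₁ l)) (Unique-∷ (λ { (here refl) → irrefl refl a }) ([] ∷ []))
        λ { (c , here refl) → u∉ c ; (c , there (here refl)) → v∉ c }) refl (s≤s (≤-trans (ℕ.n≤1+n n) (ℕ.n≤1+n (suc n))))

  longest-dominating : Toughness → ∀ δ → (∀ v → δ ≤ degree G v) → n ≤ 3 * δ + 2 →
                       ∀ C → IsLongestCycle G C → Dominating G C
  longest-dominating tough δ δ≤ n≤ C (cyc , longest) {u} {v} u∉ v∉ a =
    -- The outside edge is itself a cycle of two vertices, so `C` is not the single-vertex cycle and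
    -- satisfies `IsCyc`.
    LongestCycle.no-outside-edge tough (length C) longest′ δ δ≤ n≤ (proper C cyc (longest′ _ edge) , refl) u∉ v∉ a
    where
    longest′ : ∀ D → IsCyc D → length D ≤ length C
    longest′ D c = longest D (cyc⇒cycle D c)
    edge : IsCyc (u ∷ v ∷ [])
    edge = (a , adj-sym a) , Unique-∷ (λ { (here refl) → irrefl refl a }) ([] ∷ [])
    proper : ∀ C → IsCycle G C → 2 ≤ length C → IsCyc C
    proper _ (single _) (s≤s ())
    proper (_ ∷ _ ∷ vs) (closed uniq l) _ = linked⇒walk (_ ∷ vs) l , uniq

open import Data.Integer.Base using (+_; _-_)
open import Data.Rational.Base using (ℚ; _/_; _≤_; _<_; 1ℚ)
open import Relation.Nullary.Construct.Add.Supremum using (_⁺; [_])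
open import Relation.Binary.Construct.Add.Supremum.Strict _<_ using (_<⁺_)
open import Data.Product.Base using (_,_)

theorem1 : (n : ℕ) (G : Graph n) (δ : ℕ) (τ : ℚ ⁺) →
    IsMinDegree G δ →
    IsToughness G τ →
    [ 1ℚ ] <⁺ τ →
    (+ n - + 2) / 3 ≤ + δ / 1 →
    (C : List (Fin n)) → IsLongestCycle G C → Dominating G C
theorem1 n G δ τ (_ , δ≤) toughness 1<τ n≤ =
  Argument.longest-dominating G (Components.tough G τ toughness 1<τ) δ δ≤ (Components.third-bound G {n} {δ} n≤)
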